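{- Let $\ell$ be a prime, $p\ne\ell$ a prime, $n\ge1$, and let $G=G(\ell,p,n)$. Write $p^n-1=\ell^{\lambda^- }\omega^-$ and $p^n+1=\ell^{\lambda^+}\omega^+$ with $\gcd(\ell,\omega^-)=\gcd(\ell,\omega^+)=1$. (1) For each divisor $d>2$ of $\omega^-$, $G$ contains $\varphi(d)/(2c(d))$ cycles of length $c(d)$ (namely those whose vertices are of the form $\alpha+\alpha^{ -1}$ with $\alpha\in\mathbb{F}_{p^n}^\times$ of order $d$). If $\lambda^-\ge1$, every vertex in these cycles is adjacent to (i.e. is the image under $T_\ell$ of exactly) $\ell-1$ strictly preperiodic vertices, and each of these preperiodic vertices is the root of a complete $\ell$-ary tree of height $\lambda^--1$. (2) For each divisor $d>2$ of $\omega^+$, $G$ contains $\varphi(d)/(2c(d))$ cycles of length $c(d)$ (namely those whose vertices are of the form $\alpha+\alpha^{ -1}$ with $\alpha$ of order $d$ in the cyclic subgroup of order $p^n+1$ of $\mathbb{F}_{p^{2n}}^\times$). If $\lambda^+\ge1$, every vertex in these cycles is adjacent to $\ell-1$ strictly preperiodic vertices, and each of these preperiodic vertices is the root of a complete $\ell$-ary tree of height $\lambda^+-1$. (3) If $\ell$ is odd, the vertices $2$ and $-2$ are fixed. If $\max\{\lambda^-,\lambda^+\}\ge1$, each of these two vertices is adjacent to $(\ell-1)/2$ strictly preperiodic vertices, and each of these preperiodic vertices is the root of a complete $\ell$-ary tree of height $\max\{\lambda^-,\lambda^+\}-1$. (4) If $\ell=2$, then $G$ contains the edges $(2,2)$,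 $(-2,2)$ and $(0,-2)$. Moreover, $0$ is the root of a complete binary tree of height $\max\{\lambda^-,\lambda^+\}-2$.
   Context: $T_\ell\in\mathbb{Z}[x]$ is the Chebyshev polynomial of the first kind of degree $\ell$, defined by $T_\ell(z+z^{ -1})=z^\ell+z^{ -\ell}$. $G(\ell,p,n)$ is the directed graph whose vertices are the elements of $\mathbb{F}_{p^n}$, with a directed edge $(a,b)$ iff $T_\ell(a)=b$ (coefficients reduced mod $p$). Preperiod/period are with respect to $T_\ell$: $a$ has preperiod $\rho$ if $\rho\ge0,\pi\ge1$ are minimal with $T_\ell^{\rho+\pi}(a)=T_\ell^\rho(a)$; $a$ is strictly preperiodic if $\rho>0$, periodic if $\rho=0$. $c(d)$ is the order of $\ell$ in $(\mathbb{Z}/d\mathbb{Z})^\times/\{\pm1\}$; $\varphi$ is Euler's totient. A vertex $b$ is the root of a rooted tree meaning the subgraph consisting of all vertices $c$ with $T_\ell^j(c)=b$ for some $j\ge0$, with edges $c\to T_\ell(c)$ (excluding the edge out of $b$), all edges oriented towards $b$. The indegree of a vertex is its number of incoming edges, a leaf has indegree $0$, the height of a vertex is its distance to the root, the height of the tree is the length of its longest path. The tree is $\ell$-ary if every non-leaf has indegree $\ell$, and complete $\ell$-ary if moreover all leaves have the same height. -}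

module Defs where

open import Level using (0ℓ)
open import Data.Nat as ℕ using (ℕ; zero; suc; _∸_; _^_; _≤_; _<_; _≟_)
open import Data.Nat.Divisibility using (_∣_)
open import Data.Nat.GCD using (gcd)
open import Data.List using (List; length; filter; applyUpTo)
open import Data.List.Membership.Propositional using (_∈_)
open import Data.List.Relation.Unary.Unique.Propositional using (Unique)
open import Data.Product using (Σ; ∃; _×_; _,_; proj₁; proj₂)
open import Data.Sum using (_⊎_)
open import Data.Fin using (Fin)
open import Function.Bundles using (_↔_)
open import Algebra.Core using (Op₁; Op₂)
open import Algebra.Structures using (IsCommutativeRing)
open import Relation.Binary.PropositionalEquality using (_≡_; _≢_)
open import Relation.Nullary using (¬_)

totient : ℕ → ℕ
totient d = length (filter (λ k → gcd k d ≟ 1) (applyUpTo suc d))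

-- IsCOrder ℓ d c : c = c(d), the order of ℓ in (ℤ/dℤ)ˣ/{±1},
-- i.e. the least c ≥ 1 with ℓ^c ≡ ±1 (mod d).
PlusMinusOne : ℕ → ℕ → ℕ → Set
PlusMinusOne ℓ d c = (d ∣ (ℓ ^ c ∸ 1)) ⊎ (d ∣ (ℓ ^ c ℕ.+ 1))

IsCOrder : ℕ → ℕ → ℕ → Set
IsCOrder ℓ d c = 1 ≤ c × PlusMinusOne ℓ d c
               × (∀ k → 1 ≤ k → k < c → ¬ PlusMinusOne ℓ d k)

-- A finite field with q elements (equality is propositional).
-- F_{p^n} is represented by an arbitrary field with p^n elements
-- (unique up to isomorphism).

record FiniteField (q : ℕ) : Set₁ where
  infixl 6 _+_
  infixl 7 _*_
  field
    Carrier : Set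
    _+_ _*_ : Op₂ Carrier
    -_ : Op₁ Carrier
    0# 1# : Carrier
    isCommutativeRing : IsCommutativeRing _≡_ _+_ _*_ -_ 0# 1#
    0≢1 : 0# ≢ 1#
    inverse : ∀ x → x ≢ 0# → ∃ λ y → x * y ≡ 1#
    enumeration : Carrier ↔ Fin q

record FieldHom {q r : ℕ} (F : FiniteField q) (K : FiniteField r) : Set where
  private
    module F = FiniteField F
    module K = FiniteField K
  field
    ⟦_⟧ : F.Carrier → K.Carrier
    hom-0 : ⟦ F.0# ⟧ ≡ K.0#
    hom-1 : ⟦ F.1# ⟧ ≡ K.1#
    hom-+ : ∀ x y → ⟦ x F.+ y ⟧ ≡ ⟦ x ⟧ K.+ ⟦ y ⟧
    hom-* : ∀ x y → ⟦ x F.* y ⟧ ≡ ⟦ x ⟧ K.* ⟦ y ⟧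
    hom-- : ∀ x → ⟦ F.- x ⟧ ≡ K.- ⟦ x ⟧

module _ {q : ℕ} (F : FiniteField q) where
  open FiniteField F

  two : Carrier
  two = 1# + 1#

  pow : Carrier → ℕ → Carrier
  pow x zero = 1#
  pow x (suc k) = x * pow x k

  MulOrder : Carrier → ℕ → Set
  MulOrder α d = 1 ≤ d × pow α d ≡ 1# × (∀ k → 1 ≤ k → k < d → pow α k ≢ 1#)

  HasCard : (Carrier → Set) → ℕ → Set
  HasCard P m = Σ (List Carrier) λ xs → length xs ≡ m × Unique xs
                × (∀ x → (x ∈ xs → P x) × (P x → x ∈ xs))

  chebPair : ℕ → Carrier → Carrier × Carrier
  chebPair zero x = two , x
  chebPair (suc k) x = proj₂ (chebPair k x) , x * proj₂ (chebPair k x) + - proj₁ (chebPair k x)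

  cheb : ℕ → Carrier → Carrier
  cheb k x = proj₁ (chebPair k x)

module _ {q : ℕ} (F : FiniteField q) (ℓ : ℕ) where
  open FiniteField F

  T : Carrier → Carrier
  T = cheb F ℓ

  iter : ℕ → Carrier → Carrier
  iter zero x = x
  iter (suc j) x = T (iter j x)

  Periodic : Carrier → Set
  Periodic x = ∃ λ π → 1 ≤ π × iter π x ≡ x

  StrictlyPreperiodic : Carrier → Set
  StrictlyPreperiodic x =
    (∃ λ ρ → ∃ λ π → 1 ≤ π × iter (ρ ℕ.+ π) x ≡ iter ρ x) × ¬ Periodic x

  HasPeriod : Carrier → ℕ → Set
  HasPeriod x c = 1 ≤ c × iter c x ≡ x × (∀ j → 1 ≤ j → j < c → iter j x ≢ x)

  UnionOfCycles : (Carrier → Set) → ℕ → ℕ → Set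
  UnionOfCycles S k c = (∀ x → S x → S (T x)) × (∀ x → S x → HasPeriod x c)
                        × HasCard F S (k ℕ.* c)

  InTree : Carrier → Carrier → Set
  InTree b c = ∃ λ j → iter j c ≡ b

  HeightIs : Carrier → Carrier → ℕ → Set
  HeightIs b c h = iter h c ≡ b × (∀ j → j < h → iter j c ≢ b)

  -- indegree of c in the tree rooted at b (the edge out of b is excluded)
  Indeg : Carrier → Carrier → ℕ → Set
  Indeg b c k = HasCard F (λ u → T u ≡ c × u ≢ b) k

  CompleteAryTree : Carrier → ℕ → Set
  CompleteAryTree b h =
    (∀ c → InTree b c → Indeg b c 0 ⊎ Indeg b c ℓ)
    × (∀ c h' → InTree b c → Indeg b c 0 → HeightIs b c h' → h' ≡ h)
    × (∃ λ c → HeightIs b c h)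
    × (∀ c h' → HeightIs b c h' → h' ≤ h)

  HangingTrees : Carrier → ℕ → ℕ → Set
  HangingTrees v m h =
    HasCard F (λ u → T u ≡ v × StrictlyPreperiodic u) m
    × (∀ u → T u ≡ v → StrictlyPreperiodic u → CompleteAryTree u h)

ConjSum : {q : ℕ} (F : FiniteField q) → ℕ → FiniteField.Carrier F → Set
ConjSum F d x = ∃ λ α → ∃ λ β → α * β ≡ 1# × MulOrder F α d × x ≡ α + β
  where open FiniteField F

-- vertices x ∈ F with ι x = α + α⁻¹, α of order d in the subgroup of
-- order N (= p^n + 1) of Kˣ
ConjSumExt : {q r : ℕ} (F : FiniteField q) (K : FiniteField r) → FieldHom F K →
             ℕ → ℕ → FiniteField.Carrier F → Set
ConjSumExt F K ι N d x =
  ∃ λ α → ∃ λ β → α * β ≡ 1# × pow K α N ≡ 1# × MulOrder K α d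
  × FieldHom.⟦_⟧ ι x ≡ α + β
  where open FiniteField K

{-# OPTIONS --safe #-}
module Submission where

-- Write the vertices of G as γ + γ⁻¹ with γ in the quadratic extension K of F = F_q. The elements with
-- γ^(q-1) = 1 or γ^(q+1) = 1 give q distinct values γ + γ⁻¹ in F, hence all of F, and γ is determined up to
-- inversion. As T_ℓ(γ + γ⁻¹) = γ^ℓ + γ^(-ℓ), the graph G is the power map γ ↦ γ^ℓ on two cyclic groups, of
-- orders q - 1 and q + 1, modulo γ ~ γ⁻¹. Elements of order prime to ℓ are permuted and form the cycles;
-- in a cyclic group of order ℓ^λ ω the other elements lie over them in trees, where a node has no preimage
-- exactly when ℓ^λ divides the order of γ, and ℓ preimages otherwise. For γ = ±1 inversion also identifies
-- the roots of γ in pairs, which gives the (ℓ - 1)/2 in part (3).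

open import Defs
open import Level using (0ℓ)
open import Algebra.Bundles using (CommutativeRing)
import Algebra.Properties.AbelianGroup
import Algebra.Properties.CommutativeMonoid.Sum
import Algebra.Properties.CommutativeSemiring.Binomial
import Algebra.Properties.Ring
import Algebra.Properties.Semiring.Exp
import Algebra.Properties.Semiring.Mult
import Algebra.Solver.Ring
open import Algebra.Solver.Ring.AlmostCommutativeRing using (fromCommutativeRing; _-Raw-AlmostCommutative⟶_)
open import Data.Empty using (⊥)
open import Data.Fin using (Fin; zero; suc; toℕ; fromℕ; inject₁)
open import Data.Fin.Permutation using (permutation)
import Data.Fin.Properties as Fin
import Data.Integer as ℤ
import Data.Integer.Properties as ℤ
open import Data.List using (List; []; _∷_; length; lookup; replicate; applyUpTo; map; allFin; _++_; filter)
open import Data.List.Membership.Propositional using (_∈_; _∉_; lose)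
open import Data.List.Membership.Propositional.Properties
open import Data.List.Properties using (length-replicate; length-applyUpTo; length-map; length-tabulate; length-++)
open import Data.List.Relation.Unary.All as All using (All; []; _∷_; all?)
import Data.List.Relation.Unary.All.Properties as All
open import Data.List.Relation.Unary.AllPairs as AllPairs using (AllPairs; []; _∷_)
import Data.List.Relation.Unary.AllPairs.Properties as AllPairs
open import Data.List.Relation.Unary.Any as Any using (Any; here; there; index)
open import Data.List.Relation.Unary.Any.Properties using (lookup-index)
open import Data.List.Relation.Unary.Unique.Propositional using (Unique)
import Data.List.Relation.Unary.Unique.Propositional.Properties as Unique
import Data.Maybe as Maybe
open import Data.Nat using (ℕ; zero; suc; _+_; _*_; _∸_; _^_; _≤_; _<_; _⊔_; _/_; _%_; _!; z≤n; s≤s; _≤?_; ⌊_/2⌋; ⌈_/2⌉; NonZero; >-nonZero; >-nonZero⁻¹; ≢-nonZero⁻¹; nonTrivial⇒n>1)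
import Data.Nat as ℕ
open import Data.Nat.Combinatorics using (_C_; nCn≡1; nCk≡n!/k![n-k]!)
open import Data.Nat.Combinatorics.Specification using ([n∸k]!k!∣n!)
open import Data.Nat.Coprimality as Coprimality using (Coprime; coprime-divisor; coprime-Bézout; gcd≡1⇒coprime)
open import Data.Nat.DivMod using (m≡m%n+[m/n]*n; m%n<n; m/n*n≡m)
open import Data.Nat.Divisibility
open import Data.Nat.GCD using (gcd; gcd[m,n]∣m; gcd[m,n]∣n; mkGCD; module GCD; module Bézout)
open import Data.Nat.Primality using (Prime; prime[2]; euclidsLemma; prime⇒nonZero; prime⇒nonTrivial; prime⇒irreducible)
open import Data.Nat.Primality.Factorisation using (factorise)
open import Data.Nat.Properties hiding (_≟_)
open import Data.Nat.Solver using (module +-*-Solver)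
open import Data.Product using (∃; _×_; _,_; proj₁; proj₂)
open import Data.Product.Function.NonDependent.Propositional using (_×-↔_)
open import Data.Sum as Sum using (_⊎_; inj₁; inj₂)
open import Function using (_∘_; id; case_of_)
open import Function.Bundles using (_↔_; Inverse)
open import Function.Construct.Composition using (_↔-∘_)
open import Function.Construct.Symmetry using (↔-sym)
open import Relation.Binary.Definitions using (DecidableEquality; Tri; tri<; tri≈; tri>)
open import Relation.Binary.PropositionalEquality using (_≡_; _≢_; refl; sym; trans; cong; cong₂; subst; subst₂; isEquivalence; module ≡-Reasoning)
open import Relation.Nullary using (¬_; Dec; yes; no; contradiction)
open import Relation.Nullary.Decidable using (¬?; _×-dec_; _→-dec_; map′; dec⇒maybe)
open import Relation.Unary using (Decidable)

-- Two facts make this picture available. The multiplicative group of K is cyclic, so by q² - 1 = (q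
-- - 1)(q + 1) one primitive root supplies generators of both groups. And a quadratic extension
-- exists: counting yields some t² - ut + 1 without a root, in characteristic 2 as well. The
-- bookkeeping device is the number of factors ℓ in the order of γ, which grows by one with each
-- step away from the root of a tree. The heights are differences of such numbers: a tree hanging on
-- a cycle starts at 1 and ends at λ, so its height is λ - 1; for ℓ = 2 the vertex 0 = i + i⁻¹
-- starts at 2, which gives λ - 2. The elements γ = ±1 lie in both groups. Above them, roots may
-- come from either group and mutually inverse roots give one vertex, hence the recurring condition
-- `γ ↑ 2 ≢ 𝟙`. The maximum of the two exponents selects the group that matters: an odd ℓ divides at
-- most one of q - 1 and q + 1, and for odd q exactly one of them is divisible by 4.

-- Coprimality and prime factors of natural numbers

least : ∀ {P : ℕ → Set} → Decidable P → ∀ {n} → P n → ∃ λ m → P m × (∀ k → k < m → ¬ P k)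
least P? {zero}  p = 0 , p , λ _ ()
least {P} P? {suc n} p with P? 0
... | yes p₀ = 0 , p₀ , λ _ ()
... | no ¬p₀ with least {P ∘ suc} (P? ∘ suc) p
... | m , pm , min = suc m , pm , λ { zero _ → ¬p₀ ; (suc k) (s≤s k<m) → min k k<m }

coprime-*ˡ : ∀ {a b m} → Coprime a m → Coprime b m → Coprime (a * b) m
coprime-*ˡ {a} a⊥m b⊥m {i} (i∣ab , i∣m) = b⊥m (coprime-divisor i⊥a i∣ab , i∣m)
  where
  i⊥a : Coprime i a
  i⊥a (j∣i , j∣a) = a⊥m (j∣a , ∣-trans j∣i i∣m)

coprime-^ˡ : ∀ {a m} k → Coprime a m → Coprime (a ^ k) m
coprime-^ˡ zero    _   (i∣1 , _) = ∣1⇒≡1 i∣1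
coprime-^ˡ (suc k) a⊥m = coprime-*ˡ a⊥m (coprime-^ˡ k a⊥m)

coprime-∣ : ∀ {a m n} → Coprime a m → n ∣ m → Coprime a n
coprime-∣ a⊥m n∣m (i∣a , i∣n) = a⊥m (i∣a , ∣-trans i∣n n∣m)

coprime-*-∣ : ∀ {m n k} → Coprime m n → m ∣ k → n ∣ k → m * n ∣ k
coprime-*-∣ {m} {n} m⊥n m∣k (divides t refl) =
  *-monoˡ-∣ n (coprime-divisor m⊥n (subst (m ∣_) (*-comm t n) m∣k))

prime-∤⇒coprime : ∀ {r m} → Prime r → ¬ r ∣ m → Coprime r m
prime-∤⇒coprime {r} pr r∤m {i} (i∣r , i∣m) with prime⇒irreducible pr i∣r
... | inj₁ i≡1 = i≡1
... | inj₂ refl = contradiction i∣m r∤m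

prime-coprime⇒∤ : ∀ {r m} → Prime r → Coprime r m → ¬ r ∣ m
prime-coprime⇒∤ pr r⊥m r∣m = <⇒≢ (nonTrivial⇒n>1 _ {{prime⇒nonTrivial pr}}) (sym (r⊥m (∣-refl , r∣m)))

prime-factor : ∀ n → 1 < n → ∃ λ r → Prime r × r ∣ n
prime-factor n 1<n with factorise n {{>-nonZero (<-trans (n<1+n 0) 1<n)}}
... | record { factors = [] ; isFactorisation = refl } = contradiction 1<n (<-irrefl refl)
... | record { factors = r ∷ rs ; isFactorisation = refl ; factorsPrime = pr ∷ _ } = r , pr , m∣m*n _

prime-part : ∀ {r} → Prime r → ∀ n → 1 ≤ n → ∃ λ f → ∃ λ m → n ≡ r ^ f * m × ¬ r ∣ m
prime-part {r} pr n 1≤n = go n n ≤-refl 1≤n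
  where
  1<r : 1 < r
  1<r = nonTrivial⇒n>1 _ {{prime⇒nonTrivial pr}}
  go : ∀ b n → n ≤ b → 1 ≤ n → ∃ λ f → ∃ λ m → n ≡ r ^ f * m × ¬ r ∣ m
  go zero    zero _   ()
  go (suc b) n    n≤b 1≤n with r ∣? n
  ... | no r∤n = 0 , n , sym (+-identityʳ n) , r∤n
  ... | yes (divides zero refl) = contradiction 1≤n λ ()
  ... | yes (divides k@(suc _) refl) with go b k (≤-pred (≤-trans (m<m*n k r 1<r) n≤b)) (s≤s z≤n)
  ... | f , m , k≡ , r∤m = suc f , m , trans (cong (_* r) k≡) (trans (*-comm (r ^ f * m) r) (sym (*-assoc r (r ^ f) m))) , r∤m

*-regroup : ∀ a b c d → a * b * (c * d) ≡ a * d * (b * c)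
*-regroup = solve 4 (λ a b c d → a :* b :* (c :* d) := a :* d :* (b :* c)) refl
  where open +-*-Solver

-- Counting in finite enumerated sets

module _ {A : Set} where

  lookup-injective : ∀ {xs : List A} → Unique xs → ∀ {i j} → lookup xs i ≡ lookup xs j → i ≡ j
  lookup-injective (_   ∷ _) {zero}  {zero}  _  = refl
  lookup-injective (x∉ ∷ _) {zero}  {suc j} eq = contradiction eq (All.lookup x∉ (∈-lookup j))
  lookup-injective (x∉ ∷ _) {suc i} {zero}  eq = contradiction (sym eq) (All.lookup x∉ (∈-lookup i))
  lookup-injective (_   ∷ u) {suc i} {suc j} eq = cong suc (lookup-injective u eq)

  module _ {q} (enum : A ↔ Fin q) where
    open Inverse enum using (to; from; inverseˡ; inverseʳ)

    to-injective : ∀ {x y} → to x ≡ to y → x ≡ y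
    to-injective eq = trans (sym (inverseʳ refl)) (trans (cong from eq) (inverseʳ refl))

    length-unique≤ : ∀ {xs} → Unique xs → length xs ≤ q
    length-unique≤ u = Fin.injective⇒≤ (lookup-injective u ∘ to-injective)

    ≟-of-enumeration : DecidableEquality A
    ≟-of-enumeration x y = map′ to-injective (cong to) (to x Fin.≟ to y)

    open import Data.List.Membership.DecPropositional ≟-of-enumeration using (_∈?_)

    -- A missed element could be prepended, giving more than q distinct elements. In `cover` this
    -- counting replaces the solution of quadratic equations.
    unique-covers : ∀ {xs} → Unique xs → q ≤ length xs → ∀ x → x ∈ xs
    unique-covers {xs} u q≤ x with x ∈? xs
    ... | yes x∈ = x∈
    ... | no x∉ = contradiction (≤-trans (length-unique≤ (All.¬Any⇒All¬ _ x∉ ∷ u)) q≤) (<-irrefl refl)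

    elements : List A
    elements = map from (allFin q)

    length-elements : length elements ≡ q
    length-elements = trans (length-map from (allFin q)) (length-tabulate id)

    elements-unique : Unique elements
    elements-unique = Unique.map⁺ from-injective (Unique.allFin⁺ q)
      where
      from-injective : ∀ {i j} → from i ≡ from j → i ≡ j
      from-injective eq = trans (sym (inverseˡ refl)) (trans (cong to eq) (inverseˡ refl))

    ∈-elements : ∀ x → x ∈ elements
    ∈-elements x = subst (_∈ elements) (inverseʳ refl) (∈-map⁺ from (∈-allFin (to x)))

    -- The collision is given as i and i + k because k then serves directly as an exponent killing
    -- an element, or as a period under iteration.
    pigeonhole : (f : ℕ → A) → ∃ λ i → ∃ λ k → 1 ≤ k × f i ≡ f (i + k)
    pigeonhole f with Fin.pigeonhole (n<1+n q) (to ∘ f ∘ toℕ)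
    ... | i , j , i<j , eq = toℕ i , toℕ j ∸ toℕ i , m<n⇒0<n∸m i<j
                           , trans (to-injective eq) (cong f (sym (m+[n∸m]≡n (<⇒≤ i<j))))

-- Ring solver with integer coefficients

module IntegerCoefficients (R : CommutativeRing 0ℓ 0ℓ) where
  open import Data.Integer using (ℤ; +_; -[1+_]; _⊖_)
  open CommutativeRing R
    using (_≈_; 0#; 1#; setoid; semiring; ring; +-abelianGroup; reflexive; -‿inverseʳ; -‿cong)
    renaming (Carrier to A; _+_ to _⊕_; _*_ to _⊗_; -_ to ⊖_; refl to ≈-refl; sym to ≈-sym; trans to ≈-trans;
              +-identityˡ to ⊕-identityˡ; +-identityʳ to ⊕-identityʳ; +-assoc to ⊕-assoc; +-comm to ⊕-comm;
              +-congˡ to ⊕-congˡ; +-congʳ to ⊕-congʳ)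
  open Algebra.Properties.Semiring.Mult semiring using (×-homo-+; ×1-homo-*) renaming (_×_ to _∙_)
  open Algebra.Properties.Ring ring using (-‿distribˡ-*; -‿distribʳ-*; -0#≈0#; -‿involutive)
  open Algebra.Properties.AbelianGroup +-abelianGroup using (⁻¹-∙-comm)
  open import Relation.Binary.Reasoning.Setoid setoid

  ⟦_⟧ℤ : ℤ → A
  ⟦ + n ⟧ℤ = n ∙ 1#
  ⟦ -[1+ n ] ⟧ℤ = ⊖ (suc n ∙ 1#)

  ⟦⟧-neg : ∀ i → ⟦ ℤ.- i ⟧ℤ ≈ ⊖ ⟦ i ⟧ℤ
  ⟦⟧-neg (+ zero)   = ≈-sym -0#≈0#
  ⟦⟧-neg (+ suc n)  = ≈-refl
  ⟦⟧-neg (-[1+ n ]) = ≈-sym (-‿involutive _)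

  ⟦⟧-⊖ : ∀ m n → ⟦ m ⊖ n ⟧ℤ ≈ m ∙ 1# ⊕ ⊖ (n ∙ 1#)
  ⟦⟧-⊖ zero    zero    = ≈-sym (-‿inverseʳ _)
  ⟦⟧-⊖ zero    (suc n) = ≈-sym (⊕-identityˡ _)
  ⟦⟧-⊖ (suc m) zero    = ≈-sym (≈-trans (⊕-congˡ -0#≈0#) (⊕-identityʳ _))
  ⟦⟧-⊖ (suc m) (suc n) rewrite ℤ.[1+m]⊖[1+n]≡m⊖n m n = begin
    ⟦ m ⊖ n ⟧ℤ                                            ≈⟨ ⟦⟧-⊖ m n ⟩
    m ∙ 1# ⊕ ⊖ (n ∙ 1#)                                   ≈⟨ ⊕-congʳ (⊕-identityˡ _) ⟨
    (0# ⊕ m ∙ 1#) ⊕ ⊖ (n ∙ 1#)                            ≈⟨ ⊕-congʳ (⊕-congʳ (-‿inverseʳ 1#)) ⟨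
    ((1# ⊕ ⊖ 1#) ⊕ m ∙ 1#) ⊕ ⊖ (n ∙ 1#)                   ≈⟨ ⊕-congʳ (⊕-assoc _ _ _) ⟩
    (1# ⊕ (⊖ 1# ⊕ m ∙ 1#)) ⊕ ⊖ (n ∙ 1#)                   ≈⟨ ⊕-congʳ (⊕-congˡ (⊕-comm _ _)) ⟩
    (1# ⊕ (m ∙ 1# ⊕ ⊖ 1#)) ⊕ ⊖ (n ∙ 1#)                   ≈⟨ ⊕-congʳ (⊕-assoc _ _ _) ⟨
    (suc m ∙ 1# ⊕ ⊖ 1#) ⊕ ⊖ (n ∙ 1#)                      ≈⟨ ⊕-assoc _ _ _ ⟩
    suc m ∙ 1# ⊕ (⊖ 1# ⊕ ⊖ (n ∙ 1#))                      ≈⟨ ⊕-congˡ (⁻¹-∙-comm _ _) ⟩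
    suc m ∙ 1# ⊕ ⊖ (suc n ∙ 1#)                           ∎

  ⟦⟧-+ : ∀ i j → ⟦ i ℤ.+ j ⟧ℤ ≈ ⟦ i ⟧ℤ ⊕ ⟦ j ⟧ℤ
  ⟦⟧-+ (+ m)    (+ n)    = ×-homo-+ 1# m n
  ⟦⟧-+ (+ m)    -[1+ n ] = ⟦⟧-⊖ m (suc n)
  ⟦⟧-+ -[1+ m ] (+ n)    = ≈-trans (⟦⟧-⊖ n (suc m)) (⊕-comm _ _)
  ⟦⟧-+ -[1+ m ] -[1+ n ] = ≈-sym (≈-trans (⁻¹-∙-comm _ _) (-‿cong (begin
    suc m ∙ 1# ⊕ suc n ∙ 1#    ≈⟨ ×-homo-+ 1# (suc m) (suc n) ⟨
    (suc m + suc n) ∙ 1#       ≡⟨ cong (_∙ 1#) (+-suc (suc m) n) ⟩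
    suc (suc (m + n)) ∙ 1#     ∎)))

  ⟦⟧-* : ∀ i j → ⟦ i ℤ.* j ⟧ℤ ≈ ⟦ i ⟧ℤ ⊗ ⟦ j ⟧ℤ
  ⟦⟧-* (+ m) (+ n) = ≈-trans (reflexive (cong ⟦_⟧ℤ (sym (ℤ.pos-* m n)))) (×1-homo-* m n)
  ⟦⟧-* (+ m) -[1+ n ] = begin
    ⟦ + m ℤ.* -[1+ n ] ⟧ℤ           ≡⟨ cong ⟦_⟧ℤ (ℤ.neg-distribʳ-* (+ m) (+ suc n)) ⟨
    ⟦ ℤ.- (+ m ℤ.* + suc n) ⟧ℤ      ≈⟨ ⟦⟧-neg (+ m ℤ.* + suc n) ⟩
    ⊖ ⟦ + m ℤ.* + suc n ⟧ℤ          ≈⟨ -‿cong (⟦⟧-* (+ m) (+ suc n)) ⟩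
    ⊖ (m ∙ 1# ⊗ (suc n ∙ 1#))       ≈⟨ -‿distribʳ-* _ _ ⟩
    m ∙ 1# ⊗ ⊖ (suc n ∙ 1#)         ∎
  ⟦⟧-* -[1+ m ] (+ n) = begin
    ⟦ -[1+ m ] ℤ.* + n ⟧ℤ           ≡⟨ cong ⟦_⟧ℤ (ℤ.neg-distribˡ-* (+ suc m) (+ n)) ⟨
    ⟦ ℤ.- (+ suc m ℤ.* + n) ⟧ℤ      ≈⟨ ⟦⟧-neg (+ suc m ℤ.* + n) ⟩
    ⊖ ⟦ + suc m ℤ.* + n ⟧ℤ          ≈⟨ -‿cong (⟦⟧-* (+ suc m) (+ n)) ⟩
    ⊖ (suc m ∙ 1# ⊗ (n ∙ 1#))       ≈⟨ -‿distribˡ-* _ _ ⟩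
    ⊖ (suc m ∙ 1#) ⊗ (n ∙ 1#)       ∎
  ⟦⟧-* -[1+ m ] -[1+ n ] = begin
    ⟦ + suc m ℤ.* + suc n ⟧ℤ               ≈⟨ ⟦⟧-* (+ suc m) (+ suc n) ⟩
    (suc m ∙ 1#) ⊗ (suc n ∙ 1#)            ≈⟨ -‿involutive _ ⟨
    ⊖ (⊖ ((suc m ∙ 1#) ⊗ (suc n ∙ 1#)))    ≈⟨ -‿cong (-‿distribʳ-* _ _) ⟩
    ⊖ ((suc m ∙ 1#) ⊗ ⊖ (suc n ∙ 1#))      ≈⟨ -‿distribˡ-* _ _ ⟩
    ⊖ (suc m ∙ 1#) ⊗ ⊖ (suc n ∙ 1#)        ∎

  homomorphism : ℤ.+-*-rawRing -Raw-AlmostCommutative⟶ fromCommutativeRing R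
  homomorphism = record
    { ⟦_⟧ = ⟦_⟧ℤ
    ; +-homo = ⟦⟧-+
    ; *-homo = ⟦⟧-*
    ; -‿homo = ⟦⟧-neg
    ; 0-homo = ≈-refl
    -- The constant 1 evaluates to `1# ⊕ 0#`, which is not `1#` by computation. In the solver calls
    -- over a field 𝟙 therefore enters as a variable, usually `o`, and 𝟙 ⊗ 𝟙 ≡ 𝟙 is applied by hand;
    -- the constant 0 does evaluate to 𝟘.
    ; 1-homo = ⊕-identityʳ 1#
    }

  open Algebra.Solver.Ring ℤ.+-*-rawRing (fromCommutativeRing R) homomorphism
    (λ i j → Maybe.map (λ i≡j → reflexive (cong ⟦_⟧ℤ i≡j)) (dec⇒maybe (i ℤ.≟ j)))
    using (solve; _:=_; _:+_; _:*_; :-_; con) public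

-- Finite fields

module Field {q : ℕ} (F : FiniteField q) where
  open FiniteField F public
    renaming (_+_ to infixl 6 _⊕_; _*_ to infixl 7 _⊗_; -_ to infix 8 ⊝_; 0# to 𝟘; 1# to 𝟙)

  commutativeRing : CommutativeRing 0ℓ 0ℓ
  commutativeRing = record { isCommutativeRing = isCommutativeRing }

  open CommutativeRing commutativeRing public
    using (semiring; commutativeSemiring; +-commutativeMonoid)
    renaming (+-assoc to ⊕-assoc; +-comm to ⊕-comm; +-identityˡ to ⊕-identityˡ; +-identityʳ to ⊕-identityʳ;
              *-assoc to ⊗-assoc; *-comm to ⊗-comm; *-identityˡ to ⊗-identityˡ; *-identityʳ to ⊗-identityʳ;
              -‿inverseʳ to ⊕-inverseʳ; -‿inverseˡ to ⊕-inverseˡ; zeroˡ to ⊗-zeroˡ; zeroʳ to ⊗-zeroʳ)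

  open IntegerCoefficients commutativeRing public using (solve; _:=_; _:+_; _:*_; :-_; con)

  infix 4 _≟_
  _≟_ : DecidableEquality Carrier
  _≟_ = ≟-of-enumeration enumeration

  ⊝-zero⇒≡ : ∀ {x y} → x ⊕ ⊝ y ≡ 𝟘 → x ≡ y
  ⊝-zero⇒≡ {x} {y} eq = trans (solve 2 (λ x y → x := (x :+ :- y) :+ y) refl x y) (trans (cong (_⊕ y) eq) (⊕-identityˡ y))

  noZeroDivisors : ∀ {x y} → x ⊗ y ≡ 𝟘 → x ≡ 𝟘 ⊎ y ≡ 𝟘
  noZeroDivisors {x} {y} xy≡0 with x ≟ 𝟘
  ... | yes x≡0 = inj₁ x≡0
  ... | no x≢0 with inverse x x≢0
  ... | x⁻¹ , xx⁻¹≡1 = inj₂ (begin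
    y                ≡⟨ ⊗-identityˡ y ⟨
    𝟙 ⊗ y            ≡⟨ cong (_⊗ y) xx⁻¹≡1 ⟨
    x ⊗ x⁻¹ ⊗ y      ≡⟨ solve 3 (λ x z y → x :* z :* y := z :* (x :* y)) refl x x⁻¹ y ⟩
    x⁻¹ ⊗ (x ⊗ y)    ≡⟨ cong (x⁻¹ ⊗_) xy≡0 ⟩
    x⁻¹ ⊗ 𝟘          ≡⟨ ⊗-zeroʳ x⁻¹ ⟩
    𝟘                ∎)
    where open ≡-Reasoning

  ⊗-cancelˡ : ∀ {x y z} → x ≢ 𝟘 → x ⊗ y ≡ x ⊗ z → y ≡ z
  ⊗-cancelˡ {x} {y} {z} x≢0 eq
    with noZeroDivisors {x} {y ⊕ ⊝ z} (trans (solve 3 (λ x y z → x :* (y :+ :- z) := x :* y :+ :- (x :* z)) refl x y z)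
           (trans (cong (_⊕ ⊝ (x ⊗ z)) eq) (⊕-inverseʳ _)))
  ... | inj₁ x≡0 = contradiction x≡0 x≢0
  ... | inj₂ y-z = ⊝-zero⇒≡ y-z

  unit≢0 : ∀ {x y} → x ⊗ y ≡ 𝟙 → x ≢ 𝟘
  unit≢0 xy refl = 0≢1 (trans (sym (⊗-zeroˡ _)) xy)

  inverse-unique : ∀ {x y z} → x ⊗ y ≡ 𝟙 → x ⊗ z ≡ 𝟙 → y ≡ z
  inverse-unique xy xz = ⊗-cancelˡ (unit≢0 xy) (trans xy (sym xz))

  infixr 9 _↑_
  _↑_ : Carrier → ℕ → Carrier
  _↑_ = pow F

  ↑-+ : ∀ x m n → x ↑ (m + n) ≡ x ↑ m ⊗ x ↑ n
  ↑-+ x zero    n = sym (⊗-identityˡ _)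
  ↑-+ x (suc m) n = trans (cong (x ⊗_) (↑-+ x m n)) (sym (⊗-assoc x (x ↑ m) (x ↑ n)))

  ↑-⊗ : ∀ x y n → (x ⊗ y) ↑ n ≡ x ↑ n ⊗ y ↑ n
  ↑-⊗ x y zero    = sym (⊗-identityˡ 𝟙)
  ↑-⊗ x y (suc n) = trans (cong (x ⊗ y ⊗_) (↑-⊗ x y n))
    (solve 4 (λ x y u v → x :* y :* (u :* v) := x :* u :* (y :* v)) refl x y (x ↑ n) (y ↑ n))

  𝟙↑ : ∀ n → 𝟙 ↑ n ≡ 𝟙
  𝟙↑ zero    = refl
  𝟙↑ (suc n) = trans (⊗-identityˡ _) (𝟙↑ n)

  ↑-* : ∀ x m n → x ↑ (m * n) ≡ (x ↑ m) ↑ n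
  ↑-* x zero    n = sym (𝟙↑ n)
  ↑-* x (suc m) n = trans (↑-+ x n (m * n)) (trans (cong (x ↑ n ⊗_) (↑-* x m n)) (sym (↑-⊗ x (x ↑ m) n)))

  ↑-*′ : ∀ x m n → x ↑ (m * n) ≡ (x ↑ n) ↑ m
  ↑-*′ x m n = trans (cong (x ↑_) (*-comm m n)) (↑-* x n m)

  ↑-comm : ∀ x m n → (x ↑ m) ↑ n ≡ (x ↑ n) ↑ m
  ↑-comm x m n = trans (sym (↑-* x m n)) (↑-*′ x m n)

  ↑1 : ∀ x → x ↑ 1 ≡ x
  ↑1 = ⊗-identityʳ

  ↑-∣ : ∀ {x m n} → x ↑ m ≡ 𝟙 → m ∣ n → x ↑ n ≡ 𝟙
  ↑-∣ {x} {m} eq (divides k refl) = trans (↑-*′ x k m) (trans (cong (_↑ k) eq) (𝟙↑ k))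

  ↑-inverse : ∀ {x y} n → x ⊗ y ≡ 𝟙 → x ↑ n ⊗ y ↑ n ≡ 𝟙
  ↑-inverse {x} {y} n xy = trans (sym (↑-⊗ x y n)) (trans (cong (_↑ n) xy) (𝟙↑ n))

  inverse-↑≡1 : ∀ {x y n} → x ⊗ y ≡ 𝟙 → x ↑ n ≡ 𝟙 → y ↑ n ≡ 𝟙
  inverse-↑≡1 {x} {y} {n} xy xn = trans (sym (⊗-identityˡ _)) (trans (cong (_⊗ y ↑ n) (sym xn)) (↑-inverse n xy))

  ⊗-↑≡1 : ∀ {x y} n → x ↑ n ≡ 𝟙 → y ↑ n ≡ 𝟙 → (x ⊗ y) ↑ n ≡ 𝟙
  ⊗-↑≡1 {x} {y} n xn yn = trans (↑-⊗ x y n) (trans (cong₂ _⊗_ xn yn) (⊗-identityˡ 𝟙))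

  ↑≡1⇒≢0 : ∀ {x n} → 1 ≤ n → x ↑ n ≡ 𝟙 → x ≢ 𝟘
  ↑≡1⇒≢0 {n = suc n} _ = unit≢0

  ↑≢0 : ∀ {x} n → x ≢ 𝟘 → x ↑ n ≢ 𝟘
  ↑≢0 zero    _   1≡0 = 0≢1 (sym 1≡0)
  ↑≢0 (suc n) x≢0 eq with noZeroDivisors eq
  ... | inj₁ x≡0 = x≢0 x≡0
  ... | inj₂ xⁿ≡0 = ↑≢0 n x≢0 xⁿ≡0

  ↑-cancel : ∀ {x} m n → x ≢ 𝟘 → x ↑ m ≡ x ↑ (m + n) → x ↑ n ≡ 𝟙
  ↑-cancel {x} m n x≢0 eq = sym (⊗-cancelˡ (↑≢0 m x≢0) (trans (⊗-identityʳ _) (trans eq (↑-+ x m n))))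

  ↑-suc≡1 : ∀ {x} k n → x ↑ n ≡ 𝟙 → x ↑ (k + n) ≡ 𝟙 → x ↑ k ≡ 𝟙
  ↑-suc≡1 {x} k n xn eq = trans (sym (⊗-identityʳ _)) (trans (cong (x ↑ k ⊗_) (sym xn)) (trans (sym (↑-+ x k n)) eq))

  ↑-coprime : ∀ {x m n} → Coprime m n → x ↑ m ≡ 𝟙 → x ↑ n ≡ 𝟙 → x ≡ 𝟙
  ↑-coprime {x} {m} {n} m⊥n xm xn with coprime-Bézout m⊥n
  ... | Bézout.+- a b eq = trans (sym (↑1 x)) (↑-suc≡1 1 (b * n) (↑-∣ xn (n∣m*n b)) (trans (cong (x ↑_) eq) (↑-∣ xm (n∣m*n a))))
  ... | Bézout.-+ a b eq = trans (sym (↑1 x)) (↑-suc≡1 1 (a * m) (↑-∣ xm (n∣m*n a)) (trans (cong (x ↑_) eq) (↑-∣ xn (n∣m*n b))))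

  ↑-odd : ∀ {x} → x ↑ 2 ≡ 𝟙 → ∀ h → x ↑ suc (h + h) ≡ x
  ↑-odd {x} x² h = trans (cong (x ⊗_) (trans (cong (λ k → x ↑ (h + k)) (sym (+-identityʳ h))) (↑-∣ {x} {2} x² (m∣m*n h)))) (⊗-identityʳ x)

  order-∣ : ∀ {x d n} → MulOrder F x d → x ↑ n ≡ 𝟙 → d ∣ n
  order-∣ {x} {suc d} {n} (_ , xd , min) xn = m%n≡0⇒n∣m n (suc d) (r≡0 (n % suc d) (m%n<n n (suc d)) xr)
    where
    xr : x ↑ (n % suc d) ≡ 𝟙
    xr = ↑-suc≡1 (n % suc d) (n / suc d * suc d) (↑-∣ xd (n∣m*n (n / suc d)))
           (trans (cong (x ↑_) (sym (m≡m%n+[m/n]*n n (suc d)))) xn)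
    r≡0 : ∀ r → r < suc d → x ↑ r ≡ 𝟙 → r ≡ 0
    r≡0 zero    _   _  = refl
    r≡0 (suc r) r<d xr = contradiction xr (min (suc r) (s≤s z≤n) r<d)

  mulOrder : ∀ {x d} → 1 ≤ d → x ↑ d ≡ 𝟙 → (∀ k → x ↑ k ≡ 𝟙 → d ∣ k) → MulOrder F x d
  mulOrder 1≤d xd d∣ = 1≤d , xd , λ k 1≤k k<d xk → <⇒≱ k<d (∣⇒≤ {{>-nonZero 1≤k}} (d∣ k xk))

  order-exists : ∀ {x m} → 1 ≤ m → x ↑ m ≡ 𝟙 → ∃ (MulOrder F x)
  order-exists {x} {m} 1≤m xm with least (λ k → (1 ≤? k) ×-dec (x ↑ k ≟ 𝟙)) {m} (1≤m , xm)
  ... | d , (1≤d , xd) , min = d , 1≤d , xd , λ k 1≤k k<d xk → min k k<d (1≤k , xk)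

  order-* : ∀ {a b m n} → Coprime m n → MulOrder F a m → MulOrder F b n → MulOrder F (a ⊗ b) (m * n)
  order-* {a} {b} {m} {n} m⊥n oa ob = mulOrder (*-mono-≤ (proj₁ oa) (proj₁ ob))
    (⊗-↑≡1 (m * n) (↑-∣ {a} {m} (proj₁ (proj₂ oa)) (m∣m*n n)) (↑-∣ {b} {n} (proj₁ (proj₂ ob)) (n∣m*n m)))
    λ k abk → coprime-*-∣ m⊥n (∣k m⊥n oa ob k abk)
      (∣k (Coprimality.sym m⊥n) ob oa k (trans (cong (_↑ k) (⊗-comm b a)) abk))
    where
    ∣k : ∀ {a b m n} → Coprime m n → MulOrder F a m → MulOrder F b n → ∀ k → (a ⊗ b) ↑ k ≡ 𝟙 → m ∣ k
    ∣k {a} {b} {m} {n} m⊥n oa ob k abk = coprime-divisor m⊥n (order-∣ oa ank)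
      where
      -- Raising to the n-th power removes b, so m divides n k and, by coprimality, k.
      ank : a ↑ (n * k) ≡ 𝟙
      ank = trans (sym (⊗-identityʳ _)) (trans (cong (a ↑ (n * k) ⊗_) (sym (↑-∣ {b} {n} (proj₁ (proj₂ ob)) (m∣m*n k))))
              (trans (sym (↑-⊗ a b (n * k))) (↑-∣ {a ⊗ b} {k} abk (n∣m*n n))))

  order-↑ : ∀ {x} m {n} → MulOrder F x (m * n) → MulOrder F (x ↑ m) n
  order-↑ {x} zero (() , _)
  order-↑ {x} m@(suc _) {zero} (1≤ , _) = contradiction (subst (1 ≤_) (*-zeroʳ m) 1≤) λ ()
  order-↑ {x} m@(suc _) {n@(suc _)} o = mulOrder (s≤s z≤n) (trans (sym (↑-* x m n)) (proj₁ (proj₂ o)))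
    λ k xmk → *-cancelˡ-∣ m (order-∣ o (trans (↑-* x m k) xmk))

  order-↑-coprime : ∀ {x d k} → Coprime d k → MulOrder F x d → MulOrder F (x ↑ k) d
  order-↑-coprime {x} {d} {k} d⊥k o@(1≤d , xd , _) =
    mulOrder 1≤d (trans (↑-comm x k d) (trans (cong (_↑ k) xd) (𝟙↑ k)))
      λ j xkj → coprime-divisor d⊥k (order-∣ o (trans (↑-* x k j) xkj))

  order-injective : ∀ {x d} → MulOrder F x d → ∀ {i j} → i < j → j < d → x ↑ i ≢ x ↑ j
  order-injective {x} {d} (1≤d , xd , min) {i} {j} i<j j<d eq =
    min (j ∸ i) (m<n⇒0<n∸m i<j) (≤-<-trans (m∸n≤m j i) j<d)
      (↑-cancel i (j ∸ i) (↑≡1⇒≢0 1≤d xd) (trans eq (cong (x ↑_) (sym (m+[n∸m]≡n (<⇒≤ i<j))))))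

  -- [c₀, …, c_{d-1}] stands for the monic polynomial c₀ + c₁x + … + c_{d-1}x^{d-1} + x^d.
  evalMonic : List Carrier → Carrier → Carrier
  evalMonic []       x = 𝟙
  evalMonic (c ∷ cs) x = c ⊕ x ⊗ evalMonic cs x

  -- Horner's scheme for division by x - a: the coefficients of the quotient are the values at a of
  -- the tails of the polynomial. The value of the empty tail is the leading 1, which the encoding
  -- leaves implicit.
  monicQuotient : Carrier → List Carrier → List Carrier
  monicQuotient a []             = []
  monicQuotient a (c ∷ [])       = []
  monicQuotient a (c ∷ cs@(_ ∷ _)) = evalMonic cs a ∷ monicQuotient a cs

  evalMonic-monicQuotient : ∀ a x c cs → evalMonic (c ∷ cs) x ⊕ ⊝ evalMonic (c ∷ cs) a
                       ≡ (x ⊕ ⊝ a) ⊗ evalMonic (monicQuotient a (c ∷ cs)) x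
  evalMonic-monicQuotient a x c [] =
    solve 4 (λ a x c o → c :+ x :* o :+ :- (c :+ a :* o) := (x :+ :- a) :* o) refl a x c 𝟙
  evalMonic-monicQuotient a x c cs@(c′ ∷ cs′) = begin
    c ⊕ x ⊗ P ⊕ ⊝ (c ⊕ a ⊗ A)
      ≡⟨ solve 5 (λ a x c P A → c :+ x :* P :+ :- (c :+ a :* A) := x :* (P :+ :- A) :+ (x :+ :- a) :* A) refl a x c P A ⟩
    x ⊗ (P ⊕ ⊝ A) ⊕ (x ⊕ ⊝ a) ⊗ A
      ≡⟨ cong (λ z → x ⊗ z ⊕ (x ⊕ ⊝ a) ⊗ A) (evalMonic-monicQuotient a x c′ cs′) ⟩
    x ⊗ ((x ⊕ ⊝ a) ⊗ Q) ⊕ (x ⊕ ⊝ a) ⊗ A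
      ≡⟨ solve 4 (λ a x Q A → x :* ((x :+ :- a) :* Q) :+ (x :+ :- a) :* A := (x :+ :- a) :* (A :+ x :* Q)) refl a x Q A ⟩
    (x ⊕ ⊝ a) ⊗ (A ⊕ x ⊗ Q) ∎
    where
    open ≡-Reasoning
    P = evalMonic cs x
    A = evalMonic cs a
    Q = evalMonic (monicQuotient a cs) x

  length-monicQuotient : ∀ a c cs → length (monicQuotient a (c ∷ cs)) ≡ length cs
  length-monicQuotient a c []       = refl
  length-monicQuotient a c (c′ ∷ cs) = cong suc (length-monicQuotient a c′ cs)

  -- In the absence of zero divisors every other root is a root of the quotient by x - a. The monic
  -- encoding excludes the zero polynomial: degree 0 means the constant 1.
  roots≤degree : ∀ cs {xs} → Unique xs → All (λ x → evalMonic cs x ≡ 𝟘) xs → length xs ≤ length cs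
  roots≤degree cs []                []           = z≤n
  roots≤degree [] (_ ∷ _)           (1≡0 ∷ _)    = contradiction (sym 1≡0) 0≢1
  roots≤degree (c ∷ cs) {a ∷ xs} (a∉ ∷ u) (ra ∷ rs) = s≤s (subst (length xs ≤_) (length-monicQuotient a c cs)
    (roots≤degree (monicQuotient a (c ∷ cs)) u (All.zipWith root (a∉ , rs))))
    where
    root : ∀ {x} → a ≢ x × evalMonic (c ∷ cs) x ≡ 𝟘 → evalMonic (monicQuotient a (c ∷ cs)) x ≡ 𝟘
    root {x} (a≢x , rx) with noZeroDivisors (trans (sym (evalMonic-monicQuotient a x c cs))
                                (trans (cong₂ (λ u v → u ⊕ ⊝ v) rx ra) (⊕-inverseʳ 𝟘)))
    ... | inj₁ x-a = contradiction (sym (⊝-zero⇒≡ x-a)) a≢x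
    ... | inj₂ Q≡0 = Q≡0

  X^[1+_]-1 : ℕ → List Carrier
  X^[1+ d ]-1 = ⊝ 𝟙 ∷ replicate d 𝟘

  evalMonic-zeros : ∀ d x → evalMonic (replicate d 𝟘) x ≡ x ↑ d
  evalMonic-zeros zero    x = refl
  evalMonic-zeros (suc d) x = trans (⊕-identityˡ _) (cong (x ⊗_) (evalMonic-zeros d x))

  evalMonic-X^d-1 : ∀ d {x} → x ↑ suc d ≡ 𝟙 → evalMonic X^[1+ d ]-1 x ≡ 𝟘
  evalMonic-X^d-1 d {x} xd = trans (cong (λ z → ⊝ 𝟙 ⊕ x ⊗ z) (evalMonic-zeros d x))
    (trans (cong (⊝ 𝟙 ⊕_) xd) (⊕-inverseˡ 𝟙))

  powers-unique : ∀ {x d} → MulOrder F x d → Unique (applyUpTo (x ↑_) d)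
  powers-unique {x} {d} o = Unique.applyUpTo⁺₁ (x ↑_) d (order-injective o)

  -- The d powers of h are distinct roots of X^d - 1, so x cannot be a further one.
  order-generates : ∀ {h d} → MulOrder F h d → ∀ {x} → x ↑ d ≡ 𝟙 → ∃ λ k → k < d × x ≡ h ↑ k
  order-generates {h} {suc d} o@(_ , hd , _) {x} xd with x ∈? applyUpTo (h ↑_) (suc d)
    where open import Data.List.Membership.DecPropositional _≟_ using (_∈?_)
  ... | yes x∈ = ∈-applyUpTo⁻ (h ↑_) x∈
  ... | no x∉ = contradiction (subst₂ _≤_ (cong suc (length-applyUpTo (h ↑_) (suc d))) (cong suc (length-replicate d))
                  (roots≤degree X^[1+ d ]-1 (All.¬Any⇒All¬ _ x∉ ∷ powers-unique o) (evalMonic-X^d-1 d xd ∷ All.applyUpTo⁺₂ (h ↑_) (suc d) root)))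
                  (<-irrefl refl)
    where
    root : ∀ k → evalMonic X^[1+ d ]-1 (h ↑ k) ≡ 𝟘
    root k = evalMonic-X^d-1 d (trans (↑-comm h k (suc d)) (trans (cong (_↑ k) hd) (𝟙↑ k)))

  nonzero-torsion : ∀ {x} → x ≢ 𝟘 → ∃ (MulOrder F x)
  nonzero-torsion {x} x≢0 with pigeonhole enumeration (x ↑_)
  ... | i , k , 1≤k , eq = order-exists 1≤k (↑-cancel i k x≢0 eq)

  -- If r^(f+1) ∣ n while M = r^f M′ with r ∤ M′, then g^(r^f) has order M′, a power of x has
  -- order r^(f+1), and their product has the larger order M′ r^(f+1).
  larger-order : ∀ {g M x n} → MulOrder F g M → MulOrder F x n → ¬ n ∣ M →
                 ∃ λ g′ → ∃ λ M′ → M < M′ × MulOrder F g′ M′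
  larger-order {g} {M} {x} {n} og ox n∤M with mkGCD M n
  ... | e , GCD.is (divides M₀ refl , divides n₀ refl) greatest = build
    where
    M₀⊥n₀ : Coprime M₀ n₀
    M₀⊥n₀ {i} (divides a M₀≡ , divides b n₀≡) = ∣1⇒≡1 (*-cancelʳ-∣ e (subst (i * e ∣_) (sym (+-identityʳ e))
      (greatest (divides a (trans (cong (_* e) M₀≡) (*-assoc a i e)) , divides b (trans (cong (_* e) n₀≡) (*-assoc b i e))))))
      where
      instance
        e≢0 : NonZero e
        e≢0 = m*n≢0⇒n≢0 n₀ {{>-nonZero (proj₁ ox)}}
    1<n₀ : 1 < n₀
    1<n₀ = ≤∧≢⇒< (>-nonZero⁻¹ n₀ {{m*n≢0⇒m≢0 n₀ {{>-nonZero (proj₁ ox)}}}})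
      λ 1≡n₀ → n∤M (subst (λ k → k * e ∣ M₀ * e) 1≡n₀ (subst (_∣ M₀ * e) (sym (+-identityʳ e)) (n∣m*n M₀)))
    build : ∃ λ g′ → ∃ λ M′ → M₀ * e < M′ × MulOrder F g′ M′
    -- A prime r dividing n / gcd(M, n) does not divide M / gcd(M, n). So M contains r exactly as
    -- often as the gcd `e` does, and n contains it at least once more.
    build with prime-factor n₀ 1<n₀
    ... | r , pr , divides n₁ n₀≡ with prime-part pr e (>-nonZero⁻¹ e {{m*n≢0⇒n≢0 n₀ {{>-nonZero (proj₁ ox)}}}})
    ... | f , e′ , refl , r∤e′ = a ⊗ b , M₀ * e′ * r ^ suc f , larger ,
            order-* (Coprimality.sym (coprime-^ˡ (suc f) (prime-∤⇒coprime pr r∤M′))) oa ob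
      where
      a = g ↑ (r ^ f)
      b = x ↑ (n₁ * e′)
      r∤M′ : ¬ r ∣ M₀ * e′
      r∤M′ r∣ with euclidsLemma M₀ e′ pr r∣
      ... | inj₁ r∣M₀ = prime-coprime⇒∤ pr (λ { (i∣r , i∣M₀) → M₀⊥n₀ (i∣M₀ , ∣-trans i∣r (divides n₁ n₀≡)) }) r∣M₀
      ... | inj₂ r∣e′ = r∤e′ r∣e′
      M≡ : M₀ * (r ^ f * e′) ≡ r ^ f * (M₀ * e′)
      M≡ = trans (sym (*-assoc M₀ (r ^ f) e′)) (trans (cong (_* e′) (*-comm M₀ (r ^ f))) (*-assoc (r ^ f) M₀ e′))
      n≡ : n₀ * (r ^ f * e′) ≡ n₁ * e′ * r ^ suc f
      n≡ = trans (cong (_* (r ^ f * e′)) n₀≡) (*-regroup n₁ r (r ^ f) e′)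
      oa : MulOrder F a (M₀ * e′)
      oa = order-↑ (r ^ f) (subst (MulOrder F g) M≡ og)
      ob : MulOrder F b (r ^ suc f)
      ob = order-↑ (n₁ * e′) (subst (MulOrder F x) n≡ ox)
      larger : M₀ * (r ^ f * e′) < M₀ * e′ * r ^ suc f
      larger = subst₂ _<_ (sym M≡) (trans (cong (_* r) (*-comm (r ^ f) (M₀ * e′))) (trans (*-assoc (M₀ * e′) (r ^ f) r) (cong (M₀ * e′ *_) (*-comm (r ^ f) r))))
        (m<m*n (r ^ f * (M₀ * e′)) r {{>-nonZero (subst (1 ≤_) M≡ (proj₁ og))}} (nonTrivial⇒n>1 r {{prime⇒nonTrivial pr}}))

  ∣∣≤q : ∀ {g M} → MulOrder F g M → suc M ≤ q
  ∣∣≤q {g} {M} o@(1≤M , gM , _) = subst (λ m → suc m ≤ q) (length-applyUpTo (g ↑_) M)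
    (length-unique≤ enumeration (All.applyUpTo⁺₂ (g ↑_) M (λ k 0≡gᵏ → ↑≢0 k (↑≡1⇒≢0 1≤M gM) (sym 0≡gᵏ)) ∷ powers-unique o))

  exponent-or-larger : ∀ {g M} → MulOrder F g M →
    (∀ x → x ≢ 𝟘 → x ↑ M ≡ 𝟙) ⊎ ∃ λ g′ → ∃ λ M′ → M < M′ × MulOrder F g′ M′
  exponent-or-larger {g} {M} o = decide (all? good? (elements enumeration))
    where
    Good : Carrier → Set
    Good x = x ≢ 𝟘 → x ↑ M ≡ 𝟙
    good? : ∀ x → Dec (Good x)
    good? x = ¬? (x ≟ 𝟘) →-dec (x ↑ M ≟ 𝟙)
    enlarge : ∃ (¬_ ∘ Good) → ∃ λ g′ → ∃ λ M′ → M < M′ × MulOrder F g′ M′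
    enlarge (x , bad) = larger-order o (proj₂ torsion) (λ n∣M → bad λ _ → ↑-∣ {x} (proj₁ (proj₂ (proj₂ torsion))) n∣M)
      where
      torsion : ∃ (MulOrder F x)
      torsion = nonzero-torsion (λ x≡0 → bad λ x≢0 → contradiction x≡0 x≢0)
    decide : Dec (All Good (elements enumeration)) → (∀ x → Good x) ⊎ _
    decide (yes all) = inj₁ λ x → All.lookup all (∈-elements enumeration x)
    decide (no ¬all) = inj₂ (enlarge (Any.satisfied (All.¬All⇒Any¬ good? _ ¬all)))

  -- An element of maximal order: whenever its order fails to kill some unit, `larger-order`
  -- improves it. Orders stay below q, so q improvements suffice as fuel.
  exponent-element : ∃ λ g → ∃ λ M → MulOrder F g M × (∀ x → x ≢ 𝟘 → x ↑ M ≡ 𝟙)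
  exponent-element = go q 𝟙 1 (s≤s z≤n , ⊗-identityʳ 𝟙 , λ { (suc k) _ (s≤s ()) }) (m≤m+n q 1)
    where
    go : ∀ fuel g M → MulOrder F g M → q ≤ fuel + M → ∃ λ g → ∃ λ M → MulOrder F g M × (∀ x → x ≢ 𝟘 → x ↑ M ≡ 𝟙)
    go zero g M o q≤M = contradiction (≤-trans (∣∣≤q o) q≤M) (<-irrefl refl)
    go (suc fuel) g M o q≤ with exponent-or-larger o
    ... | inj₁ xM = g , M , o , xM
    ... | inj₂ (g′ , M′ , M<M′ , o′) = go fuel g′ M′ o′ (≤-trans q≤ (≤-trans (≤-reflexive (sym (+-suc fuel M))) (+-monoʳ-≤ fuel M<M′)))

  -- All q elements are roots of X (X^M - 1), of degree M + 1; prefixing the coefficient 𝟘 is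
  -- multiplication by X.
  q≤1+exponent : ∀ {M} → 1 ≤ M → (∀ x → x ≢ 𝟘 → x ↑ M ≡ 𝟙) → q ≤ suc M
  q≤1+exponent {suc d} _ xM = subst₂ _≤_ (length-elements enumeration) (cong (2 +_) (length-replicate d))
    (roots≤degree (𝟘 ∷ X^[1+ d ]-1) (elements-unique enumeration) (All.tabulate λ {x} _ → root x))
    where
    root : ∀ x → evalMonic (𝟘 ∷ X^[1+ d ]-1) x ≡ 𝟘
    root x with x ≟ 𝟘
    ... | yes refl = trans (⊕-identityˡ _) (⊗-zeroˡ _)
    ... | no x≢0 = trans (⊕-identityˡ _) (trans (cong (x ⊗_) (evalMonic-X^d-1 d (xM x x≢0))) (⊗-zeroʳ x))

  abstract
    -- The root count gives q ≤ M + 1, and the distinct powers of g together with 𝟘 give M + 1 ≤ q.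
    -- The block is abstract so that the search for g is never evaluated in types.
    primitive-root : ∃ λ g → ∃ λ M → MulOrder F g M × q ≡ suc M × (∀ x → x ≢ 𝟘 → x ↑ M ≡ 𝟙)
    primitive-root with exponent-element
    ... | g , M , o , xM = g , M , o , ≤-antisym (q≤1+exponent (proj₁ o) xM) (∣∣≤q o) , xM

-- The Frobenius endomorphism

prime∤! : ∀ {p} → Prime p → ∀ n → n < p → ¬ p ∣ n !
prime∤! {p} pr zero    _   p∣1 = <⇒≢ (nonTrivial⇒n>1 p {{prime⇒nonTrivial pr}}) (sym (∣1⇒≡1 p∣1))
prime∤! {p} pr (suc n) n<p p∣ with euclidsLemma (suc n) (n !) pr p∣
... | inj₁ p∣1+n = <⇒≱ n<p (∣⇒≤ p∣1+n)
... | inj₂ p∣n!  = prime∤! pr n (<-trans (n<1+n n) n<p) p∣n!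

prime∣C : ∀ {p k} → Prime p → 1 ≤ k → k < p → p ∣ p C k
prime∣C {p@(suc p′)} {k} pr 1≤k k<p with euclidsLemma (p C k) (k ! * (p ∸ k) !) pr p∣C*
  where
  instance
    _ = k !* (p ∸ k) !≢0
  p∣C* : p ∣ (p C k) * (k ! * (p ∸ k) !)
  p∣C* = subst (p ∣_) (sym (trans (cong (_* (k ! * (p ∸ k) !)) (nCk≡n!/k![n-k]! (<⇒≤ k<p)))
           (m/n*n≡m (subst (_∣ p !) (*-comm ((p ∸ k) !) (k !)) ([n∸k]!k!∣n! (<⇒≤ k<p)))))) (m∣m*n (p′ !))
... | inj₁ p∣C = p∣C
... | inj₂ p∣k!* with euclidsLemma (k !) ((p ∸ k) !) pr p∣k!*
... | inj₁ p∣k! = contradiction p∣k! (prime∤! pr k k<p)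
... | inj₂ p∣j! = contradiction p∣j! (prime∤! pr (p ∸ k) (∸-monoʳ-< 1≤k (<⇒≤ k<p)))

module Frobenius {q : ℕ} (F : FiniteField q) where
  open Field F
  open Algebra.Properties.Semiring.Mult semiring using (×-homo-+; ×1-homo-*; ×-assoc-*; ×-assocˡ) renaming (_×_ to _∙_)
  open Algebra.Properties.CommutativeMonoid.Sum +-commutativeMonoid
    using (sum; sum-permute; ∑-distrib-+; sum-cong-≗; sum-replicate; sum-replicate-zero; sum-init-last)
  open Algebra.Properties.CommutativeSemiring.Binomial commutativeSemiring using (theorem; binomialTerm)
  open Algebra.Properties.Semiring.Exp semiring using () renaming (_^_ to _↟_)

  -- Translation by 𝟙 permutes the field, so the sum of all elements is unchanged by adding q ∙ 𝟙.
  q∙𝟙≡𝟘 : q ∙ 𝟙 ≡ 𝟘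
  q∙𝟙≡𝟘 = begin
    q ∙ 𝟙                                     ≡⟨ solve 2 (λ s c → c := (s :+ c) :+ :- s) refl S (q ∙ 𝟙) ⟩
    S ⊕ q ∙ 𝟙 ⊕ ⊝ S                           ≡⟨ cong (λ z → S ⊕ z ⊕ ⊝ S) (sum-replicate q) ⟨
    S ⊕ sum {q} (λ _ → 𝟙) ⊕ ⊝ S               ≡⟨ cong (_⊕ ⊝ S) (∑-distrib-+ from (λ _ → 𝟙)) ⟨
    sum (λ i → from i ⊕ 𝟙) ⊕ ⊝ S              ≡⟨ cong (_⊕ ⊝ S) (sum-cong-≗ (λ i → inverseʳ {from i ⊕ 𝟙} refl)) ⟨
    sum (λ i → from (to (from i ⊕ 𝟙))) ⊕ ⊝ S  ≡⟨ cong (_⊕ ⊝ S) (sum-permute from translation) ⟨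
    S ⊕ ⊝ S                                   ≡⟨ ⊕-inverseʳ S ⟩
    𝟘                                         ∎
    where
    open ≡-Reasoning
    open Inverse enumeration using (to; from; inverseˡ; inverseʳ)
    S = sum from
    cancel : ∀ {a b} → a ⊕ b ≡ 𝟘 → ∀ i → to (from (to (from i ⊕ a)) ⊕ b) ≡ i
    cancel {a} {b} ab i = trans (cong (λ z → to (z ⊕ b)) (inverseʳ refl))
      (inverseˡ (trans (⊕-assoc (from i) a b) (trans (cong (from i ⊕_) ab) (⊕-identityʳ _))))
    translation = permutation (λ i → to (from i ⊕ 𝟙)) (λ i → to (from i ⊕ ⊝ 𝟙))
      (cancel (⊕-inverseˡ 𝟙)) (cancel (⊕-inverseʳ 𝟙))

  ∙𝟙-^ : ∀ p n → (p ^ n) ∙ 𝟙 ≡ (p ∙ 𝟙) ↑ n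
  ∙𝟙-^ p zero    = ⊕-identityʳ 𝟙
  ∙𝟙-^ p (suc n) = trans (×1-homo-* p (p ^ n)) (cong (p ∙ 𝟙 ⊗_) (∙𝟙-^ p n))

  -- (p ∙ 𝟙)^n = q ∙ 𝟙 = 𝟘, and a field has no nonzero nilpotents.
  characteristic : ∀ {p n} → q ≡ p ^ n → p ∙ 𝟙 ≡ 𝟘
  characteristic {p} {n} q≡ with p ∙ 𝟙 ≟ 𝟘
  ... | yes eq = eq
  ... | no neq = contradiction (trans (sym (∙𝟙-^ p n)) (trans (cong (_∙ 𝟙) (sym q≡)) q∙𝟙≡𝟘)) (↑≢0 n neq)

  ↟≡↑ : ∀ x n → x ↟ n ≡ x ↑ n
  ↟≡↑ x zero    = refl
  ↟≡↑ x (suc n) = cong (x ⊗_) (↟≡↑ x n)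

  ∣-∙ : ∀ {p m} → p ∙ 𝟙 ≡ 𝟘 → p ∣ m → ∀ x → m ∙ x ≡ 𝟘
  ∣-∙ {p} p0 (divides k refl) x = begin
    (k * p) ∙ x              ≡⟨ cong ((k * p) ∙_) (⊗-identityˡ x) ⟨
    (k * p) ∙ (𝟙 ⊗ x)        ≡⟨ ×-assoc-* (k * p) 𝟙 x ⟨
    (k * p) ∙ 𝟙 ⊗ x          ≡⟨ cong (_⊗ x) (×1-homo-* k p) ⟩
    k ∙ 𝟙 ⊗ (p ∙ 𝟙) ⊗ x      ≡⟨ cong (λ z → k ∙ 𝟙 ⊗ z ⊗ x) p0 ⟩
    k ∙ 𝟙 ⊗ 𝟘 ⊗ x            ≡⟨ cong (_⊗ x) (⊗-zeroʳ _) ⟩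
    𝟘 ⊗ x                    ≡⟨ ⊗-zeroˡ x ⟩
    𝟘                        ∎
    where open ≡-Reasoning

  ↑p-⊕ : ∀ {p} → Prime p → p ∙ 𝟙 ≡ 𝟘 → ∀ x y → (x ⊕ y) ↑ p ≡ x ↑ p ⊕ y ↑ p
  ↑p-⊕ {zero} pr with () ← ≢-nonZero⁻¹ 0 {{prime⇒nonZero pr}} refl
  ↑p-⊕ {p@(suc p′)} pr p0 x y = begin
    (x ⊕ y) ↑ p                                 ≡⟨ ↟≡↑ (x ⊕ y) p ⟨
    (x ⊕ y) ↟ p                                 ≡⟨ theorem p x y ⟩
    first ⊕ sum (λ i → term (suc i))            ≡⟨ cong (first ⊕_) (sum-init-last (λ i → term (suc i))) ⟩
    first ⊕ (sum middle ⊕ last)                 ≡⟨ cong (λ z → first ⊕ (z ⊕ last)) middle≡0 ⟩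
    first ⊕ (𝟘 ⊕ last)                          ≡⟨ cong (first ⊕_) (⊕-identityˡ last) ⟩
    first ⊕ last                                ≡⟨ cong₂ _⊕_ first≡ last≡ ⟩
    y ↑ p ⊕ x ↑ p                               ≡⟨ ⊕-comm _ _ ⟩
    x ↑ p ⊕ y ↑ p                               ∎
    where
    open ≡-Reasoning
    term : Fin (suc p) → Carrier
    term = binomialTerm x y p
    first = term zero
    last = term (suc (fromℕ p′))
    middle : Fin p′ → Carrier
    middle i = term (suc (inject₁ i))
    middle≡0 : sum middle ≡ 𝟘
    middle≡0 = trans (sum-cong-≗ {x = middle} λ i → ∣-∙ p0
      (prime∣C pr (s≤s z≤n) (s≤s (subst (_< p′) (sym (Fin.toℕ-inject₁ i)) (Fin.toℕ<n i)))) _) (sum-replicate-zero p′)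
    first≡ : first ≡ y ↑ p
    first≡ = trans (⊕-identityʳ _) (trans (⊗-identityˡ _) (↟≡↑ y p))
    last≡ : last ≡ x ↑ p
    last≡ = trans (cong (λ k → (p C k) ∙ (x ↟ k ⊗ y ↟ (p ∸ k))) (cong suc (Fin.toℕ-fromℕ p′)))
      (trans (cong₂ (λ c k → c ∙ (x ↟ p ⊗ y ↟ k)) (nCn≡1 p) (n∸n≡0 p))
        (trans (⊕-identityʳ _) (trans (⊗-identityʳ _) (↟≡↑ x p))))

  ↑pⁿ-⊕ : ∀ {p} → Prime p → p ∙ 𝟙 ≡ 𝟘 → ∀ n x y → (x ⊕ y) ↑ (p ^ n) ≡ x ↑ (p ^ n) ⊕ y ↑ (p ^ n)
  ↑pⁿ-⊕ pr p0 zero x y = trans (↑1 _) (sym (cong₂ _⊕_ (↑1 x) (↑1 y)))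
  ↑pⁿ-⊕ {p} pr p0 (suc n) x y = begin
    (x ⊕ y) ↑ (p * p ^ n)                        ≡⟨ ↑-* (x ⊕ y) p (p ^ n) ⟩
    ((x ⊕ y) ↑ p) ↑ (p ^ n)                      ≡⟨ cong (_↑ (p ^ n)) (↑p-⊕ pr p0 x y) ⟩
    (x ↑ p ⊕ y ↑ p) ↑ (p ^ n)                    ≡⟨ ↑pⁿ-⊕ pr p0 n (x ↑ p) (y ↑ p) ⟩
    (x ↑ p) ↑ (p ^ n) ⊕ (y ↑ p) ↑ (p ^ n)        ≡⟨ cong₂ _⊕_ (↑-* x p (p ^ n)) (↑-* y p (p ^ n)) ⟨
    x ↑ (p * p ^ n) ⊕ y ↑ (p * p ^ n)            ∎
    where open ≡-Reasoning

-- Parametrisation by a quadratic extension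

[1+m]²≡1+m[2+m] : ∀ m → suc m * suc m ≡ suc (m * suc (suc m))
[1+m]²≡1+m[2+m] = solve 1 (λ m → (con 1 :+ m) :* (con 1 :+ m) := con 1 :+ m :* (con 2 :+ m)) refl
  where open +-*-Solver

⌊n/2⌋+⌊n/2⌋≤n : ∀ n → ⌊ n /2⌋ + ⌊ n /2⌋ ≤ n
⌊n/2⌋+⌊n/2⌋≤n n = ≤-trans (+-monoʳ-≤ ⌊ n /2⌋ (⌊n/2⌋≤⌈n/2⌉ n)) (≤-reflexive (⌊n/2⌋+⌈n/2⌉≡n n))

module Embedding {q r : ℕ} (F : FiniteField q) (K : FiniteField r) (ι : FieldHom F K) where
  module 𝔽 = Field F
  open Field K
  open FieldHom ι public using (⟦_⟧; hom-0; hom-1; hom-+; hom-*; hom--)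

  ι-≢0 : ∀ {x} → x ≢ 𝔽.𝟘 → ⟦ x ⟧ ≢ 𝟘
  ι-≢0 {x} x≢0 with 𝔽.inverse x x≢0
  ... | y , xy = unit≢0 (trans (sym (hom-* x y)) (trans (cong ⟦_⟧ xy) hom-1))

  ι-injective : ∀ {x y} → ⟦ x ⟧ ≡ ⟦ y ⟧ → x ≡ y
  ι-injective {x} {y} eq with x 𝔽.⊕ 𝔽.⊝ y 𝔽.≟ 𝔽.𝟘
  ... | yes x-y = 𝔽.⊝-zero⇒≡ x-y
  ... | no x-y≢0 = contradiction (trans (hom-+ x (𝔽.⊝ y)) (trans (cong₂ _⊕_ eq (hom-- y)) (⊕-inverseʳ _))) (ι-≢0 x-y≢0)

  ι-↑ : ∀ x k → ⟦ x 𝔽.↑ k ⟧ ≡ ⟦ x ⟧ ↑ k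
  ι-↑ x zero    = hom-1
  ι-↑ x (suc k) = trans (hom-* x (x 𝔽.↑ k)) (cong (⟦ x ⟧ ⊗_) (ι-↑ x k))

  ι-order : ∀ {x d} → MulOrder F x d → MulOrder K ⟦ x ⟧ d
  ι-order {x} {d} (1≤d , xd , min) = 1≤d , trans (sym (ι-↑ x d)) (trans (cong ⟦_⟧ xd) hom-1)
    , λ k 1≤k k<d xk → min k 1≤k k<d (ι-injective (trans (ι-↑ x k) (trans xk (sym hom-1))))

  ι-order⁻ : ∀ {x d} → MulOrder K ⟦ x ⟧ d → MulOrder F x d
  ι-order⁻ {x} {d} (1≤d , xd , min) = 1≤d , ι-injective (trans (ι-↑ x d) (trans xd (sym hom-1)))
    , λ k 1≤k k<d xk → min k 1≤k k<d (trans (sym (ι-↑ x k)) (trans (cong ⟦_⟧ xk) hom-1))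

  -- A relation instead of a function γ ↦ x, because γ + γ⁻¹ lies in F only for suitable γ, and
  -- because x has both γ and γ⁻¹ as parameters.
  Param : 𝔽.Carrier → Carrier → Set
  Param x γ = ∃ λ δ → γ ⊗ δ ≡ 𝟙 × ⟦ x ⟧ ≡ γ ⊕ δ

  -- The common form of `ConjSum` and `ConjSumExt`, to which it is equivalent when d divides q - 1,
  -- respectively q + 1.
  OrderSum : ℕ → 𝔽.Carrier → Set
  OrderSum d x = ∃ λ α → MulOrder K α d × Param x α

  param-unique : ∀ {x y γ} → Param x γ → Param y γ → x ≡ y
  param-unique (δ , γδ , x≡) (δ′ , γδ′ , y≡) =
    ι-injective (trans x≡ (trans (cong (_ ⊕_) (inverse-unique γδ γδ′)) (sym y≡)))

  param-inverse : ∀ {x γ δ} → γ ⊗ δ ≡ 𝟙 → Param x γ → Param x δ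
  param-inverse {γ = γ} {δ} γδ (δ′ , γδ′ , x≡) = γ , trans (⊗-comm δ γ) γδ
    , trans x≡ (trans (cong (γ ⊕_) (inverse-unique γδ′ γδ)) (⊕-comm γ δ))

  -- Both are roots of t² - xt + 1, whose roots have product 1; concretely, (γ - δ)(γδ - 1)
  -- vanishes.
  param-fiber : ∀ {x γ δ} → Param x γ → Param x δ → δ ≡ γ ⊎ γ ⊗ δ ≡ 𝟙
  param-fiber {x} {γ} {δ} (γ′ , γγ′ , x≡) (δ′ , δδ′ , x≡′) =
    Sum.map (λ γ-δ → sym (⊝-zero⇒≡ γ-δ)) ⊝-zero⇒≡ (noZeroDivisors {γ ⊕ ⊝ δ} {γ ⊗ δ ⊕ ⊝ 𝟙} product≡0)
    where
    open ≡-Reasoning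
    product≡0 : (γ ⊕ ⊝ δ) ⊗ (γ ⊗ δ ⊕ ⊝ 𝟙) ≡ 𝟘
    product≡0 = begin
      (γ ⊕ ⊝ δ) ⊗ (γ ⊗ δ ⊕ ⊝ 𝟙)
        ≡⟨ solve 5 (λ γ δ γ′ δ′ o → (γ :+ :- δ) :* (γ :* δ :+ :- o)
             := γ :* δ :* ((γ :+ γ′) :+ :- (δ :+ δ′)) :+ (γ :* (δ :* δ′ :+ :- o) :+ :- (δ :* (γ :* γ′ :+ :- o)))) refl γ δ γ′ δ′ 𝟙 ⟩
      γ ⊗ δ ⊗ ((γ ⊕ γ′) ⊕ ⊝ (δ ⊕ δ′)) ⊕ (γ ⊗ (δ ⊗ δ′ ⊕ ⊝ 𝟙) ⊕ ⊝ (δ ⊗ (γ ⊗ γ′ ⊕ ⊝ 𝟙)))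
        ≡⟨ cong₂ _⊕_ (cong (γ ⊗ δ ⊗_) (trans (cong₂ (λ u v → u ⊕ ⊝ v) (sym x≡) (sym x≡′)) (⊕-inverseʳ _)))
             (cong₂ (λ u v → γ ⊗ u ⊕ ⊝ (δ ⊗ v)) (trans (cong (_⊕ ⊝ 𝟙) δδ′) (⊕-inverseʳ 𝟙)) (trans (cong (_⊕ ⊝ 𝟙) γγ′) (⊕-inverseʳ 𝟙))) ⟩
      γ ⊗ δ ⊗ 𝟘 ⊕ (γ ⊗ 𝟘 ⊕ ⊝ (δ ⊗ 𝟘))
        ≡⟨ solve 2 (λ γ δ → γ :* δ :* con (ℤ.+ 0) :+ (γ :* con (ℤ.+ 0) :+ :- (δ :* con (ℤ.+ 0))) := con (ℤ.+ 0)) refl γ δ ⟩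
      𝟘 ∎

module QuadraticExtension {p n : ℕ} (p-prime : Prime p)
  (F : FiniteField (p ^ n)) (K : FiniteField (p ^ (2 * n))) (ι : FieldHom F K) where
  open Embedding F K ι
  open Field K

  q : ℕ
  q = p ^ n

  private
    m : ℕ
    m = proj₁ (proj₂ 𝔽.primitive-root)
    gF : 𝔽.Carrier
    gF = proj₁ 𝔽.primitive-root
    gF-order : MulOrder F gF m
    gF-order = proj₁ (proj₂ (proj₂ 𝔽.primitive-root))
    q≡ : q ≡ suc m
    q≡ = proj₁ (proj₂ (proj₂ (proj₂ 𝔽.primitive-root)))
    fermat : ∀ x → x ≢ 𝔽.𝟘 → x 𝔽.↑ m ≡ 𝔽.𝟙
    fermat = proj₂ (proj₂ (proj₂ (proj₂ 𝔽.primitive-root)))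

    M : ℕ
    M = proj₁ (proj₂ primitive-root)
    g : Carrier
    g = proj₁ primitive-root
    g-order : MulOrder K g M
    g-order = proj₁ (proj₂ (proj₂ primitive-root))

    M≡ : M ≡ m * suc (suc m)
    M≡ = suc-injective (begin
      suc M                   ≡⟨ proj₁ (proj₂ (proj₂ (proj₂ primitive-root))) ⟨
      p ^ (2 * n)             ≡⟨ cong (λ k → p ^ (n + k)) (+-identityʳ n) ⟩
      p ^ (n + n)             ≡⟨ ^-distribˡ-+-* p n n ⟩
      q * q                   ≡⟨ cong₂ _*_ q≡ q≡ ⟩
      suc m * suc m           ≡⟨ [1+m]²≡1+m[2+m] m ⟩
      suc (m * suc (suc m))   ∎)
      where open ≡-Reasoning

    q∸1≡ : q ∸ 1 ≡ m
    q∸1≡ = cong (_∸ 1) q≡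
    q+1≡ : q + 1 ≡ suc (suc m)
    q+1≡ = trans (+-comm q 1) (cong suc q≡)

    -- Here m = q - 1 and g has order m (m + 2), so the complementary exponents m + 2 and m give
    -- generators of the groups of order q - 1 and q + 1.
    θ₋ θ₊ : Carrier
    θ₋ = g ↑ suc (suc m)
    θ₊ = g ↑ m

    θ₋-order : MulOrder K θ₋ m
    θ₋-order = order-↑ (suc (suc m)) (subst (MulOrder K g) (trans M≡ (*-comm m (suc (suc m)))) g-order)
    θ₊-order : MulOrder K θ₊ (suc (suc m))
    θ₊-order = order-↑ m (subst (MulOrder K g) M≡ g-order)

    -- The image of `gF` has order q - 1 in K and thus generates all elements of K killed by q - 1.
    torsion⇒F : ∀ {y} → y ↑ m ≡ 𝟙 → ∃ λ x → ⟦ x ⟧ ≡ y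
    torsion⇒F ym = case order-generates (ι-order gF-order) ym of λ
      { (k , _ , y≡) → gF 𝔽.↑ k , trans (ι-↑ gF k) (sym y≡) }

    fixed⇒F : ∀ {y} → y ↑ suc m ≡ y → ∃ λ x → ⟦ x ⟧ ≡ y
    fixed⇒F {y} yq with y ≟ 𝟘
    ... | yes refl = 𝔽.𝟘 , hom-0
    ... | no y≢0 = torsion⇒F (↑-cancel 1 m y≢0 (trans (↑1 y) (sym yq)))

    trace₋ : ∀ {γ δ} → γ ⊗ δ ≡ 𝟙 → γ ↑ m ≡ 𝟙 → ∃ λ x → ⟦ x ⟧ ≡ γ ⊕ δ
    trace₋ {γ} {δ} γδ γm = add (torsion⇒F γm) (torsion⇒F (inverse-↑≡1 {n = m} γδ γm))
      where
      add : (∃ λ x → ⟦ x ⟧ ≡ γ) → (∃ λ x → ⟦ x ⟧ ≡ δ) → ∃ λ x → ⟦ x ⟧ ≡ γ ⊕ δ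
      add (x , x≡) (y , y≡) = x 𝔽.⊕ y , trans (hom-+ x y) (cong₂ _⊕_ x≡ y≡)

    -- If γ^(q+1) = 1, then the Frobenius automorphism exchanges γ and γ⁻¹, so it fixes γ + γ⁻¹.
    trace₊ : ∀ {γ δ} → γ ⊗ δ ≡ 𝟙 → γ ↑ suc (suc m) ≡ 𝟙 → ∃ λ x → ⟦ x ⟧ ≡ γ ⊕ δ
    trace₊ {γ} {δ} γδ γq = fixed⇒F (begin
      (γ ⊕ δ) ↑ suc m             ≡⟨ cong ((γ ⊕ δ) ↑_) q≡ ⟨
      (γ ⊕ δ) ↑ q                 ≡⟨ ↑pⁿ-⊕ p-prime (characteristic {p} {2 * n} refl) n γ δ ⟩
      γ ↑ q ⊕ δ ↑ q               ≡⟨ cong (λ k → γ ↑ k ⊕ δ ↑ k) q≡ ⟩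
      γ ↑ suc m ⊕ δ ↑ suc m       ≡⟨ cong₂ _⊕_ (inverse-unique γq γδ) (inverse-unique (inverse-↑≡1 {n = suc (suc m)} γδ γq) (trans (⊗-comm δ γ) γδ)) ⟩
      δ ⊕ γ                       ≡⟨ ⊕-comm δ γ ⟩
      γ ⊕ δ                       ∎)
      where
      open ≡-Reasoning
      open Frobenius K

    intersection : ∀ {γ} → γ ↑ m ≡ 𝟙 → γ ↑ suc (suc m) ≡ 𝟙 → γ ↑ 2 ≡ 𝟙
    intersection {γ} γm γq = ↑-suc≡1 2 m γm γq

    -- γ is 1 or -1, hence comes from F, where Fermat applies. Arguing this way treats even and odd
    -- q alike.
    involution : ∀ {γ} → γ ↑ 2 ≡ 𝟙 → γ ↑ m ≡ 𝟙
    involution {γ} γ² = cases (noZeroDivisors {γ ⊕ ⊝ 𝟙} {γ ⊕ 𝟙}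
      (trans (solve 2 (λ γ o → (γ :+ :- o) :* (γ :+ o) := γ :* γ :+ :- (o :* o)) refl γ 𝟙)
        (trans (cong₂ (λ u v → u ⊕ ⊝ v) (trans (cong (γ ⊗_) (sym (↑1 γ))) γ²) (⊗-identityʳ 𝟙)) (⊕-inverseʳ 𝟙))))
      where
      -1≢0 : 𝔽.⊝ 𝔽.𝟙 ≢ 𝔽.𝟘
      -1≢0 eq = 𝔽.0≢1 (trans (sym (𝔽.⊕-inverseˡ 𝔽.𝟙)) (trans (cong (𝔽._⊕ 𝔽.𝟙) eq) (𝔽.⊕-identityˡ 𝔽.𝟙)))
      γ≡ : γ ⊕ 𝟙 ≡ 𝟘 → γ ≡ ⟦ 𝔽.⊝ 𝔽.𝟙 ⟧
      γ≡ γ+1 = trans (solve 2 (λ γ o → γ := (γ :+ o) :+ :- o) refl γ 𝟙)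
        (trans (cong (_⊕ ⊝ 𝟙) γ+1) (trans (⊕-identityˡ _) (sym (trans (hom-- 𝔽.𝟙) (cong ⊝_ hom-1)))))
      cases : γ ⊕ ⊝ 𝟙 ≡ 𝟘 ⊎ γ ⊕ 𝟙 ≡ 𝟘 → γ ↑ m ≡ 𝟙
      cases (inj₁ γ-1) = trans (cong (_↑ m) (⊝-zero⇒≡ γ-1)) (𝟙↑ m)
      cases (inj₂ γ+1) = trans (cong (_↑ m) (γ≡ γ+1)) (trans (sym (ι-↑ _ m)) (trans (cong ⟦_⟧ (fermat _ -1≢0)) hom-1))

    power-param : ∀ {θ d} → MulOrder K θ d → (∀ {γ δ} → γ ⊗ δ ≡ 𝟙 → γ ↑ d ≡ 𝟙 → ∃ λ x → ⟦ x ⟧ ≡ γ ⊕ δ) →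
                  ∀ k → ∃ λ x → Param x (θ ↑ k)
    power-param {θ} {suc d} (_ , θd , _) trace k =
      -- The order is `suc d`, so `θ ↑ d` is the inverse of θ.
      proj₁ traced , (θ ↑ d) ↑ k , ↑-inverse k θd , proj₂ traced
      where
      traced : ∃ λ x → ⟦ x ⟧ ≡ θ ↑ k ⊕ (θ ↑ d) ↑ k
      traced = trace (↑-inverse k θd) (trans (↑-comm θ k (suc d)) (trans (cong (_↑ k) θd) (𝟙↑ k)))

    -- Equal vertices require θ^i = θ^j or θ^(i + j) = 1; both are impossible because 0 < i + j < 2j
    -- ≤ d. The lower halves of the exponents thus give distinct vertices.
    powers-separated : ∀ {θ d x} → MulOrder K θ d → ∀ {i j} → i < j → j + j ≤ d →
                       Param x (θ ↑ i) → Param x (θ ↑ j) → ⊥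
    powers-separated {θ} {d} o {i} {j} i<j 2j≤d pi pj = case param-fiber pi pj of λ where
      (inj₁ θj≡θi) → order-injective o i<j (≤-trans (m<m+n j (≤-<-trans z≤n i<j)) 2j≤d) (sym θj≡θi)
      (inj₂ θiθj) → <⇒≱ (≤-trans (+-monoˡ-< j i<j) 2j≤d)
            (∣⇒≤ {{>-nonZero (≤-trans (≤-<-trans z≤n i<j) (m≤n+m j i))}} (order-∣ o (trans (↑-+ θ i j) θiθj)))

    -- `v₊` starts at exponent 1, since the identity is already counted by `v₋`. For odd q the
    -- element -1 is also counted only there: it is θ₊ to the power (q + 1)/2, just beyond the range
    -- used for `v₊`.
    v₋ v₊ : ℕ → 𝔽.Carrier
    v₋ k = proj₁ (power-param θ₋-order trace₋ k)
    v₊ k = proj₁ (power-param θ₊-order trace₊ (suc k))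

    v₋-param : ∀ k → Param (v₋ k) (θ₋ ↑ k)
    v₋-param k = proj₂ (power-param θ₋-order trace₋ k)
    v₊-param : ∀ k → Param (v₊ k) (θ₊ ↑ suc k)
    v₊-param k = proj₂ (power-param θ₊-order trace₊ (suc k))

    -- γ ↦ γ + γ⁻¹ takes 1 + ⌊(q-1)/2⌋ values on the group of order q - 1 and ⌊q/2⌋ further ones on the
    -- group of order q + 1, that is, q values.
    values : List 𝔽.Carrier
    values = applyUpTo v₋ (suc ⌊ m /2⌋) ++ applyUpTo v₊ ⌈ m /2⌉

    length-values : length values ≡ q
    length-values = begin
      length values                                                    ≡⟨ length-++ (applyUpTo v₋ (suc ⌊ m /2⌋)) ⟩
      length (applyUpTo v₋ (suc ⌊ m /2⌋)) + length (applyUpTo v₊ ⌈ m /2⌉) ≡⟨ cong₂ _+_ (length-applyUpTo v₋ (suc ⌊ m /2⌋)) (length-applyUpTo v₊ ⌈ m /2⌉) ⟩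
      suc ⌊ m /2⌋ + ⌈ m /2⌉                                            ≡⟨ cong suc (⌊n/2⌋+⌈n/2⌉≡n m) ⟩
      suc m                                                            ≡⟨ q≡ ⟨
      q                                                                ∎
      where open ≡-Reasoning

    2k≤1+m : ∀ {k} → k < ⌈ m /2⌉ → suc k + suc k ≤ suc m
    2k≤1+m k< = ≤-trans (+-mono-≤ k< k<) (⌊n/2⌋+⌊n/2⌋≤n (suc m))

    -- A common vertex would put θ₊^(k + 1) into both groups, so its square would be 1 and q + 1
    -- would divide 2(k + 1) ≤ q.
    separated± : ∀ i {k x} → k < ⌈ m /2⌉ → Param x (θ₋ ↑ i) → Param x (θ₊ ↑ suc k) → ⊥
    separated± i {k} {x} k< p₋ p₊ = <⇒≱ (s≤s (2k≤1+m k<)) (∣⇒≤ (order-∣ θ₊-order (begin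
      θ₊ ↑ (suc k + suc k)             ≡⟨ cong (λ j → θ₊ ↑ (suc k + j)) (sym (+-identityʳ (suc k))) ⟩
      θ₊ ↑ (2 * suc k)                 ≡⟨ ↑-*′ θ₊ 2 (suc k) ⟩
      (θ₊ ↑ suc k) ↑ 2                 ≡⟨ intersection (θ₊k^m (param-fiber p₋ p₊)) θ₊k^q ⟩
      𝟙                                ∎)))
      where
      open ≡-Reasoning
      θ₋i^m : (θ₋ ↑ i) ↑ m ≡ 𝟙
      θ₋i^m = trans (↑-comm θ₋ i m) (trans (cong (_↑ i) (proj₁ (proj₂ θ₋-order))) (𝟙↑ i))
      θ₊k^q : (θ₊ ↑ suc k) ↑ suc (suc m) ≡ 𝟙
      θ₊k^q = trans (↑-comm θ₊ (suc k) (suc (suc m))) (trans (cong (_↑ suc k) (proj₁ (proj₂ θ₊-order))) (𝟙↑ (suc k)))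
      θ₊k^m : θ₊ ↑ suc k ≡ θ₋ ↑ i ⊎ θ₋ ↑ i ⊗ θ₊ ↑ suc k ≡ 𝟙 → (θ₊ ↑ suc k) ↑ m ≡ 𝟙
      θ₊k^m (inj₁ eq) = trans (cong (_↑ m) eq) θ₋i^m
      θ₊k^m (inj₂ eq) = inverse-↑≡1 {n = m} eq θ₋i^m

    values-unique : Unique values
    values-unique = Unique.++⁺
      (Unique.applyUpTo⁺₁ v₋ (suc ⌊ m /2⌋) λ {i} {j} i<j j<s eq → powers-separated θ₋-order i<j
        (≤-trans (+-mono-≤ (≤-pred j<s) (≤-pred j<s)) (⌊n/2⌋+⌊n/2⌋≤n m))
        (v₋-param i) (subst (λ x → Param x (θ₋ ↑ j)) (sym eq) (v₋-param j)))
      (Unique.applyUpTo⁺₁ v₊ ⌈ m /2⌉ λ {i} {j} i<j j<s eq → powers-separated θ₊-order (s≤s i<j)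
        (m≤n⇒m≤1+n (2k≤1+m j<s)) (v₊-param i) (subst (λ x → Param x (θ₊ ↑ suc j)) (sym eq) (v₊-param j)))
      λ { (x∈₋ , x∈₊) → disjoint (∈-applyUpTo⁻ v₋ x∈₋) (∈-applyUpTo⁻ v₊ x∈₊) }
      where
      disjoint : ∀ {x} → (∃ λ i → i < suc ⌊ m /2⌋ × x ≡ v₋ i) → (∃ λ k → k < ⌈ m /2⌉ × x ≡ v₊ k) → ⊥
      disjoint (i , _ , x≡₋) (k , k< , x≡₊) = separated± i k<
        (subst (λ x → Param x (θ₋ ↑ i)) (sym x≡₋) (v₋-param i)) (subst (λ x → Param x (θ₊ ↑ suc k)) (sym x≡₊) (v₊-param k))

    cover : ∀ x → ∃ λ γ → Param x γ × (γ ↑ m ≡ 𝟙 ⊎ γ ↑ suc (suc m) ≡ 𝟙)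
    cover x = from (∈-++⁻ (applyUpTo v₋ (suc ⌊ m /2⌋)) x∈values)
      where
      x∈values : x ∈ values
      x∈values = unique-covers 𝔽.enumeration values-unique (≤-reflexive (sym length-values)) x
      from₋ : (∃ λ i → i < suc ⌊ m /2⌋ × x ≡ v₋ i) → ∃ λ γ → Param x γ × (γ ↑ m ≡ 𝟙 ⊎ γ ↑ suc (suc m) ≡ 𝟙)
      from₋ (i , _ , x≡) = θ₋ ↑ i , subst (λ x → Param x (θ₋ ↑ i)) (sym x≡) (v₋-param i)
        , inj₁ (trans (↑-comm θ₋ i m) (trans (cong (_↑ i) (proj₁ (proj₂ θ₋-order))) (𝟙↑ i)))
      from₊ : (∃ λ k → k < ⌈ m /2⌉ × x ≡ v₊ k) → ∃ λ γ → Param x γ × (γ ↑ m ≡ 𝟙 ⊎ γ ↑ suc (suc m) ≡ 𝟙)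
      from₊ (k , _ , x≡) = θ₊ ↑ suc k , subst (λ x → Param x (θ₊ ↑ suc k)) (sym x≡) (v₊-param k)
        , inj₂ (trans (↑-comm θ₊ (suc k) (suc (suc m))) (trans (cong (_↑ suc k) (proj₁ (proj₂ θ₊-order))) (𝟙↑ (suc k))))
      from : x ∈ applyUpTo v₋ (suc ⌊ m /2⌋) ⊎ x ∈ applyUpTo v₊ ⌈ m /2⌉ → ∃ λ γ → Param x γ × (γ ↑ m ≡ 𝟙 ⊎ γ ↑ suc (suc m) ≡ 𝟙)
      from (inj₁ x∈) = from₋ (∈-applyUpTo⁻ v₋ x∈)
      from (inj₂ x∈) = from₊ (∈-applyUpTo⁻ v₊ x∈)

  -- (N , N′) stands for (q - 1 , q + 1) or (q + 1 , q - 1), so that parts (1) and (2) become one statement.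
  record Tori (N N′ : ℕ) : Set where
    field
      θ : Carrier
      θ-order : MulOrder K θ N
      trace : ∀ {γ δ} → γ ⊗ δ ≡ 𝟙 → γ ↑ N ≡ 𝟙 → ∃ λ x → ⟦ x ⟧ ≡ γ ⊕ δ
      covering : ∀ x → ∃ λ γ → Param x γ × (γ ↑ N ≡ 𝟙 ⊎ γ ↑ N′ ≡ 𝟙)
      meet : ∀ {γ} → γ ↑ N ≡ 𝟙 → γ ↑ N′ ≡ 𝟙 → γ ↑ 2 ≡ 𝟙
      involutionˡ : ∀ {γ} → γ ↑ 2 ≡ 𝟙 → γ ↑ N ≡ 𝟙
      involutionʳ : ∀ {γ} → γ ↑ 2 ≡ 𝟙 → γ ↑ N′ ≡ 𝟙

  tori : Tori (q ∸ 1) (q + 1)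
  tori = subst₂ Tori (sym q∸1≡) (sym q+1≡) record
    { θ = θ₋ ; θ-order = θ₋-order ; trace = trace₋ ; covering = cover ; meet = intersection
    ; involutionˡ = involution ; involutionʳ = λ {γ} γ² → trans (↑-+ γ 2 m) (trans (cong₂ _⊗_ γ² (involution γ²)) (⊗-identityˡ 𝟙)) }

  tori-swapped : Tori (q + 1) (q ∸ 1)
  tori-swapped = subst₂ Tori (sym q+1≡) (sym q∸1≡) record
    { θ = θ₊ ; θ-order = θ₊-order ; trace = trace₊
    ; covering = λ x → proj₁ (cover x) , proj₁ (proj₂ (cover x)) , Sum.swap (proj₂ (proj₂ (cover x)))
    ; meet = λ a b → intersection b a
    ; involutionˡ = λ {γ} γ² → trans (↑-+ γ 2 m) (trans (cong₂ _⊗_ γ² (involution γ²)) (⊗-identityˡ 𝟙)) ; involutionʳ = involution }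

  F-unit-torsion : ∀ {γ} → γ ↑ (q ∸ 1) ≡ 𝟙 → ∃ λ x → ⟦ x ⟧ ≡ γ
  F-unit-torsion {γ} γm = torsion⇒F (trans (cong (γ ↑_) (sym q∸1≡)) γm)

-- Dynamics of the Chebyshev polynomial

module _ {q : ℕ} (F : FiniteField q) (ℓ : ℕ) where
  open FiniteField F using (Carrier; enumeration)

  iter-T : ∀ j x → iter F ℓ j (T F ℓ x) ≡ iter F ℓ (suc j) x
  iter-T zero    x = refl
  iter-T (suc j) x = cong (T F ℓ) (iter-T j x)

  iter-+ : ∀ i j x → iter F ℓ (i + j) x ≡ iter F ℓ i (iter F ℓ j x)
  iter-+ zero    j x = refl
  iter-+ (suc i) j x = cong (T F ℓ) (iter-+ i j x)

  -- In a finite set every orbit runs into a cycle, so only the absence of periodicity has to be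
  -- checked for the hanging vertices.
  aperiodic⇒preperiodic : ∀ {x} → ¬ Periodic F ℓ x → StrictlyPreperiodic F ℓ x
  aperiodic⇒preperiodic {x} aperiodic with pigeonhole enumeration (λ i → iter F ℓ i x)
  ... | i , k , 1≤k , eq = (i , k , 1≤k , sym eq) , aperiodic

module ChebyshevAction {q r : ℕ} (F : FiniteField q) (K : FiniteField r) (ι : FieldHom F K) where
  open Embedding F K ι
  open Field K

  -- Expanding (γ + δ)(γ^(k+1) + δ^(k+1)) gives γ^(k+2) + δ^(k+2) + γδ (γ^k + δ^k); as γδ = 1, the
  -- Chebyshev recurrence subtracts the last term.
  chebPair-param : ∀ k {x γ δ} → γ ⊗ δ ≡ 𝟙 → ⟦ x ⟧ ≡ γ ⊕ δ →
    ⟦ proj₁ (chebPair F k x) ⟧ ≡ γ ↑ k ⊕ δ ↑ k × ⟦ proj₂ (chebPair F k x) ⟧ ≡ γ ↑ suc k ⊕ δ ↑ suc k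
  chebPair-param zero {x} {γ} {δ} γδ x≡ =
    trans (hom-+ _ _) (cong₂ _⊕_ hom-1 hom-1) , trans x≡ (sym (cong₂ _⊕_ (↑1 γ) (↑1 δ)))
  chebPair-param (suc k) {x} {γ} {δ} γδ x≡ = step (chebPair-param k γδ x≡)
    where
    open ≡-Reasoning
    t s : 𝔽.Carrier
    t = proj₁ (chebPair F k x)
    s = proj₂ (chebPair F k x)
    a b : Carrier
    a = γ ↑ k
    b = δ ↑ k
    step : ⟦ t ⟧ ≡ a ⊕ b × ⟦ s ⟧ ≡ γ ↑ suc k ⊕ δ ↑ suc k →
           ⟦ s ⟧ ≡ γ ↑ suc k ⊕ δ ↑ suc k × ⟦ x 𝔽.⊗ s 𝔽.⊕ 𝔽.⊝ t ⟧ ≡ γ ↑ suc (suc k) ⊕ δ ↑ suc (suc k)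
    step (t≡ , s≡) = s≡ , (begin
      ⟦ x 𝔽.⊗ s 𝔽.⊕ 𝔽.⊝ t ⟧                           ≡⟨ hom-+ _ _ ⟩
      ⟦ x 𝔽.⊗ s ⟧ ⊕ ⟦ 𝔽.⊝ t ⟧                         ≡⟨ cong₂ _⊕_ (trans (hom-* x s) (cong₂ _⊗_ x≡ s≡)) (trans (hom-- t) (cong ⊝_ t≡)) ⟩
      (γ ⊕ δ) ⊗ (γ ⊗ a ⊕ δ ⊗ b) ⊕ ⊝ (a ⊕ b)
        ≡⟨ solve 4 (λ γ δ a b → (γ :+ δ) :* (γ :* a :+ δ :* b) :+ :- (a :+ b)
             := (γ :* (γ :* a) :+ δ :* (δ :* b)) :+ (γ :* δ :* (a :+ b) :+ :- (a :+ b))) refl γ δ a b ⟩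
      γ ⊗ (γ ⊗ a) ⊕ δ ⊗ (δ ⊗ b) ⊕ (γ ⊗ δ ⊗ (a ⊕ b) ⊕ ⊝ (a ⊕ b))
        ≡⟨ cong (γ ⊗ (γ ⊗ a) ⊕ δ ⊗ (δ ⊗ b) ⊕_) (trans (cong (λ u → u ⊗ (a ⊕ b) ⊕ ⊝ (a ⊕ b)) γδ)
             (trans (cong (_⊕ ⊝ (a ⊕ b)) (⊗-identityˡ _)) (⊕-inverseʳ _))) ⟩
      γ ⊗ (γ ⊗ a) ⊕ δ ⊗ (δ ⊗ b) ⊕ 𝟘                  ≡⟨ ⊕-identityʳ _ ⟩
      γ ⊗ (γ ⊗ a) ⊕ δ ⊗ (δ ⊗ b)                      ∎)

  T-param : ∀ ℓ {x γ} → Param x γ → Param (T F ℓ x) (γ ↑ ℓ)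
  T-param ℓ {x} {γ} (δ , γδ , x≡) = δ ↑ ℓ , ↑-inverse ℓ γδ , proj₁ (chebPair-param ℓ γδ x≡)

  iter-param : ∀ ℓ j {x γ} → Param x γ → Param (iter F ℓ j x) (γ ↑ (ℓ ^ j))
  iter-param ℓ zero    {x} {γ} px = subst (Param x) (sym (↑1 γ)) px
  iter-param ℓ (suc j) {x} {γ} px =
    subst (Param (iter F ℓ (suc j) x)) (sym (↑-*′ γ ℓ (ℓ ^ j))) (T-param ℓ (iter-param ℓ j px))

-- Preimages and trees in the group of order N = ω ℓ^e

module Dynamics {p n : ℕ} (p-prime : Prime p) (F : FiniteField (p ^ n)) (K : FiniteField (p ^ (2 * n))) (ι : FieldHom F K)
  {N N′ : ℕ} (tori : QuadraticExtension.Tori {n = n} p-prime F K ι N N′)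
  {ℓ : ℕ} (ℓ-prime : Prime ℓ) (ω e : ℕ) (N≡ : N ≡ ω * ℓ ^ e) (ℓ⊥ω : Coprime ℓ ω) where
  open Embedding F K ι
  open ChebyshevAction F K ι
  open Field K
  open QuadraticExtension.Tori tori

  private
    instance
      ℓ≢0 : NonZero ℓ
      ℓ≢0 = prime⇒nonZero ℓ-prime
    1<ℓ : 1 < ℓ
    1<ℓ = nonTrivial⇒n>1 ℓ {{prime⇒nonTrivial ℓ-prime}}
    1≤N : 1 ≤ N
    1≤N = proj₁ θ-order
    Tℓ : 𝔽.Carrier → 𝔽.Carrier
    Tℓ = T F ℓ
    it : ℕ → 𝔽.Carrier → 𝔽.Carrier
    it = iter F ℓ

  torus-inverse : ∀ {γ} → γ ↑ N ≡ 𝟙 → ∃ λ δ → γ ⊗ δ ≡ 𝟙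
  torus-inverse {γ} γN = γ ↑ (N ∸ 1) , trans (cong (γ ↑_) (m+[n∸m]≡n 1≤N)) γN

  vertex : ∀ {γ} → γ ↑ N ≡ 𝟙 → ∃ λ x → Param x γ
  vertex {γ} γN = proj₁ traced , proj₁ (torus-inverse γN) , proj₂ (torus-inverse γN) , proj₂ traced
    where
    traced : ∃ λ x → ⟦ x ⟧ ≡ γ ⊕ proj₁ (torus-inverse γN)
    traced = trace (proj₂ (torus-inverse γN)) γN

  -- Replacing δ by δ⁻¹ if necessary, an iterated preimage of γ + γ⁻¹ is parametrised by a root of γ.
  lift : ∀ j {u v γ} → it j u ≡ v → Param v γ →
         ∃ λ δ → Param u δ × δ ↑ (ℓ ^ j) ≡ γ × (δ ↑ N ≡ 𝟙 ⊎ δ ↑ N′ ≡ 𝟙)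
  lift j {u} {v} {γ} eq pv = choose (covering u)
    where
    Goal : Set
    Goal = ∃ λ δ → Param u δ × δ ↑ (ℓ ^ j) ≡ γ × (δ ↑ N ≡ 𝟙 ⊎ δ ↑ N′ ≡ 𝟙)
    flip : ∀ {δ δ′} → δ ⊗ δ′ ≡ 𝟙 → Param u δ → (δ ↑ N ≡ 𝟙 ⊎ δ ↑ N′ ≡ 𝟙) → γ ⊗ δ ↑ (ℓ ^ j) ≡ 𝟙 → Goal
    flip {δ} {δ′} δδ′ pu tors γδ = δ′ , param-inverse δδ′ pu
      , inverse-unique (↑-inverse (ℓ ^ j) δδ′) (trans (⊗-comm _ γ) γδ)
      , Sum.map (inverse-↑≡1 {n = N} δδ′) (inverse-↑≡1 {n = N′} δδ′) tors
    choose : (∃ λ δ → Param u δ × (δ ↑ N ≡ 𝟙 ⊎ δ ↑ N′ ≡ 𝟙)) → Goal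
    choose (δ , pu@(δ′ , δδ′ , _) , tors) =
      Sum.[ (λ δℓ≡γ → δ , pu , δℓ≡γ , tors) , flip δδ′ pu tors ]′
        (param-fiber pv (subst (λ x → Param x (δ ↑ (ℓ ^ j))) eq (iter-param ℓ j pu)))

  -- A root δ in the other group would put γ into both groups, where squares are 1.
  lift-torus : ∀ j {u v γ} → it j u ≡ v → Param v γ → γ ↑ N ≡ 𝟙 → γ ↑ 2 ≢ 𝟙 →
               ∃ λ δ → Param u δ × δ ↑ (ℓ ^ j) ≡ γ × δ ↑ N ≡ 𝟙
  lift-torus j {u} {v} {γ} eq pv γN γ² = choose (lift j eq pv)
    where
    choose : (∃ λ δ → Param u δ × δ ↑ (ℓ ^ j) ≡ γ × (δ ↑ N ≡ 𝟙 ⊎ δ ↑ N′ ≡ 𝟙)) → ∃ λ δ → Param u δ × δ ↑ (ℓ ^ j) ≡ γ × δ ↑ N ≡ 𝟙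
    choose (δ , pu , δℓ , inj₁ δN) = δ , pu , δℓ , δN
    choose (δ , pu , δℓ , inj₂ δN′) = contradiction (meet γN
      (trans (cong (_↑ N′) (sym δℓ)) (trans (↑-comm δ (ℓ ^ j) N′) (trans (cong (_↑ (ℓ ^ j)) δN′) (𝟙↑ (ℓ ^ j)))))) γ²

  -- Write γ = θ^i. Then γ^a = 1 means that N = ab divides ai, so b divides i.
  root-exists : ∀ a b → N ≡ a * b → ∀ {γ} → γ ↑ a ≡ 𝟙 → ∃ λ δ → δ ↑ b ≡ γ × δ ↑ N ≡ 𝟙
  root-exists a b N≡ab {γ} γa = build (order-generates θ-order (↑-∣ {γ} {a} γa (divides b (trans N≡ab (*-comm a b)))))
    where
    instance
      a≢0 : NonZero a
      a≢0 = m*n≢0⇒m≢0 a {{>-nonZero (subst (1 ≤_) N≡ab 1≤N)}}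
    build : (∃ λ i → i < N × γ ≡ θ ↑ i) → ∃ λ δ → δ ↑ b ≡ γ × δ ↑ N ≡ 𝟙
    build (i , _ , γ≡) = root (*-cancelˡ-∣ a (subst₂ _∣_ N≡ab refl (order-∣ θ-order
        (trans (↑-*′ θ a i) (trans (cong (_↑ a) (sym γ≡)) γa)))))
      where
      root : b ∣ i → ∃ λ δ → δ ↑ b ≡ γ × δ ↑ N ≡ 𝟙
      root (divides c i≡) = θ ↑ c , trans (sym (↑-* θ c b)) (trans (cong (θ ↑_) (sym i≡)) (sym γ≡))
        , trans (↑-comm θ c N) (trans (cong (_↑ c) (proj₁ (proj₂ θ-order))) (𝟙↑ c))

  -- Level k: the order of γ divides N and contains ℓ exactly to the power k + 1.
  record HasLevel (γ : Carrier) (k : ℕ) : Set where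
    constructor level
    field
      torsion : γ ↑ (ω * ℓ ^ suc k) ≡ 𝟙
      exact   : γ ↑ (ω * ℓ ^ k) ≢ 𝟙
  open HasLevel

  ω*ℓ^-∣ : ∀ {j k} → j ≤ k → ω * ℓ ^ j ∣ ω * ℓ ^ k
  ω*ℓ^-∣ {j} {k} j≤k = *-monoʳ-∣ ω (subst (λ k → ℓ ^ j ∣ ℓ ^ k) (m+[n∸m]≡n j≤k)
    (subst (ℓ ^ j ∣_) (sym (^-distribˡ-+-* ℓ j (k ∸ j))) (m∣m*n _)))

  level-≤ : ∀ {γ j k} → HasLevel γ j → HasLevel γ k → k ≤ j
  level-≤ {γ} {j} {k} lj lk = ≮⇒≥ λ j<k → exact lk (↑-∣ {γ} {ω * ℓ ^ suc j} (torsion lj) (ω*ℓ^-∣ j<k))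

  level-unique : ∀ {γ j k} → HasLevel γ j → HasLevel γ k → j ≡ k
  level-unique lj lk = ≤-antisym (level-≤ lk lj) (level-≤ lj lk)

  level-inverse : ∀ {γ δ k} → γ ⊗ δ ≡ 𝟙 → HasLevel γ k → HasLevel δ k
  level-inverse {γ} {δ} {k} γδ l = level (inverse-↑≡1 {n = ω * ℓ ^ suc k} γδ (torsion l))
    λ δk → exact l (inverse-↑≡1 {n = ω * ℓ ^ k} (trans (⊗-comm δ γ) γδ) δk)

  level-param : ∀ {x γ δ k} → Param x γ → Param x δ → HasLevel γ k → HasLevel δ k
  level-param {γ = γ} {δ} {k} pγ pδ lγ =
    Sum.[ (λ δ≡γ → subst (λ γ → HasLevel γ k) (sym δ≡γ) lγ) , (λ γδ → level-inverse γδ lγ) ]′ (param-fiber pγ pδ)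

  ↑-ω*ℓ^ : ∀ {γ δ} h → δ ↑ (ℓ ^ h) ≡ γ → ∀ k → δ ↑ (ω * ℓ ^ (h + k)) ≡ γ ↑ (ω * ℓ ^ k)
  ↑-ω*ℓ^ {γ} {δ} h eq k = begin
    δ ↑ (ω * ℓ ^ (h + k))        ≡⟨ cong (λ z → δ ↑ (ω * z)) (^-distribˡ-+-* ℓ h k) ⟩
    δ ↑ (ω * (ℓ ^ h * ℓ ^ k))    ≡⟨ cong (δ ↑_) (x∙yz≈y∙xz ω (ℓ ^ h) (ℓ ^ k)) ⟩
    δ ↑ (ℓ ^ h * (ω * ℓ ^ k))    ≡⟨ ↑-* δ (ℓ ^ h) (ω * ℓ ^ k) ⟩
    (δ ↑ (ℓ ^ h)) ↑ (ω * ℓ ^ k)  ≡⟨ cong (_↑ (ω * ℓ ^ k)) eq ⟩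
    γ ↑ (ω * ℓ ^ k)              ∎
    where
    open ≡-Reasoning
    open import Algebra.Properties.CommutativeSemigroup *-commutativeSemigroup using (x∙yz≈y∙xz)

  -- Since δ^(ω ℓ^(h+k)) = γ^(ω ℓ^k), each step backwards raises the level by one. Distances to the
  -- root of a tree become differences of levels.
  level-root : ∀ {γ δ k} h → δ ↑ (ℓ ^ h) ≡ γ → HasLevel γ k → HasLevel δ (h + k)
  level-root {γ} {δ} {k} h eq l = level
    (trans (cong (λ j → δ ↑ (ω * ℓ ^ j)) (sym (+-suc h k))) (trans (↑-ω*ℓ^ h eq (suc k)) (torsion l)))
    λ δk → exact l (trans (sym (↑-ω*ℓ^ h eq k)) δk)

  -- A return to x after h + 1 steps would make the level of γ exceed itself by h + 1.
  level-aperiodic : ∀ {x γ k} → Param x γ → HasLevel γ k → ∀ h → it (suc h) x ≢ x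
  level-aperiodic {x} {γ} {k} px lγ h eq = <⇒≢ (m<1+n+m k h) (level-unique lγ
    (level-root (suc h) refl (level-param px (subst (λ y → Param y (γ ↑ (ℓ ^ suc h))) eq (iter-param ℓ (suc h) px)) lγ)))
    where
    m<1+n+m : ∀ m n → m < suc n + m
    m<1+n+m m n = s≤s (m≤n+m m n)

  level⇒preperiodic : ∀ {x γ k} → Param x γ → HasLevel γ k → StrictlyPreperiodic F ℓ x
  level⇒preperiodic px lγ = aperiodic⇒preperiodic F ℓ λ { (suc π , _ , eq) → level-aperiodic px lγ π eq }

  module _ {H : ℕ} (e≡ : e ≡ suc H) where

    private
      a : ℕ
      a = ω * ℓ ^ H
      N≡aℓ : N ≡ a * ℓ
      N≡aℓ = trans N≡ (trans (cong (λ k → ω * ℓ ^ k) e≡) (trans (cong (ω *_) (*-comm ℓ (ℓ ^ H))) (sym (*-assoc ω (ℓ ^ H) ℓ))))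

    -- A primitive ℓ-th root of unity, available because ℓ divides N. The ℓ-th roots of an ℓ-th
    -- power form a coset of its powers.
    ζ : Carrier
    ζ = θ ↑ a

    ζ-order : MulOrder K ζ ℓ
    ζ-order = order-↑ a (subst (MulOrder K θ) N≡aℓ θ-order)

    ζ↑ℓ : ∀ j → (ζ ↑ j) ↑ ℓ ≡ 𝟙
    ζ↑ℓ j = trans (↑-comm ζ j ℓ) (trans (cong (_↑ j) (proj₁ (proj₂ ζ-order))) (𝟙↑ j))

    coset-↑ℓ : ∀ δ j → (δ ⊗ ζ ↑ j) ↑ ℓ ≡ δ ↑ ℓ
    coset-↑ℓ δ j = trans (↑-⊗ δ (ζ ↑ j) ℓ) (trans (cong (δ ↑ ℓ ⊗_) (ζ↑ℓ j)) (⊗-identityʳ _))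

    coset-↑N : ∀ {δ} j → δ ↑ N ≡ 𝟙 → (δ ⊗ ζ ↑ j) ↑ N ≡ 𝟙
    coset-↑N {δ} j δN = ⊗-↑≡1 N δN (↑-∣ {ζ ↑ j} {ℓ} (ζ↑ℓ j) (divides a N≡aℓ))

    coset-complete : ∀ {δ δ₀} → δ₀ ↑ N ≡ 𝟙 → δ ↑ ℓ ≡ δ₀ ↑ ℓ → ∃ λ j → j < ℓ × δ ≡ δ₀ ⊗ ζ ↑ j
    coset-complete {δ} {δ₀} δ₀N eq = build (torus-inverse δ₀N)
      where
      open ≡-Reasoning
      build : (∃ λ δ₁ → δ₀ ⊗ δ₁ ≡ 𝟙) → ∃ λ j → j < ℓ × δ ≡ δ₀ ⊗ ζ ↑ j
      build (δ₁ , δ₀δ₁) = finish (order-generates ζ-order (begin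
          (δ ⊗ δ₁) ↑ ℓ          ≡⟨ ↑-⊗ δ δ₁ ℓ ⟩
          δ ↑ ℓ ⊗ δ₁ ↑ ℓ        ≡⟨ cong (_⊗ δ₁ ↑ ℓ) eq ⟩
          δ₀ ↑ ℓ ⊗ δ₁ ↑ ℓ       ≡⟨ ↑-inverse ℓ δ₀δ₁ ⟩
          𝟙                     ∎))
        where
        finish : (∃ λ j → j < ℓ × δ ⊗ δ₁ ≡ ζ ↑ j) → ∃ λ j → j < ℓ × δ ≡ δ₀ ⊗ ζ ↑ j
        finish (j , j<ℓ , ζj) = j , j<ℓ , (begin
          δ                  ≡⟨ ⊗-identityˡ δ ⟨
          𝟙 ⊗ δ              ≡⟨ cong (_⊗ δ) δ₀δ₁ ⟨
          δ₀ ⊗ δ₁ ⊗ δ        ≡⟨ trans (⊗-assoc δ₀ δ₁ δ) (cong (δ₀ ⊗_) (⊗-comm δ₁ δ)) ⟩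
          δ₀ ⊗ (δ ⊗ δ₁)      ≡⟨ cong (δ₀ ⊗_) ζj ⟩
          δ₀ ⊗ ζ ↑ j         ∎)

    coset-injective : ∀ {δ₀ i j} → δ₀ ↑ N ≡ 𝟙 → i < j → j < ℓ → δ₀ ⊗ ζ ↑ j ≢ δ₀ ⊗ ζ ↑ i
    coset-injective δ₀N i<j j<ℓ eq = order-injective ζ-order i<j j<ℓ (sym (⊗-cancelˡ (↑≡1⇒≢0 1≤N δ₀N) eq))

    -- The ω-th power of δ₀ ζ^j is ζ^(jω), and the prime ℓ, which is the order of ζ, divides neither
    -- j nor ω.
    coset-level : ∀ {δ₀ j} → δ₀ ↑ ω ≡ 𝟙 → 1 ≤ j → j < ℓ → HasLevel (δ₀ ⊗ ζ ↑ j) 0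
    coset-level {δ₀} {j} δ₀ω 1≤j j<ℓ = level
      (begin
        (δ₀ ⊗ ζ ↑ j) ↑ (ω * (ℓ * 1))     ≡⟨ cong (λ k → (δ₀ ⊗ ζ ↑ j) ↑ (ω * k)) (*-identityʳ ℓ) ⟩
        (δ₀ ⊗ ζ ↑ j) ↑ (ω * ℓ)           ≡⟨ ↑-*′ _ ω ℓ ⟩
        ((δ₀ ⊗ ζ ↑ j) ↑ ℓ) ↑ ω           ≡⟨ cong (_↑ ω) (coset-↑ℓ δ₀ j) ⟩
        (δ₀ ↑ ℓ) ↑ ω                     ≡⟨ ↑-comm δ₀ ℓ ω ⟩
        (δ₀ ↑ ω) ↑ ℓ                     ≡⟨ trans (cong (_↑ ℓ) δ₀ω) (𝟙↑ ℓ) ⟩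
        𝟙                                ∎)
      λ eq → prime-coprime⇒∤ ℓ-prime ℓ⊥ω
          (Sum.[ (λ ℓ∣j → contradiction (∣⇒≤ {{>-nonZero 1≤j}} ℓ∣j) (<⇒≱ j<ℓ)) , id ]′
            (euclidsLemma j ω ℓ-prime (order-∣ ζ-order (begin
              ζ ↑ (j * ω)                ≡⟨ ↑-* ζ j ω ⟩
              (ζ ↑ j) ↑ ω                ≡⟨ ⊗-identityˡ _ ⟨
              𝟙 ⊗ (ζ ↑ j) ↑ ω            ≡⟨ cong (_⊗ (ζ ↑ j) ↑ ω) δ₀ω ⟨
              δ₀ ↑ ω ⊗ (ζ ↑ j) ↑ ω       ≡⟨ ↑-⊗ δ₀ (ζ ↑ j) ω ⟨
              (δ₀ ⊗ ζ ↑ j) ↑ ω           ≡⟨ cong ((δ₀ ⊗ ζ ↑ j) ↑_) (*-identityʳ ω) ⟨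
              (δ₀ ⊗ ζ ↑ j) ↑ (ω * 1)     ≡⟨ eq ⟩
              𝟙                          ∎))))
      where open ≡-Reasoning

    module _ {δ₀ : Carrier} (δ₀N : δ₀ ↑ N ≡ 𝟙) where

      cosetVertex : ℕ → 𝔽.Carrier
      cosetVertex j = proj₁ (vertex (coset-↑N j δ₀N))

      cosetVertex-param : ∀ j → Param (cosetVertex j) (δ₀ ⊗ ζ ↑ j)
      cosetVertex-param j = proj₂ (vertex (coset-↑N j δ₀N))

      cosetVertex-T : ∀ {v} → Param v (δ₀ ↑ ℓ) → ∀ j → Tℓ (cosetVertex j) ≡ v
      cosetVertex-T {v} pv j = param-unique (T-param ℓ (cosetVertex-param j)) (subst (Param v) (sym (coset-↑ℓ δ₀ j)) pv)

      -- Two different roots with the same vertex are mutually inverse, and taking ℓ-th powers then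
      -- makes γ = δ₀^ℓ square to 1.
      cosetVertex-injective : (δ₀ ↑ ℓ) ↑ 2 ≢ 𝟙 → ∀ {i j} → i < j → j < ℓ → cosetVertex i ≢ cosetVertex j
      cosetVertex-injective γ² {i} {j} i<j j<ℓ eq =
        Sum.[ coset-injective δ₀N i<j j<ℓ , (λ prod → γ² (begin
          (δ₀ ↑ ℓ) ↑ 2                            ≡⟨ cong (δ₀ ↑ ℓ ⊗_) (↑1 (δ₀ ↑ ℓ)) ⟩
          δ₀ ↑ ℓ ⊗ δ₀ ↑ ℓ                         ≡⟨ cong₂ _⊗_ (coset-↑ℓ δ₀ i) (coset-↑ℓ δ₀ j) ⟨
          (δ₀ ⊗ ζ ↑ i) ↑ ℓ ⊗ (δ₀ ⊗ ζ ↑ j) ↑ ℓ     ≡⟨ ↑-⊗ (δ₀ ⊗ ζ ↑ i) (δ₀ ⊗ ζ ↑ j) ℓ ⟨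
          ((δ₀ ⊗ ζ ↑ i) ⊗ (δ₀ ⊗ ζ ↑ j)) ↑ ℓ       ≡⟨ trans (cong (_↑ ℓ) prod) (𝟙↑ ℓ) ⟩
          𝟙                                       ∎)) ]′
        (param-fiber (cosetVertex-param i) (subst (λ x → Param x (δ₀ ⊗ ζ ↑ j)) (sym eq) (cosetVertex-param j)))
        where open ≡-Reasoning

      module _ {v : 𝔽.Carrier} (pv : Param v (δ₀ ↑ ℓ)) (γ² : (δ₀ ↑ ℓ) ↑ 2 ≢ 𝟙) where

        private
          γN : (δ₀ ↑ ℓ) ↑ N ≡ 𝟙
          γN = trans (↑-comm δ₀ ℓ N) (trans (cong (_↑ ℓ) δ₀N) (𝟙↑ ℓ))

        fiber⇒coset : ∀ {u} → Tℓ u ≡ v → ∃ λ j → j < ℓ × Param u (δ₀ ⊗ ζ ↑ j)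
        fiber⇒coset {u} eq = coset (lift-torus 1 eq pv γN γ²)
          where
          coset : (∃ λ δ → Param u δ × δ ↑ (ℓ ^ 1) ≡ δ₀ ↑ ℓ × δ ↑ N ≡ 𝟙) → ∃ λ j → j < ℓ × Param u (δ₀ ⊗ ζ ↑ j)
          coset (δ , pu , δℓ , δN) = translate (coset-complete δ₀N (trans (cong (δ ↑_) (sym (*-identityʳ ℓ))) δℓ))
            where
            translate : (∃ λ j → j < ℓ × δ ≡ δ₀ ⊗ ζ ↑ j) → ∃ λ j → j < ℓ × Param u (δ₀ ⊗ ζ ↑ j)
            translate (j , j<ℓ , δ≡) = j , j<ℓ , subst (Param u) δ≡ pu

        fiber-card : HasCard F (λ u → Tℓ u ≡ v) ℓ
        fiber-card = applyUpTo cosetVertex ℓ , length-applyUpTo cosetVertex ℓ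
          , Unique.applyUpTo⁺₁ cosetVertex ℓ (cosetVertex-injective γ²) , λ u → ∈⇒ , ⇒∈
          where
          ∈⇒ : ∀ {u} → u ∈ applyUpTo cosetVertex ℓ → Tℓ u ≡ v
          ∈⇒ u∈ = case ∈-applyUpTo⁻ cosetVertex u∈ of λ { (j , _ , u≡) → trans (cong Tℓ u≡) (cosetVertex-T pv j) }
          ⇒∈ : ∀ {u} → Tℓ u ≡ v → u ∈ applyUpTo cosetVertex ℓ
          ⇒∈ eq = case fiber⇒coset eq of λ { (j , j<ℓ , pu) →
            subst (_∈ applyUpTo cosetVertex ℓ) (param-unique (cosetVertex-param j) pu) (∈-applyUpTo⁺ cosetVertex j<ℓ) }

        -- Here δ₀ is the ℓ-th root whose order is prime to ℓ. Its vertex, j = 0, is the predecessor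
        -- on the cycle; the other ℓ - 1 roots have level 0, so their vertices are aperiodic.
        hanging-card : δ₀ ↑ ω ≡ 𝟙 → (∀ {u} → Param u δ₀ → Periodic F ℓ u) →
          HasCard F (λ u → Tℓ u ≡ v × StrictlyPreperiodic F ℓ u) (ℓ ∸ 1)
          × (∀ u → Tℓ u ≡ v → StrictlyPreperiodic F ℓ u → ∃ λ j → 1 ≤ j × j < ℓ × Param u (δ₀ ⊗ ζ ↑ j))
        hanging-card δ₀ω periodic =
          (applyUpTo nontrivial (ℓ ∸ 1) , length-applyUpTo nontrivial (ℓ ∸ 1)
            , Unique.applyUpTo⁺₁ nontrivial (ℓ ∸ 1) (λ i<j j< → cosetVertex-injective γ² (s≤s i<j) (suc<ℓ j<))
            , λ u → ∈⇒ , λ { (eq , sp) → ⇒∈ u (classify u eq sp) })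
          , classify
          where
          nontrivial : ℕ → 𝔽.Carrier
          nontrivial j = cosetVertex (suc j)
          suc<ℓ : ∀ {j} → j < ℓ ∸ 1 → suc j < ℓ
          suc<ℓ j< = subst (suc _ <_) (m+[n∸m]≡n (<⇒≤ 1<ℓ)) (s≤s j<)
          classify : ∀ u → Tℓ u ≡ v → StrictlyPreperiodic F ℓ u → ∃ λ j → 1 ≤ j × j < ℓ × Param u (δ₀ ⊗ ζ ↑ j)
          classify u eq (_ , ¬per) = case fiber⇒coset eq of λ where
            (zero , _ , pu) → contradiction (periodic (subst (Param u) (⊗-identityʳ δ₀) pu)) ¬per
            (suc j , j<ℓ , pu) → suc j , s≤s z≤n , j<ℓ , pu
          ∈⇒ : ∀ {u} → u ∈ applyUpTo nontrivial (ℓ ∸ 1) → Tℓ u ≡ v × StrictlyPreperiodic F ℓ u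
          ∈⇒ u∈ = case ∈-applyUpTo⁻ nontrivial u∈ of λ { (j , j< , u≡) →
            trans (cong Tℓ u≡) (cosetVertex-T pv (suc j))
            , subst (StrictlyPreperiodic F ℓ) (sym u≡) (level⇒preperiodic (cosetVertex-param (suc j)) (coset-level δ₀ω (s≤s z≤n) (suc<ℓ j<))) }
          ⇒∈ : ∀ u → (∃ λ j → 1 ≤ j × j < ℓ × Param u (δ₀ ⊗ ζ ↑ j)) → u ∈ applyUpTo nontrivial (ℓ ∸ 1)
          ⇒∈ u (suc j , _ , j<ℓ , pu) = subst (_∈ applyUpTo nontrivial (ℓ ∸ 1)) (param-unique (cosetVertex-param (suc j)) pu)
            (∈-applyUpTo⁺ nontrivial (≤-pred (subst (suc (suc j) ≤_) (sym (m+[n∸m]≡n (<⇒≤ 1<ℓ))) j<ℓ)))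

  module _ {k H : ℕ} (e≡ : e ≡ suc (k + H)) {b δ} (pb : Param b δ) (δN : δ ↑ N ≡ 𝟙) (δ² : δ ↑ 2 ≢ 𝟙) (lδ : HasLevel δ k) where

    private
      a : ℕ
      a = ω * ℓ ^ (k + H)
      N≡aℓ : N ≡ a * ℓ
      N≡aℓ = trans N≡ (trans (cong (λ k → ω * ℓ ^ k) e≡)
        (trans (cong (ω *_) (*-comm ℓ (ℓ ^ (k + H)))) (sym (*-assoc ω (ℓ ^ (k + H)) ℓ))))

      Node : 𝔽.Carrier → ℕ → Set
      Node c h = ∃ λ η → Param c η × η ↑ (ℓ ^ h) ≡ δ × η ↑ N ≡ 𝟙

      node : ∀ {c} h → it h c ≡ b → Node c h
      node h eq = lift-torus h eq pb δN δ²

      node² : ∀ {η} h → η ↑ (ℓ ^ h) ≡ δ → η ↑ 2 ≢ 𝟙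
      node² {η} h ηδ η² = δ² (trans (cong (_↑ 2) (sym ηδ)) (trans (↑-comm η (ℓ ^ h) 2) (trans (cong (_↑ (ℓ ^ h)) η²) (𝟙↑ (ℓ ^ h)))))

      -- If b were a preimage of a vertex of its own tree, b would be periodic, against its level.
      -- This supplies the condition `u ≢ b` in `Indeg`.
      child≢b : ∀ {c u} h → it h c ≡ b → Tℓ u ≡ c → u ≢ b
      child≢b {c} {u} h eq Tu u≡b = level-aperiodic pb lδ h
        (trans (sym (iter-T F ℓ h b)) (trans (cong (it h) (trans (cong Tℓ (sym u≡b)) Tu)) eq))

      -- With a = N/ℓ, the condition η^a = 1 singles out the ℓ-th powers of the cyclic group. It
      -- separates inner nodes from leaves.
      inner : ∀ {c η} h → it h c ≡ b → Param c η → η ↑ (ℓ ^ h) ≡ δ → η ↑ a ≡ 𝟙 → Indeg F ℓ b c ℓ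
      inner {c} {η} h eq pc ηδ ηa = extend (root-exists a ℓ N≡aℓ ηa)
        where
        extend : (∃ λ δ₀ → δ₀ ↑ ℓ ≡ η × δ₀ ↑ N ≡ 𝟙) → Indeg F ℓ b c ℓ
        extend (δ₀ , δ₀ℓ , δ₀N) = restrict (fiber-card e≡ δ₀N (subst (Param c) (sym δ₀ℓ) pc)
            (subst (λ γ → γ ↑ 2 ≢ 𝟙) (sym δ₀ℓ) (node² h ηδ)))
          where
          restrict : HasCard F (λ u → Tℓ u ≡ c) ℓ → Indeg F ℓ b c ℓ
          restrict (xs , len , u , char) = xs , len , u , λ x →
            (λ x∈ → proj₁ (char x) x∈ , child≢b h eq (proj₁ (char x) x∈)) , λ { (Tx , _) → proj₂ (char x) Tx }

      leaf : ∀ {c η} h → Param c η → η ↑ (ℓ ^ h) ≡ δ → η ↑ N ≡ 𝟙 → η ↑ a ≢ 𝟙 → Indeg F ℓ b c 0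
      leaf {c} {η} h pc ηδ ηN ¬ηa = [] , refl , [] , λ u → (λ ()) , λ { (Tu , _) → contradiction (η↑a (lift-torus 1 Tu pc ηN (node² h ηδ))) ¬ηa }
        where
        η↑a : ∀ {u} → (∃ λ μ → Param u μ × μ ↑ (ℓ ^ 1) ≡ η × μ ↑ N ≡ 𝟙) → η ↑ a ≡ 𝟙
        η↑a (μ , _ , μℓ , μN) = trans (cong (_↑ a) (trans (sym μℓ) (cong (μ ↑_) (*-identityʳ ℓ))))
          (trans (sym (↑-*′ μ a ℓ)) (trans (cong (μ ↑_) (sym N≡aℓ)) μN))

      dichotomy : ∀ c → InTree F ℓ b c → Indeg F ℓ b c 0 ⊎ Indeg F ℓ b c ℓ
      dichotomy c (h , eq) = decide (node h eq)
        where
        decide : Node c h → Indeg F ℓ b c 0 ⊎ Indeg F ℓ b c ℓ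
        decide (η , pc , ηδ , ηN) = case η ↑ a ≟ 𝟙 of λ where
          (yes ηa) → inj₂ (inner h eq pc ηδ ηa)
          (no ¬ηa) → inj₁ (leaf h pc ηδ ηN ¬ηa)

      -- A leaf is parametrised by a non-ℓ-th power, that is, by an element of level k + H.
      leaf-height : ∀ c h → InTree F ℓ b c → Indeg F ℓ b c 0 → HeightIs F ℓ b c h → h ≡ H
      leaf-height c h _ ([] , _ , _ , char) (eq , _) = height (node h eq)
        where
        height : Node c h → h ≡ H
        height (η , pc , ηδ , ηN) = +-cancelʳ-≡ k h H (trans (level-unique (level-root h ηδ lδ) lη) (+-comm k H))
          where
          child : (∃ λ μ → μ ↑ ℓ ≡ η × μ ↑ N ≡ 𝟙) → ⊥
          child (μ , μℓ , μN) = case proj₂ (char (proj₁ (vertex μN))) (Tu≡c , child≢b h eq Tu≡c) of λ ()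
            where
            Tu≡c : Tℓ (proj₁ (vertex μN)) ≡ c
            Tu≡c = param-unique (T-param ℓ (proj₂ (vertex μN))) (subst (Param c) (sym μℓ) pc)
          lη : HasLevel η (k + H)
          lη = level (subst (λ j → η ↑ j ≡ 𝟙) (trans N≡ (cong (λ k → ω * ℓ ^ k) e≡)) ηN)
             λ ηa → child (root-exists a ℓ N≡aℓ ηa)

      -- N is the product of ω ℓ^(k+1), which kills δ, and ℓ^H; so δ has an ℓ^H-th root in the
      -- group. Comparing levels shows that b is not met earlier.
      deepest : ∃ λ c → HeightIs F ℓ b c H
      deepest = build (root-exists (ω * ℓ ^ suc k) (ℓ ^ H) N≡′ (torsion lδ))
        where
        N≡′ : N ≡ ω * ℓ ^ suc k * ℓ ^ H
        N≡′ = trans N≡ (trans (cong (λ k → ω * ℓ ^ k) e≡) (trans (cong (ω *_) (^-distribˡ-+-* ℓ (suc k) H)) (sym (*-assoc ω (ℓ ^ suc k) (ℓ ^ H)))))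
        build : (∃ λ η → η ↑ (ℓ ^ H) ≡ δ × η ↑ N ≡ 𝟙) → ∃ λ c → HeightIs F ℓ b c H
        build (η , ηδ , ηN) = c , param-unique (iter-param ℓ H pc) (subst (Param b) (sym ηδ) pb) , minimal
          where
          c : 𝔽.Carrier
          c = proj₁ (vertex ηN)
          pc : Param c η
          pc = proj₂ (vertex ηN)
          minimal : ∀ j → j < H → it j c ≢ b
          minimal j j<H eq = <⇒≢ j<H (+-cancelʳ-≡ k j H (level-unique
            (level-root j refl (level-param pb (subst (λ x → Param x (η ↑ (ℓ ^ j))) eq (iter-param ℓ j pc)) lδ))
            (level-root H ηδ lδ)))

      height-bound : ∀ c h → HeightIs F ℓ b c h → h ≤ H
      height-bound c h (eq , _) = bound (node h eq)
        where
        bound : Node c h → h ≤ H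
        bound (η , _ , ηδ , ηN) = ≮⇒≥ λ H<h → exact (level-root h ηδ lδ)
          (↑-∣ {η} {N} ηN (subst (_∣ ω * ℓ ^ (h + k)) (sym (trans N≡ (cong (λ k → ω * ℓ ^ k) e≡)))
            (ω*ℓ^-∣ (subst (_≤ h + k) (cong suc (+-comm H k)) (+-monoˡ-≤ k H<h)))))

    -- A node at distance h has level k + h, levels in the group end at e - 1 = k + H, and exactly
    -- the nodes of that last level are leaves. The case k = 0 gives the hanging trees, k = 1 the
    -- tree over the vertex 0 for ℓ = 2.
    completeTree : CompleteAryTree F ℓ b H
    completeTree = dichotomy , leaf-height , deepest , height-bound

  hangingTrees : ∀ {H v δ₀} → e ≡ suc H → Param v (δ₀ ↑ ℓ) → (δ₀ ↑ ℓ) ↑ 2 ≢ 𝟙 → δ₀ ↑ ω ≡ 𝟙 →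
                 (∀ {u} → Param u δ₀ → Periodic F ℓ u) → HangingTrees F ℓ v (ℓ ∸ 1) H
  hangingTrees {H} {v} {δ₀} e≡ pv γ² δ₀ω periodic = proj₁ card , λ u Tu sp → tree u (proj₂ card u Tu sp)
    where
    δ₀N : δ₀ ↑ N ≡ 𝟙
    δ₀N = ↑-∣ {δ₀} {ω} δ₀ω (divides (ℓ ^ e) (trans N≡ (*-comm ω (ℓ ^ e))))
    card = hanging-card e≡ δ₀N pv γ² δ₀ω periodic
    tree : ∀ u → (∃ λ j → 1 ≤ j × j < ℓ × Param u (δ₀ ⊗ ζ e≡ ↑ j)) → CompleteAryTree F ℓ u H
    tree u (j , 1≤j , j<ℓ , pu) = completeTree e≡ pu (coset-↑N e≡ j δ₀N)
      (λ δ² → γ² (trans (cong (_↑ 2) (sym (coset-↑ℓ e≡ δ₀ j))) (trans (↑-comm _ ℓ 2) (trans (cong (_↑ ℓ) δ²) (𝟙↑ ℓ)))))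
      (coset-level e≡ δ₀ω 1≤j j<ℓ)

  -- Here γ = ±1: its roots are the γ ζ^j, and j and ℓ - j give the same vertex.
  module _ {H h v γ} (e≡ : e ≡ suc H) (ℓ≡ : ℓ ≡ suc (h + h)) (ℓ⊥N′ : Coprime ℓ N′) (pv : Param v γ) (γ² : γ ↑ 2 ≡ 𝟙) where

    private
      γγ : γ ⊗ γ ≡ 𝟙
      γγ = trans (cong (γ ⊗_) (sym (↑1 γ))) γ²

      γ↑ℓ : γ ↑ ℓ ≡ γ
      γ↑ℓ = trans (cong (γ ↑_) ℓ≡) (↑-odd γ² h)

      2⊥ℓ : Coprime 2 ℓ
      2⊥ℓ = prime-∤⇒coprime prime[2] λ 2∣ℓ → <⇒≱ (s≤s (s≤s z≤n)) (∣⇒≤ (∣m+n∣m⇒∣n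
        (subst (2 ∣_) (trans ℓ≡ (trans (+-comm 1 (h + h)) (cong (λ k → h + k + 1) (sym (+-identityʳ h))))) 2∣ℓ) (m∣m*n h)))

      -- γ^ω is killed by 2 and by ℓ^e, which are coprime. As also γ^ℓ = γ, the element γ itself
      -- takes the place of δ₀ in the coset of roots.
      γω : γ ↑ ω ≡ 𝟙
      γω = ↑-coprime {m = 2} {n = ℓ ^ e} (Coprimality.sym (coprime-^ˡ e (Coprimality.sym 2⊥ℓ)))
        (trans (↑-comm γ ω 2) (trans (cong (_↑ ω) γ²) (𝟙↑ ω)))
        (trans (sym (↑-* γ ω (ℓ ^ e))) (trans (cong (γ ↑_) (sym N≡)) (involutionˡ γ²)))

      γN : γ ↑ N ≡ 𝟙
      γN = involutionˡ γ²

      ζe : Carrier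
      ζe = ζ e≡

      fixed : Tℓ v ≡ v
      fixed = param-unique (T-param ℓ pv) (subst (Param v) (sym γ↑ℓ) pv)

      Classified : 𝔽.Carrier → Set
      Classified u = ∃ λ j → j < h × Param u (γ ⊗ ζe ↑ suc j)

      h<ℓ : ∀ {j} → j < h → suc j < ℓ
      h<ℓ j<h = subst (_ <_) (sym ℓ≡) (s≤s (≤-trans j<h (m≤m+n h h)))

      reflected : ∀ {j} → j < ℓ → h < j → ∃ λ i → i < h × j + suc i ≡ ℓ
      reflected {j} j<ℓ h<j = ℓ ∸ suc j
        , +-cancelʳ-< (suc j) (ℓ ∸ suc j) h (subst (_< h + suc j) (sym (m∸n+n≡m j<ℓ)) (subst (_< h + suc j) (sym ℓ≡) (subst (suc (h + h) <_) (sym (+-suc h j)) (s≤s (+-monoʳ-< h h<j)))))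
        , trans (+-suc j (ℓ ∸ suc j)) (m+[n∸m]≡n j<ℓ)

      reflect : ∀ {u i j} → j + suc i ≡ ℓ → Param u (γ ⊗ ζe ↑ j) → Param u (γ ⊗ ζe ↑ suc i)
      reflect {u} {i} {j} eq = param-inverse (begin
        γ ⊗ ζe ↑ j ⊗ (γ ⊗ ζe ↑ suc i)      ≡⟨ solve 3 (λ γ x y → γ :* x :* (γ :* y) := γ :* γ :* (x :* y)) refl γ (ζe ↑ j) (ζe ↑ suc i) ⟩
        γ ⊗ γ ⊗ (ζe ↑ j ⊗ ζe ↑ suc i)      ≡⟨ cong₂ _⊗_ γγ (trans (sym (↑-+ ζe j (suc i))) (trans (cong (ζe ↑_) eq) (proj₁ (proj₂ (ζ-order e≡))))) ⟩
        𝟙 ⊗ 𝟙                              ≡⟨ ⊗-identityˡ 𝟙 ⟩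
        𝟙                                  ∎)
        where open ≡-Reasoning

      classify : ∀ u → Tℓ u ≡ v → StrictlyPreperiodic F ℓ u → Classified u
      classify u Tu (_ , ¬per) = decide (lift 1 Tu pv)
        where
        u≢v : u ≢ v
        u≢v u≡v = ¬per (1 , s≤s z≤n , trans Tu (sym u≡v))
        fromCoset : (∃ λ j → j < ℓ × Param u (γ ⊗ ζe ↑ j)) → Classified u
        fromCoset (zero , _ , pu) = contradiction (param-unique pu (subst (Param v) (sym (⊗-identityʳ γ)) pv)) u≢v
        fromCoset (suc j , j<ℓ , pu) = case suc j ≤? h of λ where
          (yes j<h) → j , j<h , pu
          (no j≮h) → case reflected j<ℓ (≰⇒> j≮h) of λ { (i , i<h , eq) → i , i<h , reflect {i = i} {suc j} eq pu }
        decide : (∃ λ δ → Param u δ × δ ↑ (ℓ ^ 1) ≡ γ × (δ ↑ N ≡ 𝟙 ⊎ δ ↑ N′ ≡ 𝟙)) → Classified u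
        decide (δ , pu , δℓ , inj₁ δN) = fromCoset (case coset-complete e≡ γN (trans (cong (δ ↑_) (sym (*-identityʳ ℓ))) (trans δℓ (sym γ↑ℓ))) of
          λ { (j , j<ℓ , δ≡) → j , j<ℓ , subst (Param u) δ≡ pu })
        -- In the other group, whose order is prime to ℓ, the only ℓ-th root of γ is γ, and that
        -- would make u the fixed point v.
        decide (δ , pu , δℓ , inj₂ δN′) = contradiction (param-unique (subst (Param u) δ≡γ pu) pv) u≢v
          where
          δγ : δ ⊗ γ ≡ 𝟙
          δγ = ↑-coprime {m = ℓ} {n = N′} ℓ⊥N′
            (trans (↑-⊗ δ γ ℓ) (trans (cong₂ _⊗_ (trans (cong (δ ↑_) (sym (*-identityʳ ℓ))) δℓ) γ↑ℓ) γγ))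
            (⊗-↑≡1 N′ δN′ (involutionʳ γ²))
          δ≡γ : δ ≡ γ
          δ≡γ = inverse-unique (trans (⊗-comm γ δ) δγ) γγ

      list : List 𝔽.Carrier
      list = applyUpTo (λ j → cosetVertex e≡ γN (suc j)) h

      separated : ∀ {i j} → i < j → j < h → cosetVertex e≡ γN (suc i) ≢ cosetVertex e≡ γN (suc j)
      separated {i} {j} i<j j<h eq =
        Sum.[ coset-injective e≡ γN (s≤s i<j) (h<ℓ j<h)
            , (λ prod → <⇒≱ (subst (suc i + suc j <_) (sym ℓ≡) (s≤s (+-mono-≤ (≤-trans (s≤s (<⇒≤ i<j)) j<h) j<h)))
                (∣⇒≤ (order-∣ (ζ-order e≡) (begin
                  ζe ↑ (suc i + suc j)                       ≡⟨ ↑-+ ζe (suc i) (suc j) ⟩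
                  ζe ↑ suc i ⊗ ζe ↑ suc j                    ≡⟨ ⊗-identityˡ _ ⟨
                  𝟙 ⊗ (ζe ↑ suc i ⊗ ζe ↑ suc j)              ≡⟨ cong (_⊗ (ζe ↑ suc i ⊗ ζe ↑ suc j)) γγ ⟨
                  γ ⊗ γ ⊗ (ζe ↑ suc i ⊗ ζe ↑ suc j)          ≡⟨ solve 3 (λ γ x y → γ :* γ :* (x :* y) := γ :* x :* (γ :* y)) refl γ (ζe ↑ suc i) (ζe ↑ suc j) ⟩
                  γ ⊗ ζe ↑ suc i ⊗ (γ ⊗ ζe ↑ suc j)          ≡⟨ prod ⟩
                  𝟙                                          ∎)))) ]′
          (param-fiber (cosetVertex-param e≡ γN (suc i)) (subst (λ x → Param x (γ ⊗ ζe ↑ suc j)) (sym eq) (cosetVertex-param e≡ γN (suc j))))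
        where open ≡-Reasoning

    hangingTrees-involution : HangingTrees F ℓ v h H
    hangingTrees-involution =
      (list , length-applyUpTo _ h , Unique.applyUpTo⁺₁ _ h separated
        , λ u → ∈⇒ , λ { (Tu , sp) → ⇒∈ (classify u Tu sp) })
      , λ u Tu sp → tree (classify u Tu sp)
      where
      ∈⇒ : ∀ {u} → u ∈ list → Tℓ u ≡ v × StrictlyPreperiodic F ℓ u
      ∈⇒ u∈ = case ∈-applyUpTo⁻ _ u∈ of λ { (j , j<h , u≡) →
        trans (cong Tℓ u≡) (cosetVertex-T e≡ γN (subst (Param v) (sym γ↑ℓ) pv) (suc j))
        , subst (StrictlyPreperiodic F ℓ) (sym u≡) (level⇒preperiodic (cosetVertex-param e≡ γN (suc j)) (coset-level e≡ γω (s≤s z≤n) (h<ℓ j<h))) }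
      ⇒∈ : ∀ {u} → Classified u → u ∈ list
      ⇒∈ (j , j<h , pu) = subst (_∈ list) (param-unique (cosetVertex-param e≡ γN (suc j)) pu) (∈-applyUpTo⁺ _ j<h)
      tree : ∀ {u} → Classified u → CompleteAryTree F ℓ u H
      tree {u} (j , j<h , pu) = completeTree e≡ pu (coset-↑N e≡ (suc j) γN) δ²≢1 (coset-level e≡ γω (s≤s z≤n) (h<ℓ j<h))
        where
        -- The square equals ζ^(2(j+1)). If it were 1, then ζ^(j+1) would be killed by both 2 and ℓ
        -- and so be 1.
        δ²≢1 : (γ ⊗ ζe ↑ suc j) ↑ 2 ≢ 𝟙
        δ²≢1 δ² = proj₂ (proj₂ (ζ-order e≡)) (suc j) (s≤s z≤n) (h<ℓ j<h) (↑-coprime {m = 2} {n = ℓ} 2⊥ℓ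
          (trans (sym (⊗-identityˡ _)) (trans (cong (_⊗ (ζe ↑ suc j) ↑ 2) (sym γ²)) (trans (sym (↑-⊗ γ (ζe ↑ suc j) 2)) δ²)))
          (ζ↑ℓ e≡ (suc j)))

-- Counting cycles

map-unique : ∀ {A B : Set} {f : A → B} {xs} → (∀ {x y} → x ∈ xs → y ∈ xs → f x ≡ f y → x ≡ y) → Unique xs → Unique (map f xs)
map-unique inj [] = []
map-unique {f = f} {x ∷ xs} inj (x∉ ∷ u) =
  All.map⁺ (All.tabulate λ y∈ fx≡fy → All.lookup x∉ y∈ (inj (here refl) (there y∈) fx≡fy))
  ∷ map-unique (λ x∈ y∈ → inj (there x∈) (there y∈)) u

unique-⊆-length : ∀ {A : Set} {xs ys : List A} → Unique xs → (∀ {x} → x ∈ xs → x ∈ ys) → length xs ≤ length ys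
unique-⊆-length {xs = xs} {ys} u sub = Fin.injective⇒≤ {f = λ i → index (sub (∈-lookup {xs = xs} i))} λ {i} {j} eq →
  lookup-injective u (trans (lookup-index (sub (∈-lookup i))) (trans (cong (lookup ys) eq) (sym (lookup-index (sub (∈-lookup j))))))

-- A free action of the cyclic group of order c on a finite set, written as an action of ℕ. It is
-- instantiated twice: by inversion with c = 2, and by iteration of T with c = c(d).
record Free {A : Set} (act : ℕ → A → A) (c : ℕ) (xs : List A) : Set where
  field
    unique : Unique xs
    closed : ∀ {x} → x ∈ xs → act 1 x ∈ xs
    period : ∀ {x} → x ∈ xs → act c x ≡ x
    minimal : ∀ {x} → x ∈ xs → ∀ j → 1 ≤ j → j < c → act j x ≢ x

record Transversal {A : Set} (act : ℕ → A → A) (c : ℕ) (xs : List A) : Set where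
  field
    reps : List A
    length≡ : length xs ≡ length reps * c
    reps⊆ : ∀ {y} → y ∈ reps → y ∈ xs
    covers : ∀ {x} → x ∈ xs → ∃ λ y → y ∈ reps × ∃ λ i → x ≡ act i y
    separated : AllPairs (λ y z → ∀ i → act i y ≢ z) reps

module CyclicAction {A : Set} (_≟_ : DecidableEquality A) {act : ℕ → A → A} (act-0 : ∀ x → act 0 x ≡ x)
  (act-+ : ∀ i j x → act (i + j) x ≡ act i (act j x)) {c : ℕ} (1≤c : 1 ≤ c) where
  open import Data.List.Membership.DecPropositional _≟_ using (_∈?_; _∉?_)

  private
    module Step {x : A} {xs : List A} (free : Free act c (x ∷ xs)) where
      open Free free

      orbit : List A
      orbit = applyUpTo (λ i → act i x) c

      act∈orbit : ∀ i → act i x ∈ orbit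
      act∈orbit zero = ∈-applyUpTo⁺ _ 1≤c
      act∈orbit (suc i) = next (∈-applyUpTo⁻ _ (act∈orbit i))
        where
        next : (∃ λ k → k < c × act i x ≡ act k x) → act (suc i) x ∈ orbit
        next (k , k<c , eq) = subst (_∈ orbit) (sym (trans (act-+ 1 i x) (trans (cong (act 1) eq) (sym (act-+ 1 k x))))) (wrap (m≤n⇒m<n∨m≡n k<c))
          where
          wrap : suc k < c ⊎ suc k ≡ c → act (suc k) x ∈ orbit
          wrap (inj₁ <c) = ∈-applyUpTo⁺ _ <c
          wrap (inj₂ ≡c) = subst (_∈ orbit) (sym (trans (cong (λ k → act k x) ≡c) (trans (period (here refl)) (sym (act-0 x))))) (∈-applyUpTo⁺ _ 1≤c)

      act∈ : ∀ i → act i x ∈ x ∷ xs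
      act∈ zero    = subst (_∈ x ∷ xs) (sym (act-0 x)) (here refl)
      act∈ (suc i) = subst (_∈ x ∷ xs) (sym (act-+ 1 i x)) (closed (act∈ i))

      orbit-unique : Unique orbit
      orbit-unique = Unique.applyUpTo⁺₁ _ c λ {i} {j} i<j j<c eq →
        minimal (act∈ i) (j ∸ i) (m<n⇒0<n∸m i<j) (≤-<-trans (m∸n≤m j i) j<c)
          (trans (sym (act-+ (j ∸ i) i x)) (trans (cong (λ k → act k x) (m∸n+n≡m (<⇒≤ i<j))) (sym eq)))

      rest : List A
      rest = filter (_∉? orbit) (x ∷ xs)

      rest∈ : ∀ {y} → y ∈ rest → y ∈ x ∷ xs
      rest∈ y∈ = proj₁ (∈-filter⁻ (_∉? orbit) {xs = x ∷ xs} y∈)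

      rest∉ : ∀ {y} → y ∈ rest → y ∉ orbit
      rest∉ y∈ = proj₂ (∈-filter⁻ (_∉? orbit) {xs = x ∷ xs} y∈)

      length-rest : length (x ∷ xs) ≡ c + length rest
      length-rest = trans (≤-antisym (unique-⊆-length unique ⊆₁) (unique-⊆-length ++-unique ⊆₂))
        (trans (length-++ orbit) (cong (_+ length rest) (length-applyUpTo _ c)))
        where
        ++-unique : Unique (orbit ++ rest)
        ++-unique = Unique.++⁺ orbit-unique (Unique.filter⁺ (_∉? orbit) unique) λ { (∈o , ∈r) → rest∉ ∈r ∈o }
        ⊆₁ : ∀ {y} → y ∈ x ∷ xs → y ∈ orbit ++ rest
        ⊆₁ {y} y∈ = case y ∈? orbit of λ where
          (yes ∈o) → ∈-++⁺ˡ ∈o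
          (no ∉o) → ∈-++⁺ʳ orbit (∈-filter⁺ (_∉? orbit) y∈ ∉o)
        ⊆₂ : ∀ {y} → y ∈ orbit ++ rest → y ∈ x ∷ xs
        ⊆₂ y∈ = Sum.[ (λ ∈o → case ∈-applyUpTo⁻ _ ∈o of λ { (i , _ , refl) → act∈ i }) , rest∈ ]′ (∈-++⁻ orbit y∈)

      rest-free : Free act c rest
      rest-free = record
        { unique = Unique.filter⁺ (_∉? orbit) unique
        ; closed = λ y∈ → ∈-filter⁺ (_∉? orbit) (closed (rest∈ y∈)) λ ∈o → rest∉ y∈ (back (rest∈ y∈) (∈-applyUpTo⁻ _ ∈o))
        ; period = λ y∈ → period (rest∈ y∈)
        ; minimal = λ y∈ → minimal (rest∈ y∈) }
        where
        -- `act (c ∸ 1)` undoes `act 1`, so a point whose image lies in the orbit lies there itself.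
        -- Hence the complement of an orbit is stable.
        back : ∀ {y} → y ∈ x ∷ xs → (∃ λ i → i < c × act 1 y ≡ act i x) → y ∈ orbit
        back {y} y∈ (i , _ , eq) = subst (_∈ orbit) (begin
          act (c ∸ 1 + i) x        ≡⟨ act-+ (c ∸ 1) i x ⟩
          act (c ∸ 1) (act i x)    ≡⟨ cong (act (c ∸ 1)) eq ⟨
          act (c ∸ 1) (act 1 y)    ≡⟨ act-+ (c ∸ 1) 1 y ⟨
          act (c ∸ 1 + 1) y        ≡⟨ cong (λ k → act k y) (m∸n+n≡m 1≤c) ⟩
          act c y                  ≡⟨ period y∈ ⟩
          y                        ∎) (act∈orbit (c ∸ 1 + i))
          where open ≡-Reasoning

      extend : Transversal act c rest → Transversal act c (x ∷ xs)
      extend t = record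
        { reps = x ∷ reps
        ; length≡ = trans length-rest (cong (c +_) length≡)
        ; reps⊆ = λ { (here refl) → here refl ; (there y∈) → rest∈ (reps⊆ y∈) }
        ; covers = cover
        ; separated = All.tabulate (λ y∈ i eq → rest∉ (reps⊆ y∈) (subst (_∈ orbit) eq (act∈orbit i))) ∷ separated }
        where
        open Transversal t
        cover : ∀ {y} → y ∈ x ∷ xs → ∃ λ z → z ∈ x ∷ reps × ∃ λ i → y ≡ act i z
        cover {y} y∈ = case y ∈? orbit of λ where
          (yes ∈o) → case ∈-applyUpTo⁻ _ ∈o of λ { (i , _ , eq) → x , here refl , i , eq }
          (no ∉o) → case covers (∈-filter⁺ (_∉? orbit) y∈ ∉o) of λ { (z , z∈ , i , eq) → z , there z∈ , i , eq }

  transversal : ∀ {xs} → Free act c xs → Transversal act c xs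
  transversal {xs} = go (length xs) ≤-refl
    where
    go : ∀ {xs} b → length xs ≤ b → Free act c xs → Transversal act c xs
    go {[]} _ _ _ = record { reps = [] ; length≡ = refl ; reps⊆ = λ () ; covers = λ () ; separated = [] }
    go {x ∷ xs} (suc b) len free = extend (go b (≤-pred (≤-trans (≤-trans (+-monoˡ-≤ (length rest) 1≤c) (≤-reflexive (sym length-rest))) len)) rest-free)
      where open Step free

module Totient {q : ℕ} (K : FiniteField q) {h d} (h-order : MulOrder (K) h d) (2<d : 2 < d) where
  open Field K

  private
    hd : h ↑ d ≡ 𝟙
    hd = proj₁ (proj₂ h-order)

    units : List ℕ
    units = filter (λ k → gcd k d ℕ.≟ 1) (applyUpTo suc d)

  generators : List Carrier
  generators = map (h ↑_) units

  length-generators : length generators ≡ totient d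
  length-generators = length-map (h ↑_) units

  generators-unique : Unique generators
  generators-unique = map-unique (λ x∈ y∈ → injective (unit⁻ x∈) (unit⁻ y∈))
    (Unique.filter⁺ (λ k → gcd k d ℕ.≟ 1) (Unique.applyUpTo⁺₁ suc d λ i<j _ → <⇒≢ (s≤s i<j)))
    where
    unit⁻ : ∀ {k} → k ∈ units → ∃ λ i → i < d × k ≡ suc i
    unit⁻ k∈ = ∈-applyUpTo⁻ suc (proj₁ (∈-filter⁻ (λ k → gcd k d ℕ.≟ 1) {xs = applyUpTo suc d} k∈))
    injective : ∀ {j k} → (∃ λ i → i < d × j ≡ suc i) → (∃ λ i → i < d × k ≡ suc i) → h ↑ j ≡ h ↑ k → j ≡ k
    injective (i , i<d , refl) (i′ , i′<d , refl) eq = cong suc (compare (<-cmp i i′))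
      where
      cancelled : h ↑ i ≡ h ↑ i′
      cancelled = ⊗-cancelˡ (↑≡1⇒≢0 (proj₁ h-order) hd) eq
      compare : Tri (i < i′) (i ≡ i′) (i′ < i) → i ≡ i′
      compare (tri< lt _ _) = contradiction cancelled (order-injective h-order lt i′<d)
      compare (tri≈ _ eq _) = eq
      compare (tri> _ _ gt) = contradiction (sym cancelled) (order-injective h-order gt i<d)

  generators-order : ∀ {α} → α ∈ generators → MulOrder K α d
  generators-order α∈ = order (∈-map⁻ (h ↑_) α∈)
    where
    order : ∀ {α} → (∃ λ k → k ∈ units × α ≡ h ↑ k) → MulOrder K α d
    order (k , k∈ , refl) = order-↑-coprime {k = k}
      (Coprimality.sym (gcd≡1⇒coprime {k} {d} (proj₂ (∈-filter⁻ (λ k → gcd k d ℕ.≟ 1) {xs = applyUpTo suc d} k∈)))) h-order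

  -- If g divides both k and d, then (h^k)^(d/g) = 1; since h^k has order d, this forces g = 1.
  order-∈-generators : ∀ {α} → MulOrder K α d → α ∈ generators
  order-∈-generators {α} o = locate (order-generates h-order (proj₁ (proj₂ o)))
    where
    locate : (∃ λ k → k < d × α ≡ h ↑ k) → α ∈ generators
    -- `totient` runs over 1, ..., d and the exponents here over 0, ..., d - 1. Exponent 0 is
    -- impossible because the identity does not have order d > 2.
    locate (zero , _ , refl) = contradiction (⊗-identityʳ 𝟙) (proj₂ (proj₂ o) 1 (s≤s z≤n) (<-trans (n<1+n 1) 2<d))
    locate (suc i , k<d , refl) = ∈-map⁺ (h ↑_) (∈-filter⁺ (λ k → gcd k d ℕ.≟ 1) (∈-applyUpTo⁺ suc (<-trans (n<1+n i) k<d))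
        (common (gcd[m,n]∣m (suc i) d) (gcd[m,n]∣n (suc i) d)))
      where
      common : ∀ {g} → g ∣ suc i → g ∣ d → g ≡ 1
      common {g} (divides k′ k≡) (divides d′ d≡) = ∣1⇒≡1 (*-cancelˡ-∣ d′ {{d′≢0}} (subst₂ _∣_ d≡ (sym (*-identityʳ d′)) (order-∣ o (begin
        (h ↑ suc i) ↑ d′       ≡⟨ ↑-* h (suc i) d′ ⟨
        h ↑ (suc i * d′)       ≡⟨ cong (λ k → h ↑ (k * d′)) k≡ ⟩
        h ↑ (k′ * g * d′)      ≡⟨ cong (h ↑_) (trans (*-assoc k′ g d′) (cong (k′ *_) (trans (*-comm g d′) (sym d≡)))) ⟩
        h ↑ (k′ * d)           ≡⟨ ↑-∣ {h} {d} hd (n∣m*n k′) ⟩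
        𝟙                      ∎))))
        where
        open ≡-Reasoning
        d′≢0 : NonZero d′
        d′≢0 = m*n≢0⇒m≢0 d′ {{>-nonZero (subst (1 ≤_) d≡ (proj₁ h-order))}}

-- Cycles through the vertices α + α⁻¹ with α of order d

module Cycles {p n : ℕ} (p-prime : Prime p) (F : FiniteField (p ^ n)) (K : FiniteField (p ^ (2 * n))) (ι : FieldHom F K)
  {N N′ : ℕ} (tori : QuadraticExtension.Tori {n = n} p-prime F K ι N N′)
  {ℓ : ℕ} (ℓ-prime : Prime ℓ) (ω e : ℕ) (N≡ : N ≡ ω * ℓ ^ e) (ℓ⊥ω : Coprime ℓ ω)
  {d c : ℕ} (2<d : 2 < d) (d∣ω : d ∣ ω) (cOrder : IsCOrder ℓ d c) where
  open Embedding F K ι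
  open ChebyshevAction F K ι
  open Field K
  open QuadraticExtension.Tori tori
  open Dynamics p-prime F K ι tori ℓ-prime ω e N≡ ℓ⊥ω

  private
    1≤c : 1 ≤ c
    1≤c = proj₁ cOrder

    d∣N : d ∣ N
    d∣N = subst (d ∣_) (sym N≡) (∣m⇒∣m*n (ℓ ^ e) d∣ω)

    d⊥ℓ : Coprime d ℓ
    d⊥ℓ = Coprimality.sym (coprime-∣ ℓ⊥ω d∣ω)

    1≤ℓ^ : ∀ j → 1 ≤ ℓ ^ j
    1≤ℓ^ j = >-nonZero⁻¹ (ℓ ^ j) {{m^n≢0 ℓ j {{prime⇒nonZero ℓ-prime}}}}

  order⇒torus : ∀ {α} → MulOrder K α d → α ↑ N ≡ 𝟙
  order⇒torus {α} o = ↑-∣ {α} {d} (proj₁ (proj₂ o)) d∣N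

  private
    α²≢1 : ∀ {α} → MulOrder K α d → α ↑ 2 ≢ 𝟙
    α²≢1 o = proj₂ (proj₂ o) 2 (s≤s z≤n) 2<d

    -- ℓ^j ≡ 1 modulo d returns α and ℓ^j ≡ -1 returns α⁻¹, and both parametrise x. With the
    -- converse below, this makes c(d), an order modulo ±1, the period.
    returns : ∀ {x α} j → MulOrder K α d → Param x α → PlusMinusOne ℓ d j → iter F ℓ j x ≡ x
    returns {x} {α} j o px pm = param-unique (iter-param ℓ j px) (back pm)
      where
      back : PlusMinusOne ℓ d j → Param x (α ↑ (ℓ ^ j))
      back (inj₁ d∣) = subst (Param x) (sym (begin
        α ↑ (ℓ ^ j)                    ≡⟨ cong (α ↑_) (m+[n∸m]≡n (1≤ℓ^ j)) ⟨
        α ⊗ α ↑ (ℓ ^ j ∸ 1)            ≡⟨ cong (α ⊗_) (↑-∣ {α} {d} (proj₁ (proj₂ o)) d∣) ⟩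
        α ⊗ 𝟙                          ≡⟨ ⊗-identityʳ α ⟩
        α                              ∎)) px
        where open ≡-Reasoning
      back (inj₂ d∣) = param-inverse (trans (cong (α ↑_) (+-comm 1 (ℓ ^ j))) (↑-∣ {α} {d} (proj₁ (proj₂ o)) d∣)) px

    returns⁻ : ∀ {x α} j → MulOrder K α d → Param x α → iter F ℓ j x ≡ x → PlusMinusOne ℓ d j
    returns⁻ {x} {α} j o px eq = Sum.map minus plus
        (param-fiber px (subst (λ y → Param y (α ↑ (ℓ ^ j))) eq (iter-param ℓ j px)))
      where
      minus : α ↑ (ℓ ^ j) ≡ α → d ∣ ℓ ^ j ∸ 1
      minus αℓ = order-∣ o (↑-cancel 1 (ℓ ^ j ∸ 1) (↑≡1⇒≢0 (proj₁ o) (proj₁ (proj₂ o)))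
        (trans (↑1 α) (trans (sym αℓ) (cong (α ↑_) (sym (m+[n∸m]≡n (1≤ℓ^ j)))))))
      plus : α ⊗ α ↑ (ℓ ^ j) ≡ 𝟙 → d ∣ ℓ ^ j + 1
      plus αα = order-∣ o (trans (cong (α ↑_) (+-comm (ℓ ^ j) 1)) αα)

  orderSum-closed : ∀ x → OrderSum d x → OrderSum d (T F ℓ x)
  orderSum-closed x (α , o , px) = α ↑ ℓ , order-↑-coprime d⊥ℓ o , T-param ℓ px

  orderSum-period : ∀ x → OrderSum d x → HasPeriod F ℓ x c
  orderSum-period x (α , o , px) = 1≤c , returns c o px (proj₁ (proj₂ cOrder))
    , λ j 1≤j j<c eq → proj₂ (proj₂ cOrder) j 1≤j j<c (returns⁻ j o px eq)

  private
    h : Carrier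
    h = θ ↑ _∣_.quotient d∣N

    h-order : MulOrder K h d
    h-order = order-↑ (_∣_.quotient d∣N) (subst (MulOrder K θ) (_∣_.equality d∣N) θ-order)

    open Totient K h-order 2<d

    -- As d - 1 ≡ -1 modulo d, one step inverts an element of order d. Written as a power it is
    -- total on K and satisfies the action law by exponent arithmetic.
    invert : ℕ → Carrier → Carrier
    invert i α = α ↑ ((d ∸ 1) ^ i)

    invert-inverse : ∀ {α} → MulOrder K α d → α ⊗ invert 1 α ≡ 𝟙
    invert-inverse {α} (1≤d , αd , _) = trans (cong (λ k → α ⊗ α ↑ k) (*-identityʳ (d ∸ 1))) (trans (cong (α ↑_) (m+[n∸m]≡n 1≤d)) αd)

    invert-+ : ∀ i j α → invert (i + j) α ≡ invert i (invert j α)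
    invert-+ i j α = trans (cong (α ↑_) (^-distribˡ-+-* (d ∸ 1) i j)) (↑-*′ α ((d ∸ 1) ^ i) ((d ∸ 1) ^ j))

    inverse-order : ∀ {α β} → α ⊗ β ≡ 𝟙 → MulOrder K α d → MulOrder K β d
    inverse-order {α} {β} αβ (1≤d , αd , min) = 1≤d , inverse-↑≡1 {n = d} αβ αd
      , λ k 1≤k k<d βk → min k 1≤k k<d (inverse-↑≡1 {n = k} (trans (⊗-comm β α) αβ) βk)

    inversion-free : Free invert 2 generators
    inversion-free = record
      { unique = generators-unique
      ; closed = λ α∈ → order-∈-generators (inverse-order (invert-inverse (generators-order α∈)) (generators-order α∈))
      ; period = λ α∈ → involutive (generators-order α∈)
      ; minimal = λ { α∈ (suc zero) _ _ eq → fixed (generators-order α∈) eq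
                    ; _ (suc (suc j)) _ (s≤s (s≤s ())) } }
      where
      involutive : ∀ {α} → MulOrder K α d → invert 2 α ≡ α
      involutive {α} o = trans (invert-+ 1 1 α) (inverse-unique (invert-inverse (inverse-order (invert-inverse o) o))
        (trans (⊗-comm _ α) (invert-inverse o)))
      fixed : ∀ {α} → MulOrder K α d → invert 1 α ≢ α
      fixed {α} o eq = α²≢1 o (trans (cong (α ⊗_) (trans (↑1 α) (sym eq))) (invert-inverse o))

    inversion-transversal : Transversal invert 2 generators
    inversion-transversal = CyclicAction.transversal _≟_ ↑1 invert-+ (s≤s z≤n) inversion-free

    open Transversal inversion-transversal
      renaming (reps to halves; length≡ to length-halves; reps⊆ to halves⊆; covers to halves-cover; separated to halves-separated)

    -- Made total so that it can be mapped over a list; the default 𝟘 never occurs for α of order d.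
    toVertex : Carrier → 𝔽.Carrier
    toVertex α = choose (α ↑ N ≟ 𝟙)
      where
      choose : Dec (α ↑ N ≡ 𝟙) → 𝔽.Carrier
      choose (yes αN) = proj₁ (vertex αN)
      choose (no _)   = 𝔽.𝟘

    toVertex-param : ∀ {α} → MulOrder K α d → Param (toVertex α) α
    toVertex-param {α} o with α ↑ N ≟ 𝟙
    ... | yes αN = proj₂ (vertex αN)
    ... | no ¬αN = contradiction (order⇒torus o) ¬αN

    vertices : List 𝔽.Carrier
    vertices = map toVertex halves

    vertices-unique : Unique vertices
    vertices-unique = AllPairs.map⁺ (separate halves (λ α∈ → generators-order (halves⊆ α∈)) halves-separated)
      where
      apart : ∀ {α β} → MulOrder K α d → MulOrder K β d → (∀ i → invert i α ≢ β) → toVertex α ≢ toVertex β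
      apart {α} {β} oα oβ sep eq = Sum.[ (λ β≡α → sep 0 (trans (↑1 α) (sym β≡α)))
                                       , (λ αβ → sep 1 (inverse-unique (invert-inverse oα) αβ)) ]′
        (param-fiber (toVertex-param oα) (subst (λ x → Param x β) (sym eq) (toVertex-param oβ)))
      separate : ∀ αs → (∀ {α} → α ∈ αs → MulOrder K α d) → AllPairs (λ α β → ∀ i → invert i α ≢ β) αs →
                 AllPairs (λ α β → toVertex α ≢ toVertex β) αs
      separate []       _ _          = []
      separate (α ∷ αs) o (sα ∷ sep) =
        All.tabulate (λ β∈ → apart (o (here refl)) (o (there β∈)) (All.lookup sα β∈)) ∷ separate αs (o ∘ there) sep

    ∈-vertices⁻ : ∀ {x} → x ∈ vertices → OrderSum d x
    ∈-vertices⁻ x∈ = from (∈-map⁻ toVertex x∈)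
      where
      from : ∀ {x} → (∃ λ α → α ∈ halves × x ≡ toVertex α) → OrderSum d x
      from (α , α∈ , refl) = α , generators-order (halves⊆ α∈) , toVertex-param (generators-order (halves⊆ α∈))

    ∈-vertices⁺ : ∀ {x} → OrderSum d x → x ∈ vertices
    ∈-vertices⁺ {x} (α , o , px) = locate (halves-cover (order-∈-generators o))
      where
      locate : (∃ λ β → β ∈ halves × ∃ λ i → α ≡ invert i β) → x ∈ vertices
      locate (β , β∈ , i , α≡) = subst (_∈ vertices) (param-unique (power i) (subst (Param x) α≡ px)) (∈-map⁺ toVertex β∈)
        where
        power : ∀ i → Param (toVertex β) (invert i β)
        power zero    = subst (Param (toVertex β)) (sym (↑1 β)) (toVertex-param (generators-order (halves⊆ β∈)))
        power (suc i) = subst (Param (toVertex β)) (sym (invert-+ 1 i β)) (param-inverse (invert-inverse (order i)) (power i))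
          where
          order : ∀ i → MulOrder K (invert i β) d
          order zero    = subst (λ γ → MulOrder K γ d) (sym (↑1 β)) (generators-order (halves⊆ β∈))
          order (suc i) = subst (λ γ → MulOrder K γ d) (sym (invert-+ 1 i β)) (inverse-order (invert-inverse (order i)) (order i))

    iteration-free : Free (iter F ℓ) c vertices
    iteration-free = record
      { unique = vertices-unique
      ; closed = λ x∈ → ∈-vertices⁺ (orderSum-closed _ (∈-vertices⁻ x∈))
      ; period = λ x∈ → proj₁ (proj₂ (orderSum-period _ (∈-vertices⁻ x∈)))
      ; minimal = λ x∈ → proj₂ (proj₂ (orderSum-period _ (∈-vertices⁻ x∈))) }

    iteration-transversal : Transversal (iter F ℓ) c vertices
    iteration-transversal = CyclicAction.transversal 𝔽._≟_ (λ _ → refl) (iter-+ F ℓ) 1≤c iteration-free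

    open Transversal iteration-transversal using () renaming (reps to cycles; length≡ to length-cycles)

  -- Inversion pairs the φ(d) elements of order d into φ(d)/2 vertices, and T splits these into
  -- orbits of length c.
  orderSum-cycles : ∃ λ k → k * (2 * c) ≡ totient d × UnionOfCycles F ℓ (OrderSum d) k c
  orderSum-cycles = length cycles , count , orderSum-closed , orderSum-period
    , vertices , length-cycles , vertices-unique , λ x → ∈-vertices⁻ , ∈-vertices⁺
    where
    open ≡-Reasoning
    count : length cycles * (2 * c) ≡ totient d
    count = begin
      length cycles * (2 * c)      ≡⟨ cong (length cycles *_) (*-comm 2 c) ⟩
      length cycles * (c * 2)      ≡⟨ *-assoc (length cycles) c 2 ⟨
      length cycles * c * 2        ≡⟨ cong (_* 2) length-cycles ⟨
      length vertices * 2          ≡⟨ cong (_* 2) (length-map toVertex halves) ⟩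
      length halves * 2            ≡⟨ length-halves ⟨
      length generators            ≡⟨ length-generators ⟩
      totient d                    ∎

  -- The root δ₀ for `hangingTrees` is a parameter of T^(c-1) x, the predecessor of x on its cycle.
  -- It equals α^(ℓ^(c-1)) or the inverse, so d kills it, and therefore ω does.
  orderSum-trees : 1 ≤ e → ∀ x → OrderSum d x → HangingTrees F ℓ x (ℓ ∸ 1) (e ∸ 1)
  orderSum-trees 1≤e x (α , o , px) = hang (lift 1 T-pred px)
    where
    pred-x : 𝔽.Carrier
    pred-x = iter F ℓ (c ∸ 1) x
    T-pred : T F ℓ pred-x ≡ x
    T-pred = trans (cong (λ k → iter F ℓ k x) (m+[n∸m]≡n 1≤c)) (returns c o px (proj₁ (proj₂ cOrder)))
    pred-periodic : Periodic F ℓ pred-x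
    pred-periodic = c , 1≤c , trans (sym (iter-+ F ℓ c (c ∸ 1) x)) (trans (cong (λ k → iter F ℓ k x) (+-comm c (c ∸ 1)))
      (trans (iter-+ F ℓ (c ∸ 1) c x) (cong (iter F ℓ (c ∸ 1)) (returns c o px (proj₁ (proj₂ cOrder))))))
    hang : (∃ λ δ → Param pred-x δ × δ ↑ (ℓ ^ 1) ≡ α × (δ ↑ N ≡ 𝟙 ⊎ δ ↑ N′ ≡ 𝟙)) → HangingTrees F ℓ x (ℓ ∸ 1) (e ∸ 1)
    hang (δ , pδ , δℓ , _) = hangingTrees (sym (m+[n∸m]≡n 1≤e)) (subst (Param x) (sym δℓ′) px)
        (λ sq → α²≢1 o (trans (cong (_↑ 2) (sym δℓ′)) sq)) (↑-∣ {δ} {d} δd d∣ω)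
        (λ pu → subst (Periodic F ℓ) (param-unique pδ pu) pred-periodic)
      where
      δℓ′ : δ ↑ ℓ ≡ α
      δℓ′ = trans (cong (δ ↑_) (sym (*-identityʳ ℓ))) δℓ
      μd : (α ↑ (ℓ ^ (c ∸ 1))) ↑ d ≡ 𝟙
      μd = trans (↑-comm α (ℓ ^ (c ∸ 1)) d) (trans (cong (_↑ (ℓ ^ (c ∸ 1))) (proj₁ (proj₂ o))) (𝟙↑ (ℓ ^ (c ∸ 1))))
      δd : δ ↑ d ≡ 𝟙
      δd = Sum.[ (λ δ≡ → trans (cong (_↑ d) δ≡) μd) , (λ μδ → inverse-↑≡1 {n = d} μδ μd) ]′
        (param-fiber (iter-param ℓ (c ∸ 1) px) pδ)

-- Existence of a quadratic extension

module Construction {q : ℕ} (F : FiniteField q) where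
  open Field F

  private
    -- The equation says that x is a root of t² - ut + 1. Polynomials of this shape serve in every
    -- characteristic, whereas adjoining a square root would give nothing in characteristic 2.
    Split : Carrier → Set
    Split u = ∃ λ x → x ⊗ (u ⊕ ⊝ x) ≡ 𝟙

    -- u ↦ x would embed F into F ∖ {0}, because u = x + x⁻¹.
    not-all-split : ¬ (∀ u → Split u)
    not-all-split split = <⇒≱ (≤-reflexive (cong suc (trans (sym (length-elements enumeration)) (sym (length-map root (elements enumeration))))))
      (length-unique≤ enumeration (All.map⁺ (All.tabulate (λ {u} _ 0≡ → unit≢0 (proj₂ (split u)) (sym 0≡)))
        ∷ Unique.map⁺ root-injective (elements-unique enumeration)))
      where
      root : Carrier → Carrier
      root u = proj₁ (split u)
      root-injective : ∀ {u v} → root u ≡ root v → u ≡ v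
      root-injective {u} {v} eq = trans (recover u (root u)) (trans (cong₂ _⊕_ (inverse-unique (proj₂ (split u))
          (trans (cong (λ x → x ⊗ (v ⊕ ⊝ root v)) eq) (proj₂ (split v)))) eq) (sym (recover v (root v))))
        where
        recover : ∀ u x → u ≡ u ⊕ ⊝ x ⊕ x
        recover = solve 2 (λ u x → u := u :+ :- x :+ x) refl

  nonsplit : ∃ λ u → ∀ x → x ⊗ (u ⊕ ⊝ x) ≢ 𝟙
  nonsplit = decide (all? split? (elements enumeration))
    where
    split? : ∀ u → Dec (Any (λ x → x ⊗ (u ⊕ ⊝ x) ≡ 𝟙) (elements enumeration))
    split? u = Any.any? (λ x → x ⊗ (u ⊕ ⊝ x) ≟ 𝟙) (elements enumeration)
    decide : Dec (All _ (elements enumeration)) → ∃ λ u → ∀ x → x ⊗ (u ⊕ ⊝ x) ≢ 𝟙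
    decide (yes all) = contradiction (λ u → Any.satisfied (All.lookup all (∈-elements enumeration u))) not-all-split
    decide (no ¬all) = pick (Any.satisfied (All.¬All⇒Any¬ split? _ ¬all))
      where
      pick : (∃ λ u → ¬ Any (λ x → x ⊗ (u ⊕ ⊝ x) ≡ 𝟙) (elements enumeration)) → ∃ λ u → ∀ x → x ⊗ (u ⊕ ⊝ x) ≢ 𝟙
      pick (u , ¬any) = u , λ x eq → ¬any (lose (∈-elements enumeration x) eq)

  -- F[t]/(t² − ut + 1), with (a , b) standing for a + bt.
  module Adjoin (u : Carrier) (irreducible : ∀ x → x ⊗ (u ⊕ ⊝ x) ≢ 𝟙) where

    E : Set
    E = Carrier × Carrier

    infixl 6 _+ᴱ_
    infixl 7 _*ᴱ_
    _+ᴱ_ _*ᴱ_ : E → E → E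
    (a , b) +ᴱ (c , d) = a ⊕ c , b ⊕ d
    (a , b) *ᴱ (c , d) = a ⊗ c ⊕ ⊝ (b ⊗ d) , a ⊗ d ⊕ b ⊗ c ⊕ u ⊗ (b ⊗ d)

    -ᴱ_ : E → E
    -ᴱ (a , b) = ⊝ a , ⊝ b

    0ᴱ 1ᴱ : E
    0ᴱ = 𝟘 , 𝟘
    1ᴱ = 𝟙 , 𝟘

    *ᴱ-comm : ∀ x y → x *ᴱ y ≡ y *ᴱ x
    *ᴱ-comm (a , b) (c , d) = cong₂ _,_
      (solve 4 (λ a b c d → a :* c :+ :- (b :* d) := c :* a :+ :- (d :* b)) refl a b c d)
      (solve 5 (λ u a b c d → a :* d :+ b :* c :+ u :* (b :* d) := c :* b :+ d :* a :+ u :* (d :* b)) refl u a b c d)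

    *ᴱ-assoc : ∀ x y z → (x *ᴱ y) *ᴱ z ≡ x *ᴱ (y *ᴱ z)
    *ᴱ-assoc (a , b) (c , d) (e , f) = cong₂ _,_
      (solve 7 (λ u a b c d e f →
        (a :* c :+ :- (b :* d)) :* e :+ :- ((a :* d :+ b :* c :+ u :* (b :* d)) :* f)
        := a :* (c :* e :+ :- (d :* f)) :+ :- (b :* (c :* f :+ d :* e :+ u :* (d :* f)))) refl u a b c d e f)
      (solve 7 (λ u a b c d e f →
        (a :* c :+ :- (b :* d)) :* f :+ (a :* d :+ b :* c :+ u :* (b :* d)) :* e :+ u :* ((a :* d :+ b :* c :+ u :* (b :* d)) :* f)
        := a :* (c :* f :+ d :* e :+ u :* (d :* f)) :+ b :* (c :* e :+ :- (d :* f)) :+ u :* (b :* (c :* f :+ d :* e :+ u :* (d :* f))))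
        refl u a b c d e f)

    *ᴱ-identityˡ : ∀ x → 1ᴱ *ᴱ x ≡ x
    *ᴱ-identityˡ (a , b) = cong₂ _,_
      (trans (solve 3 (λ o a b → o :* a :+ :- (con (ℤ.+ 0) :* b) := o :* a) refl 𝟙 a b) (⊗-identityˡ a))
      (trans (solve 4 (λ u o a b → o :* b :+ con (ℤ.+ 0) :* a :+ u :* (con (ℤ.+ 0) :* b) := o :* b) refl u 𝟙 a b) (⊗-identityˡ b))

    *ᴱ-distribˡ : ∀ x y z → x *ᴱ (y +ᴱ z) ≡ x *ᴱ y +ᴱ x *ᴱ z
    *ᴱ-distribˡ (a , b) (c , d) (e , f) = cong₂ _,_
      (solve 6 (λ a b c d e f → a :* (c :+ e) :+ :- (b :* (d :+ f))
        := (a :* c :+ :- (b :* d)) :+ (a :* e :+ :- (b :* f))) refl a b c d e f)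
      (solve 7 (λ u a b c d e f → a :* (d :+ f) :+ b :* (c :+ e) :+ u :* (b :* (d :+ f))
        := (a :* d :+ b :* c :+ u :* (b :* d)) :+ (a :* f :+ b :* e :+ u :* (b :* f))) refl u a b c d e f)

    -- The product of a + bt with its conjugate a + b(u - t), as t + (u - t) = u and t (u - t) = 1.
    norm : E → Carrier
    norm (a , b) = a ⊗ a ⊕ a ⊗ b ⊗ u ⊕ b ⊗ b

    -- If b ≠ 0 and the norm vanishes, dividing by b² shows -a/b to be a root of t² - ut + 1.
    norm≢0 : ∀ x → x ≢ 0ᴱ → norm x ≢ 𝟘
    norm≢0 (a , b) x≢0 N≡0 = case b ≟ 𝟘 of λ where
        (yes refl) → x≢0 (cong (_, 𝟘) (Sum.[ id , id ]′ (noZeroDivisors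
          (trans (solve 2 (λ u a → a :* a := a :* a :+ a :* con (ℤ.+ 0) :* u :+ con (ℤ.+ 0) :* con (ℤ.+ 0)) refl u a) N≡0))))
        (no b≢0) → case inverse b b≢0 of λ { (b⁻¹ , bb⁻¹) → irreducible (⊝ (a ⊗ b⁻¹)) (root b⁻¹ bb⁻¹) }
      where
      root : ∀ b⁻¹ → b ⊗ b⁻¹ ≡ 𝟙 → ⊝ (a ⊗ b⁻¹) ⊗ (u ⊕ ⊝ (⊝ (a ⊗ b⁻¹))) ≡ 𝟙
      root v bv = begin
        ⊝ (a ⊗ v) ⊗ (u ⊕ ⊝ (⊝ (a ⊗ v)))
          ≡⟨ cong (λ z → ⊝ (a ⊗ v) ⊗ (z ⊕ ⊝ (⊝ (a ⊗ v)))) (trans (cong (_⊗ u) bv) (⊗-identityˡ u)) ⟨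
        ⊝ (a ⊗ v) ⊗ (b ⊗ v ⊗ u ⊕ ⊝ (⊝ (a ⊗ v)))
          ≡⟨ solve 4 (λ u a b v → :- (a :* v) :* (b :* v :* u :+ :- (:- (a :* v)))
               := (b :* v) :* (b :* v) :+ :- (v :* v :* (a :* a :+ a :* b :* u :+ b :* b))) refl u a b v ⟩
        (b ⊗ v) ⊗ (b ⊗ v) ⊕ ⊝ (v ⊗ v ⊗ norm (a , b))
          ≡⟨ cong₂ (λ o z → o ⊗ o ⊕ ⊝ (v ⊗ v ⊗ z)) bv N≡0 ⟩
        𝟙 ⊗ 𝟙 ⊕ ⊝ (v ⊗ v ⊗ 𝟘)
          ≡⟨ solve 2 (λ o v → o :* o :+ :- (v :* v :* con (ℤ.+ 0)) := o :* o) refl 𝟙 v ⟩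
        𝟙 ⊗ 𝟙
          ≡⟨ ⊗-identityʳ 𝟙 ⟩
        𝟙 ∎
        where open ≡-Reasoning

    inverseᴱ : ∀ x → x ≢ 0ᴱ → ∃ λ y → x *ᴱ y ≡ 1ᴱ
    inverseᴱ x@(a , b) x≢0 = build (inverse (norm x) (norm≢0 x x≢0))
      where
      build : (∃ λ v → norm x ⊗ v ≡ 𝟙) → ∃ λ y → x *ᴱ y ≡ 1ᴱ
      -- The inverse is the conjugate (a + bu) - bt divided by the norm.
      build (v , Nv) = ((a ⊕ b ⊗ u) ⊗ v , ⊝ (b ⊗ v)) , cong₂ _,_
        (trans (solve 4 (λ u a b v → a :* ((a :+ b :* u) :* v) :+ :- (b :* :- (b :* v))
          := (a :* a :+ a :* b :* u :+ b :* b) :* v) refl u a b v) Nv)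
        (solve 4 (λ u a b v → a :* :- (b :* v) :+ b :* ((a :+ b :* u) :* v) :+ u :* (b :* :- (b :* v)) := con (ℤ.+ 0)) refl u a b v)

    extension : FiniteField (q * q)
    extension = record
      { Carrier = E ; _+_ = _+ᴱ_ ; _*_ = _*ᴱ_ ; -_ = -ᴱ_ ; 0# = 0ᴱ ; 1# = 1ᴱ
      ; isCommutativeRing = record
        { isRing = record
          { +-isAbelianGroup = record
            { isGroup = record
              { isMonoid = record
                { isSemigroup = record
                  { isMagma = record { isEquivalence = isEquivalence ; ∙-cong = cong₂ _+ᴱ_ }
                  ; assoc = λ { (a , b) (c , d) (e , f) → cong₂ _,_ (⊕-assoc a c e) (⊕-assoc b d f) } }
                ; identity = (λ { (a , b) → cong₂ _,_ (⊕-identityˡ a) (⊕-identityˡ b) })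
                           , (λ { (a , b) → cong₂ _,_ (⊕-identityʳ a) (⊕-identityʳ b) }) }
              ; inverse = (λ { (a , b) → cong₂ _,_ (⊕-inverseˡ a) (⊕-inverseˡ b) })
                        , (λ { (a , b) → cong₂ _,_ (⊕-inverseʳ a) (⊕-inverseʳ b) })
              ; ⁻¹-cong = cong -ᴱ_ }
            ; comm = λ { (a , b) (c , d) → cong₂ _,_ (⊕-comm a c) (⊕-comm b d) } }
          ; *-cong = cong₂ _*ᴱ_
          ; *-assoc = *ᴱ-assoc
          ; *-identity = *ᴱ-identityˡ , λ x → trans (*ᴱ-comm x 1ᴱ) (*ᴱ-identityˡ x)
          ; distrib = *ᴱ-distribˡ , λ x y z → trans (*ᴱ-comm (y +ᴱ z) x)
              (trans (*ᴱ-distribˡ x y z) (cong₂ _+ᴱ_ (*ᴱ-comm x y) (*ᴱ-comm x z))) }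
        ; *-comm = *ᴱ-comm }
      ; 0≢1 = λ eq → 0≢1 (cong proj₁ eq)
      ; inverse = inverseᴱ
      ; enumeration = ↔-sym Fin.*↔× ↔-∘ (enumeration ×-↔ enumeration) }

    embedding : FieldHom F extension
    embedding = record
      { ⟦_⟧ = _, 𝟘 ; hom-0 = refl ; hom-1 = refl
      ; hom-+ = λ x y → cong (x ⊕ y ,_) (sym (⊕-identityˡ 𝟘))
      ; hom-* = λ x y → cong₂ _,_
          (solve 2 (λ x y → x :* y := x :* y :+ :- (con (ℤ.+ 0) :* con (ℤ.+ 0))) refl x y)
          (solve 3 (λ u x y → con (ℤ.+ 0) := x :* con (ℤ.+ 0) :+ con (ℤ.+ 0) :* y :+ u :* (con (ℤ.+ 0) :* con (ℤ.+ 0))) refl u x y)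
      ; hom-- = λ x → cong (⊝ x ,_) (solve 0 (con (ℤ.+ 0) := :- (con (ℤ.+ 0))) refl) }

-- Abstract, since unfolding the concrete extension in the theorem is infeasible.
abstract
  quadraticExtension : ∀ p n (F : FiniteField (p ^ n)) → ∃ λ (K : FiniteField (p ^ (2 * n))) → FieldHom F K
  quadraticExtension p n F = subst (λ r → ∃ λ (K : FiniteField r) → FieldHom F K) q²≡ (extension , embedding)
    where
    open Construction F
    open Adjoin (proj₁ nonsplit) (proj₂ nonsplit)
    q²≡ : p ^ n * p ^ n ≡ p ^ (2 * n)
    q²≡ = trans (sym (^-distribˡ-+-* p n n)) (cong (λ k → p ^ (n + k)) (sym (+-identityʳ n)))

-- Fixed points and the theorem

even∨odd : ∀ n → 2 ∣ n ⊎ 2 ∣ suc n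
even∨odd zero = inj₁ (divides 0 refl)
even∨odd (suc n) with even∨odd n
... | inj₁ (divides k refl) = inj₂ (divides (suc k) refl)
... | inj₂ 2∣1+n = inj₁ 2∣1+n

odd⇒half : ∀ {n} → ¬ 2 ∣ n → n ≡ suc ((n ∸ 1) / 2 + (n ∸ 1) / 2)
odd⇒half {zero}  2∤0 = contradiction (divides 0 refl) 2∤0
odd⇒half {suc m} 2∤n with even∨odd m
... | inj₂ 2∣n = contradiction 2∣n 2∤n
... | inj₁ 2∣m = cong suc (sym (trans (cong (m / 2 +_) (sym (+-identityʳ (m / 2)))) (trans (*-comm 2 (m / 2)) (m/n*n≡m 2∣m))))

hasCard-cong : ∀ {q} {F : FiniteField q} {P Q : FiniteField.Carrier F → Set} {m} →
               (∀ x → P x → Q x) → (∀ x → Q x → P x) → HasCard F P m → HasCard F Q m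
hasCard-cong to from (xs , len , u , char) = xs , len , u , λ x → to x ∘ proj₁ (char x) , proj₂ (char x) ∘ from x

unionOfCycles-cong : ∀ {q} {F : FiniteField q} {ℓ} {P Q : FiniteField.Carrier F → Set} {k c} →
                     (∀ x → P x → Q x) → (∀ x → Q x → P x) → UnionOfCycles F ℓ P k c → UnionOfCycles F ℓ Q k c
unionOfCycles-cong {F = F} to from (closed , period , card) =
  (λ x Qx → to _ (closed x (from x Qx))) , (λ x Qx → period x (from x Qx)) , hasCard-cong {F = F} to from card

module _ {p n : ℕ} (p-prime : Prime p) (F : FiniteField (p ^ n)) (K : FiniteField (p ^ (2 * n))) (ι : FieldHom F K)
  {N N′ : ℕ} (tori : QuadraticExtension.Tori {n = n} p-prime F K ι N N′)
  (ω e : ℕ) (N≡ : N ≡ ω * 2 ^ e) (2⊥ω : Coprime 2 ω) where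
  open Embedding F K ι
  open Field K
  open QuadraticExtension.Tori tori

  -- 0 = i + i⁻¹ with i of order 4.
  zeroTree : ∀ {H} → e ≡ suc (suc H) → CompleteAryTree F 2 𝔽.𝟘 H
  zeroTree {H} e≡ = Dynamics.completeTree p-prime F K ι tori prime[2] ω e N≡ 2⊥ω e≡ i-param (↑-∣ {i} {4} i⁴ (divides (ω * 2 ^ H) N≡4)) i²≢1
      -- The level of i is 1, not 0: 4ω kills i, while 2ω does not because ω is odd. This is why the
      -- height is e - 2.
      (Dynamics.level (↑-∣ {i} {4} i⁴ (n∣m*n ω)) λ eq → prime-coprime⇒∤ prime[2] 2⊥ω (*-cancelʳ-∣ 2 (order-∣ i-order eq)))
    where
    N≡4 : N ≡ ω * 2 ^ H * 4
    N≡4 = trans N≡ (trans (cong (λ k → ω * 2 ^ k) e≡) (trans (cong (ω *_)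
      (trans (sym (*-assoc 2 2 (2 ^ H))) (*-comm 4 (2 ^ H)))) (sym (*-assoc ω (2 ^ H) 4))))
    i : Carrier
    i = θ ↑ (ω * 2 ^ H)
    i-order : MulOrder K i 4
    i-order = order-↑ (ω * 2 ^ H) (subst (MulOrder K θ) N≡4 θ-order)
    i⁴ : i ↑ 4 ≡ 𝟙
    i⁴ = proj₁ (proj₂ i-order)
    i²≢1 : i ↑ 2 ≢ 𝟙
    i²≢1 = proj₂ (proj₂ i-order) 2 (s≤s z≤n) (s≤s (s≤s (s≤s z≤n)))
    i²≡-1 : i ↑ 2 ⊕ 𝟙 ≡ 𝟘
    i²≡-1 = Sum.[ (λ eq → contradiction (⊝-zero⇒≡ eq) i²≢1) , id ]′ (noZeroDivisors {i ↑ 2 ⊕ ⊝ 𝟙} {i ↑ 2 ⊕ 𝟙} (begin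
      (i ↑ 2 ⊕ ⊝ 𝟙) ⊗ (i ↑ 2 ⊕ 𝟙)
        ≡⟨ solve 2 (λ x o → (x :+ :- o) :* (x :+ o) := x :* x :+ :- (o :* o)) refl (i ↑ 2) 𝟙 ⟩
      i ↑ 2 ⊗ i ↑ 2 ⊕ ⊝ (𝟙 ⊗ 𝟙)
        ≡⟨ cong₂ (λ u v → u ⊕ ⊝ v) (trans (sym (↑-+ i 2 2)) i⁴) (⊗-identityʳ 𝟙) ⟩
      𝟙 ⊕ ⊝ 𝟙
        ≡⟨ ⊕-inverseʳ 𝟙 ⟩
      𝟘 ∎))
      where open ≡-Reasoning
    i-param : Param 𝔽.𝟘 i
    i-param = ⊝ i
      , trans (solve 2 (λ i o → i :* :- i := o :+ :- (i :* i :+ o)) refl i 𝟙)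
          (trans (cong (λ z → 𝟙 ⊕ ⊝ z) (trans (cong (λ z → i ⊗ z ⊕ 𝟙) (sym (↑1 i))) i²≡-1))
            (solve 1 (λ o → o :+ :- con (ℤ.+ 0) := o) refl 𝟙))
      , trans hom-0 (sym (⊕-inverseʳ i))

prime-^-odd : ∀ {p} → Prime p → p ≢ 2 → ∀ n → ¬ 2 ∣ p ^ n
prime-^-odd pr p≢2 n 2∣ = prime-coprime⇒∤ prime[2] (Coprimality.sym (coprime-^ˡ n (Coprimality.sym (prime-∤⇒coprime prime[2] 2∤p)))) 2∣
  where
  2∤p : ¬ 2 ∣ _
  2∤p 2∣p = Sum.[ (λ ()) , (λ 2≡p → p≢2 (sym 2≡p)) ]′ (prime⇒irreducible pr 2∣p)

exponent-4∣ : ∀ {N} l {w} → N ≡ 2 ^ l * w → Coprime 2 w → 4 ∣ N → 2 ≤ l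
exponent-4∣ zero {w} N≡ 2⊥w 4∣N = contradiction
  (∣-trans (divides 2 refl) (subst (4 ∣_) (trans N≡ (+-identityʳ w)) 4∣N)) (prime-coprime⇒∤ prime[2] 2⊥w)
exponent-4∣ (suc zero) {w} N≡ 2⊥w 4∣N = contradiction
  (*-cancelˡ-∣ 2 (subst (4 ∣_) N≡ 4∣N)) (prime-coprime⇒∤ prime[2] 2⊥w)
exponent-4∣ (suc (suc l)) _ _ _ = s≤s (s≤s z≤n)

exponent-4∤ : ∀ {N} l {w} → N ≡ 2 ^ l * w → ¬ 4 ∣ N → l ≤ 1
exponent-4∤ zero _ _ = z≤n
exponent-4∤ (suc zero) _ _ = s≤s z≤n
exponent-4∤ (suc (suc l)) {w} N≡ 4∤N = contradiction
  (subst (4 ∣_) (sym (trans N≡ (trans (cong (_* w) (sym (*-assoc 2 2 (2 ^ l)))) (*-assoc 4 (2 ^ l) w)))) (m∣m*n (2 ^ l * w))) 4∤N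

even⇒4∣ : ∀ {m} → 2 ∣ m → 4 ∣ m ⊎ 4 ∣ 2 + m
even⇒4∣ (divides k refl) = Sum.map double double (even∨odd k)
  where
  double : ∀ {k} → 2 ∣ k → 4 ∣ k * 2
  double = *-monoˡ-∣ 2

-- For odd q exactly one of q - 1 and q + 1 is divisible by 4. The other has exponent at most 1, so
-- the maximum is attained by the group that contains an element of order 4.
binary-zeroTree : ∀ {p n} → Prime p → p ≢ 2 → (F : FiniteField (p ^ n)) (K : FiniteField (p ^ (2 * n))) → FieldHom F K →
  ∀ {lm wm lp wp} → p ^ n ∸ 1 ≡ 2 ^ lm * wm → Coprime 2 wm → p ^ n + 1 ≡ 2 ^ lp * wp → Coprime 2 wp →
  CompleteAryTree F 2 (FiniteField.0# F) ((lm ⊔ lp) ∸ 2)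
binary-zeroTree {p} {n} p-prime p≢2 F K ι {lm} {wm} {lp} {wp} q-1≡ 2⊥wm q+1≡ 2⊥wp =
  Sum.[ split , nonsplit ]′ (even⇒4∣ 2∣q-1)
  where
  open QuadraticExtension {n = n} p-prime F K ι using (tori; tori-swapped)
  1≤q : 1 ≤ p ^ n
  1≤q = >-nonZero⁻¹ (p ^ n) {{m^n≢0 p n {{prime⇒nonZero p-prime}}}}
  2+ : 2 + (p ^ n ∸ 1) ≡ p ^ n + 1
  2+ = trans (cong suc (m+[n∸m]≡n 1≤q)) (+-comm 1 (p ^ n))
  2∣q-1 : 2 ∣ p ^ n ∸ 1
  2∣q-1 = Sum.[ id , (λ 2∣q → contradiction (subst (2 ∣_) (m+[n∸m]≡n 1≤q) 2∣q) (prime-^-odd p-prime p≢2 n)) ]′ (even∨odd (p ^ n ∸ 1))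
  not-both : 4 ∣ p ^ n ∸ 1 → ¬ 4 ∣ p ^ n + 1
  not-both 4∣- 4∣+ = <⇒≱ (s≤s (s≤s (s≤s z≤n))) (∣⇒≤ (∣m+n∣m⇒∣n (subst (4 ∣_) (trans (sym 2+) (+-comm 2 (p ^ n ∸ 1))) 4∣+) 4∣-))
  split : 4 ∣ p ^ n ∸ 1 → CompleteAryTree F 2 (FiniteField.0# F) ((lm ⊔ lp) ∸ 2)
  split 4∣ = subst (λ l → CompleteAryTree F 2 (FiniteField.0# F) (l ∸ 2)) (sym (m≥n⇒m⊔n≡m (≤-trans (exponent-4∤ lp q+1≡ (not-both 4∣)) (<⇒≤ 2≤lm))))
    (zeroTree {n = n} p-prime F K ι tori wm lm (trans q-1≡ (*-comm (2 ^ lm) wm)) 2⊥wm (sym (m+[n∸m]≡n 2≤lm)))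
    where
    2≤lm : 2 ≤ lm
    2≤lm = exponent-4∣ lm q-1≡ 2⊥wm 4∣
  nonsplit : 4 ∣ 2 + (p ^ n ∸ 1) → CompleteAryTree F 2 (FiniteField.0# F) ((lm ⊔ lp) ∸ 2)
  nonsplit 4∣2+ = subst (λ l → CompleteAryTree F 2 (FiniteField.0# F) (l ∸ 2)) (sym (m≤n⇒m⊔n≡n (≤-trans (exponent-4∤ lm q-1≡ (λ 4∣- → not-both 4∣- 4∣)) (<⇒≤ 2≤lp))))
    (zeroTree {n = n} p-prime F K ι tori-swapped wp lp (trans q+1≡ (*-comm (2 ^ lp) wp)) 2⊥wp (sym (m+[n∸m]≡n 2≤lp)))
    where
    4∣ : 4 ∣ p ^ n + 1
    4∣ = subst (4 ∣_) 2+ 4∣2+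
    2≤lp : 2 ≤ lp
    2≤lp = exponent-4∣ lp q+1≡ 2⊥wp 4∣

module Parts {ℓ p n : ℕ} (ℓ-prime : Prime ℓ) (p-prime : Prime p) (F : FiniteField (p ^ n))
  (K : FiniteField (p ^ (2 * n))) (ι : FieldHom F K) {lm wm lp wp : ℕ}
  (q-1≡ : p ^ n ∸ 1 ≡ ℓ ^ lm * wm) (ℓ⊥wm : Coprime ℓ wm) (q+1≡ : p ^ n + 1 ≡ ℓ ^ lp * wp) (ℓ⊥wp : Coprime ℓ wp) where
  open Embedding F K ι
  open ChebyshevAction F K ι
  open Field K
  open QuadraticExtension {n = n} p-prime F K ι using (tori; tori-swapped; F-unit-torsion)

  private
    N₋≡ : p ^ n ∸ 1 ≡ wm * ℓ ^ lm
    N₋≡ = trans q-1≡ (*-comm (ℓ ^ lm) wm)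
    N₊≡ : p ^ n + 1 ≡ wp * ℓ ^ lp
    N₊≡ = trans q+1≡ (*-comm (ℓ ^ lp) wp)

  split-cycles : ∀ d c → 2 < d → d ∣ wm → IsCOrder ℓ d c →
      ∃ λ k → k * (2 * c) ≡ totient d
        × UnionOfCycles F ℓ (ConjSum F d) k c
        × (1 ≤ lm → ∀ x → ConjSum F d x → HangingTrees F ℓ x (ℓ ∸ 1) (lm ∸ 1))
  split-cycles d c 2<d d∣wm cOrder =
    proj₁ cycles , proj₁ (proj₂ cycles) , unionOfCycles-cong {F = F} {k = proj₁ cycles} from to (proj₂ (proj₂ cycles))
    , λ 1≤lm x cs → Cycles.orderSum-trees p-prime F K ι tori ℓ-prime wm lm N₋≡ ℓ⊥wm 2<d d∣wm cOrder 1≤lm x (to x cs)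
    where
    cycles : ∃ λ k → k * (2 * c) ≡ totient d × UnionOfCycles F ℓ (OrderSum d) k c
    cycles = Cycles.orderSum-cycles p-prime F K ι tori ℓ-prime wm lm N₋≡ ℓ⊥wm 2<d d∣wm cOrder
    to : ∀ x → ConjSum F d x → OrderSum d x
    to x (α , β , αβ , o , x≡) = ⟦ α ⟧ , ι-order o , ⟦ β ⟧ , trans (sym (hom-* α β)) (trans (cong ⟦_⟧ αβ) hom-1)
      , trans (cong ⟦_⟧ x≡) (hom-+ α β)
    -- As d divides q - 1, both α and α⁻¹ are killed by q - 1 and so come from F.
    from : ∀ x → OrderSum d x → ConjSum F d x
    from x (α , o , β , αβ , x≡) = descend (F-unit-torsion αN) (F-unit-torsion (inverse-↑≡1 {n = p ^ n ∸ 1} αβ αN))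
      where
      αN : α ↑ (p ^ n ∸ 1) ≡ 𝟙
      αN = ↑-∣ {α} {d} (proj₁ (proj₂ o)) (subst (d ∣_) (sym N₋≡) (∣m⇒∣m*n (ℓ ^ lm) d∣wm))
      descend : (∃ λ a → ⟦ a ⟧ ≡ α) → (∃ λ b → ⟦ b ⟧ ≡ β) → ConjSum F d x
      descend (a , a≡) (b , b≡) = a , b
        , ι-injective (trans (hom-* a b) (trans (cong₂ _⊗_ a≡ b≡) (trans αβ (sym hom-1))))
        , ι-order⁻ (subst (λ γ → MulOrder K γ d) (sym a≡) o)
        , ι-injective (trans x≡ (sym (trans (hom-+ a b) (cong₂ _⊕_ a≡ b≡))))

  nonsplit-cycles : ∀ d c → 2 < d → d ∣ wp → IsCOrder ℓ d c →
      ∃ λ k → k * (2 * c) ≡ totient d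
        × UnionOfCycles F ℓ (ConjSumExt F K ι (p ^ n + 1) d) k c
        × (1 ≤ lp → ∀ x → ConjSumExt F K ι (p ^ n + 1) d x → HangingTrees F ℓ x (ℓ ∸ 1) (lp ∸ 1))
  nonsplit-cycles d c 2<d d∣wp cOrder =
    proj₁ cycles , proj₁ (proj₂ cycles) , unionOfCycles-cong {F = F} {k = proj₁ cycles} from to (proj₂ (proj₂ cycles))
    , λ 1≤lp x cs → Cycles.orderSum-trees p-prime F K ι tori-swapped ℓ-prime wp lp N₊≡ ℓ⊥wp 2<d d∣wp cOrder 1≤lp x (to x cs)
    where
    cycles : ∃ λ k → k * (2 * c) ≡ totient d × UnionOfCycles F ℓ (OrderSum d) k c
    cycles = Cycles.orderSum-cycles p-prime F K ι tori-swapped ℓ-prime wp lp N₊≡ ℓ⊥wp 2<d d∣wp cOrder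
    to : ∀ x → ConjSumExt F K ι (p ^ n + 1) d x → OrderSum d x
    to x (α , β , αβ , _ , o , x≡) = α , o , β , αβ , x≡
    from : ∀ x → OrderSum d x → ConjSumExt F K ι (p ^ n + 1) d x
    from x (α , o , β , αβ , x≡) = α , β , αβ , ↑-∣ {α} {d} (proj₁ (proj₂ o)) (subst (d ∣_) (sym N₊≡) (∣m⇒∣m*n (ℓ ^ lp) d∣wp)) , o , x≡

  private
    2F -2F : 𝔽.Carrier
    2F = two F
    -2F = 𝔽.⊝ 2F

    𝟙² : 𝟙 ↑ 2 ≡ 𝟙
    𝟙² = 𝟙↑ 2

    ⊝𝟙² : (⊝ 𝟙) ⊗ (⊝ 𝟙) ≡ 𝟙
    ⊝𝟙² = trans (solve 1 (λ o → :- o :* :- o := o :* o) refl 𝟙) (⊗-identityˡ 𝟙)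

    ⊝𝟙↑2 : (⊝ 𝟙) ↑ 2 ≡ 𝟙
    ⊝𝟙↑2 = trans (cong (⊝ 𝟙 ⊗_) (↑1 (⊝ 𝟙))) ⊝𝟙²

    2-param : Param 2F 𝟙
    2-param = 𝟙 , ⊗-identityˡ 𝟙 , trans (hom-+ _ _) (cong₂ _⊕_ hom-1 hom-1)

    -2-param : Param -2F (⊝ 𝟙)
    -2-param = ⊝ 𝟙 , ⊝𝟙² , trans (hom-- 2F) (trans (cong ⊝_ (proj₂ (proj₂ 2-param))) (solve 1 (λ o → :- (o :+ o) := :- o :+ :- o) refl 𝟙))

    1<ℓ : 1 < ℓ
    1<ℓ = nonTrivial⇒n>1 ℓ {{prime⇒nonTrivial ℓ-prime}}

    1≤q : 1 ≤ p ^ n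
    1≤q = >-nonZero⁻¹ (p ^ n) {{m^n≢0 p n {{prime⇒nonZero p-prime}}}}

    q+1≡2+ : p ^ n + 1 ≡ p ^ n ∸ 1 + 2
    q+1≡2+ = trans (cong (_+ 1) (sym (m∸n+n≡m 1≤q))) (+-assoc (p ^ n ∸ 1) 1 1)

  T-two : T F ℓ 2F ≡ 2F
  T-two = param-unique (T-param ℓ 2-param) (subst (Param 2F) (sym (𝟙↑ ℓ)) 2-param)

  T-minus-two-odd : ¬ 2 ∣ ℓ → T F ℓ -2F ≡ -2F
  T-minus-two-odd odd = param-unique (T-param ℓ -2-param) (subst (Param -2F) (sym (trans (cong ((⊝ 𝟙) ↑_) (odd⇒half odd)) (↑-odd ⊝𝟙↑2 ((ℓ ∸ 1) / 2)))) -2-param)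

  T-minus-two-even : 2 ∣ ℓ → T F ℓ -2F ≡ 2F
  T-minus-two-even 2∣ℓ = param-unique (T-param ℓ -2-param) (subst (Param 2F) (sym (↑-∣ {⊝ 𝟙} {2} ⊝𝟙↑2 2∣ℓ)) 2-param)

  T-zero : ℓ ≡ 2 → T F ℓ 𝔽.𝟘 ≡ -2F
  T-zero refl = trans (cong (𝔽._⊕ -2F) (𝔽.⊗-zeroˡ 𝔽.𝟘)) (𝔽.⊕-identityˡ -2F)

  private
    ℓ∣N : ∀ {N l w} → N ≡ ℓ ^ l * w → 1 ≤ l → ℓ ∣ N
    ℓ∣N {l = suc l} {w} N≡ _ = subst (ℓ ∣_) (sym (trans N≡ (*-assoc ℓ (ℓ ^ l) w))) (m∣m*n (ℓ ^ l * w))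

    not-both : ¬ 2 ∣ ℓ → ℓ ∣ p ^ n ∸ 1 → ¬ ℓ ∣ p ^ n + 1
    not-both odd ℓ∣- ℓ∣+ = odd (subst (2 ∣_) (≤-antisym 1<ℓ (∣⇒≤ (∣m+n∣m⇒∣n (subst (ℓ ∣_) q+1≡2+ ℓ∣+) ℓ∣-))) ∣-refl)

  -- q - 1 and q + 1 differ by 2, so an odd ℓ divides at most one of them. That one carries the
  -- trees and its exponent is the maximum; γ = ±1 belongs to its group in either case.
  fixed-trees : ¬ 2 ∣ ℓ → 1 ≤ lm ⊔ lp → ∀ {v γ} → Param v γ → γ ↑ 2 ≡ 𝟙 → HangingTrees F ℓ v ((ℓ ∸ 1) / 2) ((lm ⊔ lp) ∸ 1)
  fixed-trees odd 1≤ {v} pv γ² = cases lm lp refl refl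
    where
    cases : ∀ a b → lm ≡ a → lp ≡ b → HangingTrees F ℓ v ((ℓ ∸ 1) / 2) ((lm ⊔ lp) ∸ 1)
    cases zero zero lm≡ lp≡ = contradiction (subst (1 ≤_) (cong₂ _⊔_ lm≡ lp≡) 1≤) λ ()
    cases (suc a) zero lm≡ lp≡ = subst (HangingTrees F ℓ v _) (cong (_∸ 1) (sym (cong₂ _⊔_ lm≡ lp≡)))
      (Dynamics.hangingTrees-involution p-prime F K ι tori ℓ-prime wm lm N₋≡ ℓ⊥wm lm≡ (odd⇒half odd)
        (prime-∤⇒coprime ℓ-prime (not-both odd (ℓ∣N q-1≡ (subst (1 ≤_) (sym lm≡) (s≤s z≤n))))) pv γ²)
    cases zero (suc b) lm≡ lp≡ = subst (HangingTrees F ℓ v _) (cong (_∸ 1) (sym (cong₂ _⊔_ lm≡ lp≡)))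
      (Dynamics.hangingTrees-involution p-prime F K ι tori-swapped ℓ-prime wp lp N₊≡ ℓ⊥wp lp≡ (odd⇒half odd)
        (prime-∤⇒coprime ℓ-prime (λ ℓ∣- → not-both odd ℓ∣- (ℓ∣N q+1≡ (subst (1 ≤_) (sym lp≡) (s≤s z≤n))))) pv γ²)
    cases (suc a) (suc b) lm≡ lp≡ = contradiction (ℓ∣N q+1≡ (subst (1 ≤_) (sym lp≡) (s≤s z≤n)))
      (not-both odd (ℓ∣N q-1≡ (subst (1 ≤_) (sym lm≡) (s≤s z≤n))))

  odd-fixed-points : ¬ (2 ∣ ℓ) →
        T F ℓ (two F) ≡ two F
        × T F ℓ (FiniteField.-_ F (two F)) ≡ FiniteField.-_ F (two F)
        × (1 ≤ lm ⊔ lp →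
             HangingTrees F ℓ (two F) ((ℓ ∸ 1) / 2) ((lm ⊔ lp) ∸ 1)
             × HangingTrees F ℓ (FiniteField.-_ F (two F)) ((ℓ ∸ 1) / 2) ((lm ⊔ lp) ∸ 1))
  odd-fixed-points odd = T-two , T-minus-two-odd odd
    , λ 1≤ → fixed-trees odd 1≤ 2-param 𝟙² , fixed-trees odd 1≤ -2-param ⊝𝟙↑2

  even-fixed-points : ℓ ≡ 2 → p ≢ ℓ →
        T F ℓ (two F) ≡ two F
        × T F ℓ (FiniteField.-_ F (two F)) ≡ two F
        × T F ℓ (FiniteField.0# F) ≡ FiniteField.-_ F (two F)
        × CompleteAryTree F ℓ (FiniteField.0# F) ((lm ⊔ lp) ∸ 2)
  even-fixed-points refl p≢2 = T-two , T-minus-two-even ∣-refl , T-zero refl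
    , binary-zeroTree {n = n} p-prime p≢2 F K ι {lm} {wm} {lp} {wp} q-1≡ ℓ⊥wm q+1≡ ℓ⊥wp

theorem2p3 : (ℓ p n : ℕ) → Prime ℓ → Prime p → p ≢ ℓ → 1 ≤ n →
    (F : FiniteField (p ^ n)) →
    (lm wm lp wp : ℕ) →
    p ^ n ∸ 1 ≡ ℓ ^ lm * wm → Coprime ℓ wm →
    p ^ n + 1 ≡ ℓ ^ lp * wp → Coprime ℓ wp →
    -- (1)
    (∀ d c → 2 < d → d ∣ wm → IsCOrder ℓ d c →
      ∃ λ k → k * (2 * c) ≡ totient d
        × UnionOfCycles F ℓ (ConjSum F d) k c
        × (1 ≤ lm → ∀ x → ConjSum F d x → HangingTrees F ℓ x (ℓ ∸ 1) (lm ∸ 1)))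
    -- (2)
    × ((K : FiniteField (p ^ (2 * n))) → (ι : FieldHom F K) →
      ∀ d c → 2 < d → d ∣ wp → IsCOrder ℓ d c →
      ∃ λ k → k * (2 * c) ≡ totient d
        × UnionOfCycles F ℓ (ConjSumExt F K ι (p ^ n + 1) d) k c
        × (1 ≤ lp → ∀ x → ConjSumExt F K ι (p ^ n + 1) d x →
             HangingTrees F ℓ x (ℓ ∸ 1) (lp ∸ 1)))
    -- (3)
    × (¬ (2 ∣ ℓ) →
        T F ℓ (two F) ≡ two F
        × T F ℓ (FiniteField.-_ F (two F)) ≡ FiniteField.-_ F (two F)
        × (1 ≤ lm ⊔ lp →
             HangingTrees F ℓ (two F) ((ℓ ∸ 1) / 2) ((lm ⊔ lp) ∸ 1)
             × HangingTrees F ℓ (FiniteField.-_ F (two F)) ((ℓ ∸ 1) / 2) ((lm ⊔ lp) ∸ 1)))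
    -- (4)
    × (ℓ ≡ 2 →
        T F ℓ (two F) ≡ two F
        × T F ℓ (FiniteField.-_ F (two F)) ≡ two F
        × T F ℓ (FiniteField.0# F) ≡ FiniteField.-_ F (two F)
        × CompleteAryTree F ℓ (FiniteField.0# F) ((lm ⊔ lp) ∸ 2))
theorem2p3 ℓ p n ℓ-prime p-prime p≢ℓ 1≤n F lm wm lp wp q-1≡ ℓ⊥wm q+1≡ ℓ⊥wp =
    Parts.split-cycles {n = n} ℓ-prime p-prime F K ι {lm} {wm} {lp} {wp} q-1≡ ℓ⊥wm q+1≡ ℓ⊥wp
  , (λ K′ ι′ → Parts.nonsplit-cycles {n = n} ℓ-prime p-prime F K′ ι′ {lm} {wm} {lp} {wp} q-1≡ ℓ⊥wm q+1≡ ℓ⊥wp)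
  , Parts.odd-fixed-points {n = n} ℓ-prime p-prime F K ι {lm} {wm} {lp} {wp} q-1≡ ℓ⊥wm q+1≡ ℓ⊥wp
  , λ ℓ≡2 → Parts.even-fixed-points {n = n} ℓ-prime p-prime F K ι {lm} {wm} {lp} {wp} q-1≡ ℓ⊥wm q+1≡ ℓ⊥wp ℓ≡2 p≢ℓ
  where
  -- An auxiliary extension for the claims that speak of F alone; the claim about the group of order
  -- q + 1 is proved for the extension given there.
  K : FiniteField (p ^ (2 * n))
  K = proj₁ (quadraticExtension p n F)
  ι : FieldHom F K
  ι = proj₂ (quadraticExtension p n F)
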